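{- For all integers $n\ge 0$, $$c\phi_{18}(3n+1)\equiv 0\pmod{81},\qquad c\phi_{18}(3n+2)\equiv 0\pmod{2187}.$$
   Context: For a positive integer $k$ and an integer $n\ge 0$, $c\phi_k(n)$ denotes the number of $k$-colored generalized Frobenius partitions of $n$ (Andrews): two-rowed arrays $\begin{pmatrix} a_1 & a_2 & \cdots & a_r\\ b_1 & b_2 & \cdots & b_r\end{pmatrix}$ (with $r\ge 0$) in which every entry is a non-negative integer carrying one of $k$ colors, no integer occurs twice in the same color in the same row, each row is arranged in non-increasing order (equal integers being ordered by a fixed order on colors, so that a row is just a set of $r$ colored non-negative integers), and $n=r+\sum_{j=1}^r(a_j+b_j)$ (colors do not contribute to the sum). Equivalently, $\sum_{n\ge0}c\phi_k(n)q^n$ is the coefficient of $z^0$ in $\prod_{j\ge 0}(1+zq^{j+1})^k(1+z^{ -1}q^{j})^k$. -}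

module Defs where

open import Data.Fin.Base as Fin using (Fin)
import Data.Fin.Properties as Fin
open import Data.List.Base
  using (List; []; _∷_; _++_; map; filter; length; allFin; downFrom; cartesianProduct)
open import Data.List.Membership.Propositional using (_∈_)
open import Data.List.Membership.Propositional.Properties
  using (∈-map⁺; ∈-map⁻; ∈-++⁺ˡ; ∈-++⁺ʳ; ∈-++⁻; ∈-filter⁺; ∈-filter⁻;
         ∈-cartesianProduct⁺; ∈-downFrom⁺; ∈-allFin; ∈-map∷⁻)
open import Data.List.Properties using (∷-injectiveʳ)
open import Data.List.Relation.Binary.Subset.Propositional using (_⊆_)
open import Data.List.Relation.Unary.All as All using (All; []; _∷_)
import Data.List.Relation.Unary.All.Properties as All
open import Data.List.Relation.Unary.AllPairs using (AllPairs; []; _∷_; allPairs?)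
import Data.List.Relation.Unary.AllPairs.Properties as AllPairs
open import Data.List.Relation.Unary.Any using (here; there)
open import Data.List.Relation.Unary.Unique.Propositional using (Unique)
import Data.List.Relation.Unary.Unique.Propositional.Properties as Unique
open import Data.Nat.Base using (ℕ; _+_; _≤_; _<_; _>_; s≤s)
open import Data.Nat.ListAction using (sum)
open import Data.Nat.Properties
  using (_≟_; _>?_; <-trans; <-irrefl; ≤-trans; ≤-reflexive; m≤m+n; m≤n+m; +-mono-≤)
open import Data.Product.Base using (_×_; _,_; proj₁; proj₂)
open import Data.Product.Relation.Binary.Lex.Strict using (×-Lex; ×-decidable; ×-transitive)
open import Data.Sum.Base using (inj₁; inj₂)
open import Function.Base using (flip; _∘_)
open import Relation.Binary.Core using (Rel)
open import Relation.Binary.Definitions using (Decidable; Transitive)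
open import Relation.Binary.PropositionalEquality
  using (_≡_; refl; sym; subst; setoid; isEquivalence)
open import Relation.Nullary using (¬_; contradiction)
open import Relation.Nullary.Decidable using (_×-dec_)
import Relation.Unary as U

------------------------------------------------------------------------
-- Generalized Frobenius partitions

Entry : ℕ → Set
Entry k = ℕ × Fin k

-- Decreasing integers; equal integers are listed by increasing color.
infix 4 _≻_ _≻?_
_≻_ : ∀ {k} → Rel (Entry k) _
_≻_ = ×-Lex _≡_ _>_ Fin._<_

-- Strictness of _≻_ forbids a repetition of an integer in the same color.
IsRow : ∀ {k} → List (Entry k) → Set
IsRow = AllPairs _≻_

rowSum : ∀ {k} → List (Entry k) → ℕ
rowSum as = sum (map proj₁ as)

-- A pair (as , bs) is the array with top row as and bottom row bs.
Array : ℕ → Set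
Array k = List (Entry k) × List (Entry k)

IsFrobenius : ∀ {k} → ℕ → Array k → Set
IsFrobenius n (as , bs) =
  IsRow as × IsRow bs × length as ≡ length bs ×
  n ≡ length as + (rowSum as + rowSum bs)

_≻?_ : ∀ {k} → Decidable (_≻_ {k})
_≻?_ = ×-decidable _≟_ _>?_ Fin._<?_

isFrobenius? : ∀ {k} n → U.Decidable (IsFrobenius {k} n)
isFrobenius? n (as , bs) =
  allPairs? _≻?_ as ×-dec allPairs? _≻?_ bs ×-dec
  (length as ≟ length bs) ×-dec (n ≟ length as + (rowSum as + rowSum bs))

------------------------------------------------------------------------
-- Enumeration

sublists : {A : Set} → List A → List (List A)
sublists []       = [] ∷ []
sublists (x ∷ xs) = map (x ∷_) (sublists xs) ++ sublists xs

entriesBelow : ∀ k → ℕ → List (Entry k)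
entriesBelow k m = cartesianProduct (downFrom m) (allFin k)

-- An entry of an array counted by n is less than n, because the array has
-- at least one column; so every such array occurs among these candidates.
candidates : ∀ k → ℕ → List (Array k)
candidates k n = cartesianProduct rows rows
  where rows = sublists (entriesBelow k n)

frobeniusPartitions : ∀ k → ℕ → List (Array k)
frobeniusPartitions k n = filter (isFrobenius? n) (candidates k n)

-- That this length is the number of arrays satisfying IsFrobenius n is the
-- content of sound, complete and unique below.
cφ : ℕ → ℕ → ℕ
cφ k n = length (frobeniusPartitions k n)

------------------------------------------------------------------------
-- Correctness of the enumeration

≻-trans : ∀ {k} → Transitive (_≻_ {k})
≻-trans {k} {x} {y} {z} =
  ×-transitive {_<₂_ = Fin._<_} isEquivalence
    ((λ { refl p → p }) , (λ { refl p → p })) (flip <-trans) Fin.<-trans {x} {y} {z}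

≻-irrefl : ∀ {k} {x : Entry k} → ¬ (x ≻ x)
≻-irrefl (inj₁ p)       = <-irrefl refl p
≻-irrefl (inj₂ (_ , p)) = Fin.<-irrefl refl p

entriesBelow-isRow : ∀ k m → IsRow (entriesBelow k m)
entriesBelow-isRow k m = go (AllPairs.applyDownFrom⁺₁ (λ i → i) m (λ j<i _ → j<i))
  where
  go : ∀ {is} → AllPairs _>_ is → IsRow (cartesianProduct is (allFin k))
  go []         = []
  go {i ∷ is} (p ∷ ps) = AllPairs.++⁺
    (AllPairs.map⁺ (AllPairs.tabulate⁺-< (λ c<d → inj₂ (refl , c<d))))
    (go ps)
    (All.map⁺ (All.tabulate λ _ → All.cartesianProduct⁺
      (setoid ℕ) (setoid (Fin k)) is (allFin k)
      (λ j∈is _ → inj₁ (All.lookup p j∈is))))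

∈-sublists : ∀ {k} {xs ys : List (Entry k)} →
             IsRow xs → IsRow ys → xs ⊆ ys → xs ∈ sublists ys
∈-sublists {xs = []}     {[]}     _ _ _ = here refl
∈-sublists {xs = x ∷ xs} {[]}     _ _ s with () ← s (here refl)
∈-sublists {xs = []}     {y ∷ ys} r (_ ∷ q) s =
  ∈-++⁺ʳ (map (y ∷_) (sublists ys)) (∈-sublists r q λ ())
∈-sublists {xs = x ∷ xs} {y ∷ ys} (p ∷ r) (q ∷ r′) s with s (here refl)
... | here refl = ∈-++⁺ˡ (∈-map⁺ (y ∷_) (∈-sublists r r′ tail))
  where
  tail : xs ⊆ ys
  tail z∈xs with s (there z∈xs)
  ... | here refl  = contradiction (All.lookup p z∈xs) ≻-irrefl
  ... | there z∈ys = z∈ys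
... | there x∈ys = ∈-++⁺ʳ (map (y ∷_) (sublists ys)) (∈-sublists (p ∷ r) r′ all)
  where
  y≻x : y ≻ x
  y≻x = All.lookup q x∈ys
  all : (x ∷ xs) ⊆ ys
  all (here refl) = x∈ys
  all (there z∈xs) with s (there z∈xs)
  ... | here refl  = contradiction (≻-trans {i = y} {x} {y} y≻x (All.lookup p z∈xs)) ≻-irrefl
  ... | there z∈ys = z∈ys

sublists-⊆ : {A : Set} {xs : List A} (ys : List A) → xs ∈ sublists ys → xs ⊆ ys
sublists-⊆ []       (here refl) = λ z → z
sublists-⊆ (y ∷ ys) p with ∈-++⁻ (map (y ∷_) (sublists ys)) p
... | inj₂ q = there ∘ sublists-⊆ ys q
... | inj₁ q with _ , r , refl ← ∈-map⁻ (y ∷_) q =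
  λ { (here e) → here e ; (there t) → there (sublists-⊆ ys r t) }

sublists-unique : {A : Set} {xs : List A} → Unique xs → Unique (sublists xs)
sublists-unique {xs = []}     _ = [] ∷ []
sublists-unique {xs = x ∷ xs} (p ∷ u) = Unique.++⁺
  (Unique.map⁺ ∷-injectiveʳ (sublists-unique u)) (sublists-unique u)
  (λ (a , b) → All.lookup p (sublists-⊆ xs b (∈-map∷⁻ a)) refl)

∈-rowSum : ∀ {k} {x : Entry k} {as} → x ∈ as → proj₁ x < length as + rowSum as
∈-rowSum {as = a ∷ as} (here refl) =
  s≤s (≤-trans (m≤m+n (proj₁ a) (rowSum as)) (m≤n+m _ (length as)))
∈-rowSum {as = a ∷ as} (there p) =
  ≤-trans (∈-rowSum p)
    (+-mono-≤ (m≤n+m (length as) 1) (m≤n+m (rowSum as) (proj₁ a)))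

∈-rows : ∀ {k n} {as : List (Entry k)} →
         IsRow as → length as + rowSum as ≤ n → as ∈ sublists (entriesBelow k n)
∈-rows {k} {n} r le = ∈-sublists r (entriesBelow-isRow k n) λ x∈as →
  ∈-cartesianProduct⁺ (∈-downFrom⁺ (≤-trans (∈-rowSum x∈as) le)) (∈-allFin _)

sound : ∀ {k n} {π : Array k} → π ∈ frobeniusPartitions k n → IsFrobenius n π
sound {k} {n} p = proj₂ (∈-filter⁻ (isFrobenius? n) {xs = candidates k n} p)

complete : ∀ {k n} {π : Array k} → IsFrobenius n π → π ∈ frobeniusPartitions k n
complete {k} {n} {as , bs} f@(ra , rb , l , w) = ∈-filter⁺ (isFrobenius? n)
  (∈-cartesianProduct⁺
    (∈-rows ra (bound (m≤m+n _ _)))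
    (∈-rows rb (subst (λ r → r + rowSum bs ≤ n) l (bound (m≤n+m _ _)))))
  f
  where
  bound : ∀ {s} → s ≤ rowSum as + rowSum bs → length as + s ≤ n
  bound le = ≤-trans (+-mono-≤ (≤-reflexive {length as} refl) le) (≤-reflexive (sym w))

unique : ∀ k n → Unique (frobeniusPartitions k n)
unique k n = Unique.filter⁺ (isFrobenius? n) (Unique.cartesianProduct⁺ rows! rows!)
  where
  rows! : Unique (sublists (entriesBelow k n))
  rows! = sublists-unique
    (Unique.cartesianProduct⁺ (Unique.downFrom⁺ n) (Unique.allFin⁺ k))

{-# OPTIONS --safe #-}
-- Write q = Q⁶ and P(q) = ∏ 1 / (1 - qʲ). By Jacobi's triple product, the generating
-- function of cφ₁₈ is the constant term in z of P(q)¹⁸ ϑ¹⁸, where ϑ = Σ zᵐ Q^(3m²).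
-- Splitting ℤ³ according to the sum of the coordinates modulo 3 gives
-- ϑ³ = a x₀ + c (x₁ + x₂) with x_r = Σ_{n ≡ r} zⁿ Q^(n²) and Borwein's cubic theta
-- functions a and c. In the same way x_r³ and x₀ x₁ x₂ are combinations of the series
-- E_r(z , Q) = x_r(z³ , Q³): with A = a(Q³), C = c(Q³), c = 3M and t = M(Q³),
--   x₀³ = A E₀ + C (E₁ + E₂) (and cyclically),  x₀ x₁ x₂ = M (E₀ + E₁ + E₂),
--   C = 3t,  a = A + 6t,
-- and the constant terms of (x₀ x₁ x₂)³ = x₀³ x₁³ x₂³ give M³ = t (A² + 3At + 9t²).
-- Hence the constant term of ϑ¹⁸ = (ϑ⁹)² is F₀(A , t) S₀ + F₁(A , t) S₁ with explicit
-- binary forms F₀ and F₁ and with S_r = Σ_{n ≡ r} q^(n²). Grouping the factors of the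
-- triple product by j modulo 3 gives Q² P(q) = P(q³)³ M, so that Q³⁶ P(q)¹⁸ is a series
-- in q³ times M¹⁸ = t⁶ (A² + 3At + 9t²)⁶. As A and S₀ are series in q³ whereas t and S₁
-- only have exponents congruent to 1 modulo 3 in q, the two congruences can be read off
-- the coefficients of (A² + 3At + 9t²)⁶ F₀ and (A² + 3At + 9t²)⁶ F₁.

module Submission where

open import Defs
open import Data.Nat.Base using (ℕ)
open import Data.Nat.Divisibility using (_∣_)
open import Data.Product.Base using (_×_)

open import Algebra.Bundles using (CommutativeSemiring)
import Algebra.Properties.AbelianGroup
import Algebra.Properties.CommutativeSemiring.Exp as Exp
import Algebra.Properties.Semiring.Mult.TCOptimised as Mult
import Algebra.Solver.Ring.NaturalCoefficients.Default as SemiringSolver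
open import Algebra.Structures.Biased using (isCommutativeSemiringˡ)
open import Data.Bool.Base using (Bool; true; false; not; if_then_else_)
open import Data.Fin.Base using (Fin; zero; suc)
open import Data.Fin.Patterns using (0F; 1F; 2F)
open import Data.Integer.Base as ℤ using (ℤ; +_; -[1+_]; ∣_∣; -_)
import Data.Integer.DivMod as ℤ
import Data.Integer.Properties as ℤ
import Data.Integer.Tactic.RingSolver as ℤ
open import Data.List.Base as List
  using (List; []; _∷_; _++_; map; filter; foldr; length; allFin; upTo; downFrom; applyUpTo;
         cartesianProduct; cartesianProductWith)
open import Data.List.Membership.Propositional using (_∈_)
open import Data.List.Membership.Propositional.Properties
  using (∈-map⁺; ∈-map⁻; ∈-filter⁺; ∈-filter⁻; ∈-upTo⁺; ∈-cartesianProduct⁺; ∈-allFin)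
open import Data.List.Membership.Propositional.Properties.WithK using (unique∧set⇒bag)
import Data.List.Properties as List
open import Data.List.Relation.Binary.BagAndSetEquality using (∼bag⇒↭)
import Data.List.Relation.Binary.Permutation.Propositional.Properties as Perm
open import Data.List.Relation.Unary.All as All using (All; []; _∷_)
import Data.List.Relation.Unary.All.Properties as All
open import Data.List.Relation.Unary.AllPairs using ([]; _∷_)
open import Data.List.Relation.Unary.Any using (here)
open import Data.List.Relation.Unary.Unique.Propositional using (Unique)
import Data.List.Relation.Unary.Unique.Propositional.Properties as Unique
open import Data.Nat.Base as ℕ using (zero; suc; _≤_; _<_; z≤n; s≤s; _∸_)
open import Data.Nat.Divisibility using (_∣?_; divides; ∣m∣n⇒∣m+n; ∣m⇒∣m*n; _∣0)
import Data.Nat.ListAction as ℕ using (sum)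
import Data.Nat.ListAction.Properties as ℕ using (sum-↭; sum-++)
import Data.Nat.Properties as ℕ
open import Data.Nat.Tactic.RingSolver using (solve-∀)
open import Data.Product.Base as Product using (_,_; proj₁; proj₂; ∃; ∃₂)
open import Data.Product.Properties using (≡-dec)
open import Data.Sum.Base using (inj₁; inj₂)
open import Data.Unit.Base using (⊤; tt)
open import Data.Vec.Base as Vec using (Vec; []; _∷_; _∷ʳ_)
open import Function.Base using (_∘_)
open import Function.Bundles using (_⇔_; mk⇔)
open import Relation.Binary.PropositionalEquality
  using (_≡_; _≢_; refl; sym; trans; cong; cong₂; subst; module ≡-Reasoning)
open import Relation.Binary.Structures using (IsEquivalence)
open import Relation.Nullary using (¬_; Dec; yes; no; does; contradiction)
open import Relation.Nullary.Decidable
  using (True; False; toWitness; toWitnessFalse; ¬?; _×-dec_; decidable-stable; dec-false; does-⇔)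
import Relation.Unary as U

open Algebra.Properties.AbelianGroup ℤ.+-0-abelianGroup
  using () renaming (∙-cancelˡ to +-cancelˡ; ∙-cancelʳ to +-cancelʳ)

-- Series are sums of monomials with natural coefficients and without subtraction, so every identity
-- is arranged to be positive, and truncation in degree `K` replaces infinite sums. The single
-- division occurs in the cubic relation: comparing constant terms only yields M³ a = t (A² + 3At +
-- 9t²) a, since both sides acquire the factor A + 6t = a; it can be cancelled because a has
-- constant term 1. The unit Q = q^(1/6) makes the exponents m²/2 of ϑ and those of c, which are
-- congruent to 1/3 modulo 1, integral. The exponent 18 matters twice: ϑ⁹ is the cube of ϑ³, so that
-- only a pairing of two copies of ϑ⁹ is needed; and 3 divides 18, so that M¹⁸ is a power of M³,
-- which is a form in A and t, whereas M itself has Q-exponents congruent to 2 modulo 3 and is not.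
-- The exponents of t⁶ are congruent modulo 9 to the shift 36. Hence, for given n, only those
-- coefficients of the two forms of degree 20 count whose index is congruent modulo 3 to n (next to
-- S₀) or to n - 1 (next to S₁).

private variable
  I J : Set

-- Finite sums

∑ : (I → ℕ) → List I → ℕ
∑ f xs = ℕ.sum (map f xs)

∑-cong : {f g : I → ℕ} → (∀ x → f x ≡ g x) → ∀ xs → ∑ f xs ≡ ∑ g xs
∑-cong f≗g xs = cong ℕ.sum (List.map-cong f≗g xs)

∑-zero : {f : I → ℕ} → (∀ x → f x ≡ 0) → ∀ xs → ∑ f xs ≡ 0
∑-zero f≗0 []       = refl
∑-zero f≗0 (x ∷ xs) = cong₂ ℕ._+_ (f≗0 x) (∑-zero f≗0 xs)

∑-++ : (f : I → ℕ) → ∀ xs ys → ∑ f (xs ++ ys) ≡ ∑ f xs ℕ.+ ∑ f ys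
∑-++ f xs ys = trans (cong ℕ.sum (List.map-++ f xs ys)) (ℕ.sum-++ (map f xs) (map f ys))

∑-map : (f : J → ℕ) (g : I → J) → ∀ xs → ∑ f (map g xs) ≡ ∑ (f ∘ g) xs
∑-map f g xs = cong ℕ.sum (sym (List.map-∘ xs))

∑-+ : (f g : I → ℕ) → ∀ xs → ∑ (λ x → f x ℕ.+ g x) xs ≡ ∑ f xs ℕ.+ ∑ g xs
∑-+ f g []       = refl
∑-+ f g (x ∷ xs) = trans (cong (f x ℕ.+ g x ℕ.+_) (∑-+ f g xs))
                         (interchange (f x) (g x) (∑ f xs) (∑ g xs))
  where
  interchange : ∀ a b c d → a ℕ.+ b ℕ.+ (c ℕ.+ d) ≡ a ℕ.+ c ℕ.+ (b ℕ.+ d)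
  interchange = solve-∀

∑-swap : (f : I → J → ℕ) → ∀ xs ys →
         ∑ (λ x → ∑ (f x) ys) xs ≡ ∑ (λ y → ∑ (λ x → f x y) xs) ys
∑-swap f []       ys = sym (∑-zero (λ _ → refl) ys)
∑-swap f (x ∷ xs) ys = trans (cong (∑ (f x) ys ℕ.+_) (∑-swap f xs ys))
                             (sym (∑-+ (f x) _ ys))

∑-cartesianProductWith : {C : Set} (f : C → ℕ) (_∙_ : I → J → C) → ∀ xs ys →
  ∑ f (cartesianProductWith _∙_ xs ys) ≡ ∑ (λ x → ∑ (λ y → f (x ∙ y)) ys) xs
∑-cartesianProductWith f _∙_ []       ys = refl
∑-cartesianProductWith f _∙_ (x ∷ xs) ys =
  trans (∑-++ f (map (x ∙_) ys) _)
        (cong₂ ℕ._+_ (∑-map f (x ∙_) ys) (∑-cartesianProductWith f _∙_ xs ys))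

∑-filter : {P : I → Set} (P? : U.Decidable P) (f : I → ℕ) → (∀ x → ¬ P x → f x ≡ 0) →
           ∀ xs → ∑ f (filter P? xs) ≡ ∑ f xs
∑-filter P? f f≡0 []       = refl
∑-filter P? f f≡0 (x ∷ xs) with P? x
... | yes _  = cong (f x ℕ.+_) (∑-filter P? f f≡0 xs)
... | no ¬Px = trans (∑-filter P? f f≡0 xs) (cong (ℕ._+ ∑ f xs) (sym (f≡0 x ¬Px)))

-- The two lists are typically boxes of different shapes that do not correspond under `g`; they only
-- have to contain the respective supports. Once the zero terms are dropped, `is` and the image of
-- `js` are duplicate-free lists with the same members, hence permutations of each other.
∑-reindex : (f : I → ℕ) (g : J → I) (h : I → J) {is : List I} {js : List J} →
            Unique is → Unique js →
            (∀ j → h (g j) ≡ j) → (∀ i → f i ≢ 0 → g (h i) ≡ i) →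
            (∀ i → f i ≢ 0 → i ∈ is) → (∀ j → f (g j) ≢ 0 → j ∈ js) →
            ∑ f is ≡ ∑ (f ∘ g) js
∑-reindex {I} {J} f g h {is} {js} is! js! hg gh is⊇ js⊇ = begin
  ∑ f is                 ≡⟨ ∑-filter f≢0? f (λ i → decidable-stable (f i ℕ.≟ 0)) is ⟨
  ∑ f is′                ≡⟨ ℕ.sum-↭ (Perm.map⁺ f (∼bag⇒↭ (unique∧set⇒bag is′! js′! (mk⇔ to from)))) ⟩
  ∑ f (map g js′)        ≡⟨ ∑-map f g js′ ⟩
  ∑ (f ∘ g) js′          ≡⟨ ∑-filter fg≢0? (f ∘ g) (λ j → decidable-stable (f (g j) ℕ.≟ 0)) js ⟩
  ∑ (f ∘ g) js           ∎
  where
  open ≡-Reasoning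
  f≢0? = λ i → ¬? (f i ℕ.≟ 0)
  fg≢0? = λ j → ¬? (f (g j) ℕ.≟ 0)
  is′ : List I
  is′ = filter f≢0? is
  js′ : List J
  js′ = filter fg≢0? js
  is′! : Unique is′
  is′! = Unique.filter⁺ f≢0? is!
  js′! : Unique (map g js′)
  js′! = Unique.map⁺ (λ {j} {j′} e → trans (sym (hg j)) (trans (cong h e) (hg j′)))
                     (Unique.filter⁺ fg≢0? js!)
  to : ∀ {i} → i ∈ is′ → i ∈ map g js′
  to {i} i∈ with _ , fi≢0 ← ∈-filter⁻ f≢0? {xs = is} i∈ =
    subst (_∈ map g js′) e
      (∈-map⁺ g (∈-filter⁺ fg≢0? (js⊇ (h i) fghi≢0) fghi≢0))
    where
    e : g (h i) ≡ i
    e = gh i fi≢0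
    fghi≢0 : f (g (h i)) ≢ 0
    fghi≢0 = subst (λ k → f k ≢ 0) (sym e) fi≢0
  from : ∀ {i} → i ∈ map g js′ → i ∈ is′
  from i∈ with j , j∈ , refl ← ∈-map⁻ g i∈ with _ , p ← ∈-filter⁻ fg≢0? {xs = js} j∈ =
    ∈-filter⁺ f≢0? (is⊇ (g j) p) p

-- Laurent polynomials

-- (m , k) stands for zᵐ Qᵏ.
Mon : Set
Mon = ℤ × ℕ

infixr 7 _∙_
_∙_ : Mon → Mon → Mon
(m , k) ∙ (m′ , k′) = m ℤ.+ m′ , k ℕ.+ k′

deg : Mon → ℕ
deg = proj₂

-- A list stands for the sum of its monomials, repetitions giving the coefficients. These are
-- natural numbers, so the structure is a semiring and nothing can be subtracted.
Laurent : Set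
Laurent = List Mon

infixl 6 _⊕_
infixl 7 _⊛_
opaque
  _⊕_ _⊛_ : Laurent → Laurent → Laurent
  _⊕_ = _++_
  _⊛_ = cartesianProductWith _∙_

  𝟘 𝟙 : Laurent
  𝟘 = []
  𝟙 = (+ 0 , 0) ∷ []

∙-assoc : ∀ s t u → (s ∙ t) ∙ u ≡ s ∙ (t ∙ u)
∙-assoc (m , k) (m′ , k′) (m″ , k″) = cong₂ _,_ (ℤ.+-assoc m m′ m″) (ℕ.+-assoc k k′ k″)

∙-comm : ∀ s t → s ∙ t ≡ t ∙ s
∙-comm (m , k) (m′ , k′) = cong₂ _,_ (ℤ.+-comm m m′) (ℕ.+-comm k k′)

opaque
  unfolding _⊕_

  ∑-𝟘 : (φ : Mon → ℕ) → ∑ φ 𝟘 ≡ 0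
  ∑-𝟘 φ = refl

  ∑-⊕ : (φ : Mon → ℕ) → ∀ u v → ∑ φ (u ⊕ v) ≡ ∑ φ u ℕ.+ ∑ φ v
  ∑-⊕ = ∑-++

  ∑-⊛ : (φ : Mon → ℕ) → ∀ u v → ∑ φ (u ⊛ v) ≡ ∑ (λ s → ∑ (λ t → φ (s ∙ t)) v) u
  ∑-⊛ φ = ∑-cartesianProductWith φ _∙_

module Truncated (K : ℕ) where

  -- Equality modulo Q^(K+1), by duality: no functional that vanishes above degree K
  -- can tell u from v. Infinite series are represented by large enough finite parts.
  Good : (Mon → ℕ) → Set
  Good φ = ∀ s → K < deg s → φ s ≡ 0

  infix 4 _≈_
  record _≈_ (u v : Laurent) : Set where
    constructor mk≈
    field at : ∀ φ → Good φ → ∑ φ u ≡ ∑ φ v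
  open _≈_ public

  ≡⇒≈ : ∀ {u v} → u ≡ v → u ≈ v
  ≡⇒≈ refl .at _ _ = refl

  ≈-sym : ∀ {u v} → u ≈ v → v ≈ u
  ≈-sym p .at φ g = sym (p .at φ g)

  ≈-trans : ∀ {u v w} → u ≈ v → v ≈ w → u ≈ w
  ≈-trans p q .at φ g = trans (p .at φ g) (q .at φ g)

  ⊕-cong : ∀ {u u′ v v′} → u ≈ u′ → v ≈ v′ → u ⊕ v ≈ u′ ⊕ v′
  ⊕-cong {u} {u′} {v} {v′} p q .at φ g =
    trans (∑-⊕ φ u v) (trans (cong₂ ℕ._+_ (p .at φ g) (q .at φ g)) (sym (∑-⊕ φ u′ v′)))

  ⊕-comm : ∀ u v → u ⊕ v ≈ v ⊕ u
  ⊕-comm u v .at φ _ =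
    trans (∑-⊕ φ u v) (trans (ℕ.+-comm (∑ φ u) (∑ φ v)) (sym (∑-⊕ φ v u)))

  ⊛-comm : ∀ u v → u ⊛ v ≈ v ⊛ u
  ⊛-comm u v .at φ _ = begin
    ∑ φ (u ⊛ v)                          ≡⟨ ∑-⊛ φ u v ⟩
    ∑ (λ s → ∑ (λ t → φ (s ∙ t)) v) u    ≡⟨ ∑-swap (λ s t → φ (s ∙ t)) u v ⟩
    ∑ (λ t → ∑ (λ s → φ (s ∙ t)) u) v    ≡⟨ ∑-cong (λ t → ∑-cong (λ s → cong φ (∙-comm s t)) u) v ⟩
    ∑ (λ t → ∑ (λ s → φ (t ∙ s)) u) v    ≡⟨ ∑-⊛ φ v u ⟨
    ∑ φ (v ⊛ u)                          ∎
    where open ≡-Reasoning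

  -- Degrees are non-negative, so for fixed `s` the functional that sends `t` to `φ (s ∙ t)` is
  -- again good. This makes the truncated equality compatible with products.
  ⊛-congˡ : ∀ u {v v′} → v ≈ v′ → u ⊛ v ≈ u ⊛ v′
  ⊛-congˡ u {v} {v′} p .at φ g = begin
    ∑ φ (u ⊛ v)                          ≡⟨ ∑-⊛ φ u v ⟩
    ∑ (λ s → ∑ (λ t → φ (s ∙ t)) v) u    ≡⟨ ∑-cong (λ s → p .at _ λ t K<t →
                                              g (s ∙ t) (ℕ.<-≤-trans K<t (ℕ.m≤n+m (deg t) (deg s)))) u ⟩
    ∑ (λ s → ∑ (λ t → φ (s ∙ t)) v′) u   ≡⟨ ∑-⊛ φ u v′ ⟨
    ∑ φ (u ⊛ v′)                         ∎
    where open ≡-Reasoning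

  ⊛-congʳ : ∀ {u u′} v → u ≈ u′ → u ⊛ v ≈ u′ ⊛ v
  ⊛-congʳ {u} {u′} v p = ≈-trans (⊛-comm u v) (≈-trans (⊛-congˡ v p) (⊛-comm v u′))

  ⊛-assoc : ∀ u v w → (u ⊛ v) ⊛ w ≈ u ⊛ (v ⊛ w)
  ⊛-assoc u v w .at φ _ = begin
    ∑ φ ((u ⊛ v) ⊛ w)
      ≡⟨ ∑-⊛ φ (u ⊛ v) w ⟩
    ∑ (λ s → ∑ (λ t → φ (s ∙ t)) w) (u ⊛ v)
      ≡⟨ ∑-⊛ _ u v ⟩
    ∑ (λ r → ∑ (λ s → ∑ (λ t → φ ((r ∙ s) ∙ t)) w) v) u
      ≡⟨ ∑-cong (λ r → ∑-cong (λ s → ∑-cong (λ t → cong φ (∙-assoc r s t)) w) v) u ⟩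
    ∑ (λ r → ∑ (λ s → ∑ (λ t → φ (r ∙ (s ∙ t))) w) v) u
      ≡⟨ ∑-cong (λ r → ∑-⊛ _ v w) u ⟨
    ∑ (λ r → ∑ (λ t → φ (r ∙ t)) (v ⊛ w)) u
      ≡⟨ ∑-⊛ φ u (v ⊛ w) ⟨
    ∑ φ (u ⊛ (v ⊛ w)) ∎
    where open ≡-Reasoning

  opaque
    unfolding _⊕_

    ⊛-identityˡ : ∀ u → 𝟙 ⊛ u ≈ u
    ⊛-identityˡ u .at φ _ = trans (∑-⊛ φ 𝟙 u)
      (trans (ℕ.+-identityʳ _) (∑-cong (λ (m , k) → cong φ (cong (_, k) (ℤ.+-identityˡ m))) u))

    ⊕-assoc : ∀ u v w → (u ⊕ v) ⊕ w ≈ u ⊕ (v ⊕ w)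
    ⊕-assoc u v w = ≡⇒≈ (List.++-assoc u v w)

    ⊕-identityˡ : ∀ u → 𝟘 ⊕ u ≈ u
    ⊕-identityˡ u = ≡⇒≈ refl

    ⊛-distribʳ-⊕ : ∀ w u v → (u ⊕ v) ⊛ w ≈ (u ⊛ w) ⊕ (v ⊛ w)
    ⊛-distribʳ-⊕ w u v = ≡⇒≈ (List.cartesianProductWith-distribʳ-++ _∙_ u v w)

    ⊛-zeroˡ : ∀ u → 𝟘 ⊛ u ≈ 𝟘
    ⊛-zeroˡ u = ≡⇒≈ refl

  laurent : CommutativeSemiring _ _
  laurent = record
    { Carrier = Laurent
    ; _≈_ = _≈_
    ; _+_ = _⊕_
    ; _*_ = _⊛_
    ; 0# = 𝟘
    ; 1# = 𝟙
    ; isCommutativeSemiring = isCommutativeSemiringˡ record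
      { +-isCommutativeMonoid = record
        { isMonoid = record
          { isSemigroup = record
            { isMagma = record { isEquivalence = isEquivalence ; ∙-cong = ⊕-cong }
            ; assoc = ⊕-assoc
            }
          ; identity = ⊕-identityˡ , (λ u → ≈-trans (⊕-comm u 𝟘) (⊕-identityˡ u))
          }
        ; comm = ⊕-comm
        }
      ; *-isCommutativeMonoid = record
        { isMonoid = record
          { isSemigroup = record
            { isMagma = record { isEquivalence = isEquivalence
                               ; ∙-cong = λ {u} {u′} {v} {v′} p q → ≈-trans (⊛-congʳ v p) (⊛-congˡ u′ q) }
            ; assoc = ⊛-assoc
            }
          ; identity = ⊛-identityˡ , (λ u → ≈-trans (⊛-comm u 𝟙) (⊛-identityˡ u))
          }
        ; comm = ⊛-comm
        }
      ; distribʳ = ⊛-distribʳ-⊕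
      ; zeroˡ = ⊛-zeroˡ
      }
    }
    where
    isEquivalence : IsEquivalence _≈_
    isEquivalence = record { refl = ≡⇒≈ refl ; sym = ≈-sym ; trans = ≈-trans }

-- Residues modulo 3

-- Balanced residues, with `2F` for -1: negation then exchanges the classes `1F` and `2F` without a
-- carry.
ε : Fin 3 → ℤ
ε 0F = + 0
ε 1F = + 1
ε 2F = -[1+ 0 ]

tri : Fin 3 → ℤ → ℤ
tri r j = + 3 ℤ.* j ℤ.+ ε r

private
  ∣ε-ε∣≤2 : ∀ r r′ → ∣ ε r′ ℤ.- ε r ∣ ≤ 2
  ∣ε-ε∣≤2 0F 0F = z≤n
  ∣ε-ε∣≤2 0F 1F = s≤s z≤n
  ∣ε-ε∣≤2 0F 2F = s≤s z≤n
  ∣ε-ε∣≤2 1F 0F = s≤s z≤n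
  ∣ε-ε∣≤2 1F 1F = z≤n
  ∣ε-ε∣≤2 1F 2F = s≤s (s≤s z≤n)
  ∣ε-ε∣≤2 2F 0F = s≤s z≤n
  ∣ε-ε∣≤2 2F 1F = s≤s (s≤s z≤n)
  ∣ε-ε∣≤2 2F 2F = z≤n

  ε-injective : ∀ r r′ → ε r ≡ ε r′ → r ≡ r′
  ε-injective 0F 0F _ = refl
  ε-injective 1F 1F _ = refl
  ε-injective 2F 2F _ = refl
  ε-injective 0F 1F ()
  ε-injective 0F 2F ()
  ε-injective 1F 2F ()

  3*n≤2⇒n≡0 : ∀ n → 3 ℕ.* n ≤ 2 → n ≡ 0
  3*n≤2⇒n≡0 zero    _ = refl
  3*n≤2⇒n≡0 (suc n) p = contradiction (ℕ.≤-trans (ℕ.*-monoʳ-≤ 3 (s≤s (z≤n {n}))) p) λ { (s≤s (s≤s ())) }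

-- Three times `j - j′` is a difference of balanced residues, hence at most 2 in absolute value,
-- hence 0.
tri-injective : ∀ r r′ j j′ → tri r j ≡ tri r′ j′ → r ≡ r′ × j ≡ j′
tri-injective r r′ j j′ e = ε-injective r r′ εr≡εr′ , j≡j′
  where
  split : ∀ j j′ a b → + 3 ℤ.* (j ℤ.- j′) ≡ (+ 3 ℤ.* j ℤ.+ a) ℤ.- (+ 3 ℤ.* j′ ℤ.+ b) ℤ.+ (b ℤ.- a)
  split = ℤ.solve-∀
  3*diff : + 3 ℤ.* (j ℤ.- j′) ≡ ε r′ ℤ.- ε r
  3*diff = trans (split j j′ (ε r) (ε r′))
    (trans (cong (ℤ._+ (ε r′ ℤ.- ε r)) (ℤ.i≡j⇒i-j≡0 e)) (ℤ.+-identityˡ _))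
  j≡j′ : j ≡ j′
  j≡j′ = ℤ.i-j≡0⇒i≡j j j′ (ℤ.∣i∣≡0⇒i≡0 (3*n≤2⇒n≡0 ∣ j ℤ.- j′ ∣
    (subst (_≤ 2) (trans (cong ∣_∣ (sym 3*diff)) (ℤ.abs-* (+ 3) (j ℤ.- j′))) (∣ε-ε∣≤2 r r′))))
  εr≡εr′ : ε r ≡ ε r′
  εr≡εr′ = +-cancelˡ (+ 3 ℤ.* j) (ε r) (ε r′) (trans e (cong (λ k → + 3 ℤ.* k ℤ.+ ε r′) (sym j≡j′)))

private
  -- Division of `1 + n` by 3 leaves the remainder 0, 1 or 2; taking the 1 away again turns these
  -- into the balanced residues of `n`.
  ε-shift : ∀ a j → a ℕ.< 3 → ∃ λ r → + a ℤ.+ j ℤ.* + 3 ≡ + 1 ℤ.+ tri r j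
  ε-shift 0 j _ = 2F , lemma j
    where
    lemma : ∀ j → + 0 ℤ.+ j ℤ.* + 3 ≡ + 1 ℤ.+ (+ 3 ℤ.* j ℤ.+ -[1+ 0 ])
    lemma = ℤ.solve-∀
  ε-shift 1 j _ = 0F , lemma j
    where
    lemma : ∀ j → + 1 ℤ.+ j ℤ.* + 3 ≡ + 1 ℤ.+ (+ 3 ℤ.* j ℤ.+ + 0)
    lemma = ℤ.solve-∀
  ε-shift 2 j _ = 1F , lemma j
    where
    lemma : ∀ j → + 2 ℤ.+ j ℤ.* + 3 ≡ + 1 ℤ.+ (+ 3 ℤ.* j ℤ.+ + 1)
    lemma = ℤ.solve-∀
  ε-shift (suc (suc (suc _))) j (s≤s (s≤s (s≤s ())))

  tri-surjective : ∀ n → ∃₂ λ r j → tri r j ≡ n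
  tri-surjective n = r , q , +-cancelˡ (+ 1) (tri r q) n (trans (sym e) (sym (ℤ.a≡a%ℕn+[a/ℕn]*n 1+n 3)))
    where
    1+n = + 1 ℤ.+ n
    q = 1+n ℤ./ℕ 3
    r = proj₁ (ε-shift (1+n ℤ.%ℕ 3) q (ℤ.n%ℕd<d 1+n 3))
    e = proj₂ (ε-shift (1+n ℤ.%ℕ 3) q (ℤ.n%ℕd<d 1+n 3))

residue : ℤ → Fin 3
residue n = proj₁ (tri-surjective n)

quotient : ℤ → ℤ
quotient n = proj₁ (proj₂ (tri-surjective n))

tri-residue-quotient : ∀ n → tri (residue n) (quotient n) ≡ n
tri-residue-quotient n = proj₂ (proj₂ (tri-surjective n))

residue-tri : ∀ r j → residue (tri r j) ≡ r
residue-tri r j = proj₁ (tri-injective (residue (tri r j)) r (quotient (tri r j)) j (tri-residue-quotient (tri r j)))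

quotient-tri : ∀ r j → quotient (tri r j) ≡ j
quotient-tri r j = proj₂ (tri-injective (residue (tri r j)) r (quotient (tri r j)) j (tri-residue-quotient (tri r j)))

box : ℕ → List ℤ
box n = map (λ a → + a ℤ.- + n) (upTo (suc (n ℕ.+ n)))

box! : ∀ n → Unique (box n)
box! n = Unique.map⁺ (λ e → ℤ.+-injective (+-cancelʳ (- + n) _ _ e)) (Unique.upTo⁺ _)

∈-box : ∀ {n} x → ∣ x ∣ ≤ n → x ∈ box n
∈-box {n} (+ m) m≤n =
  subst (_∈ box n) (cancel (+ m) (+ n)) (∈-map⁺ _ (∈-upTo⁺ (s≤s (ℕ.+-monoˡ-≤ n m≤n))))
  where
  cancel : ∀ x y → x ℤ.+ y ℤ.- y ≡ x
  cancel = ℤ.solve-∀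
∈-box {n} -[1+ m ] m<n =
  subst (_∈ box n) e (∈-map⁺ _ (∈-upTo⁺ (s≤s (ℕ.≤-trans (ℕ.m∸n≤m n (suc m)) (ℕ.m≤m+n n n)))))
  where
  cancel : ∀ x y → y ℤ.- x ℤ.- y ≡ - x
  cancel = ℤ.solve-∀
  e : + (n ℕ.∸ suc m) ℤ.- + n ≡ -[1+ m ]
  e = trans (cong (ℤ._- + n) (trans (sym (ℤ.⊖-≥ m<n)) (sym (ℤ.m-n≡m⊖n n (suc m)))))
            (cancel (+ suc m) (+ n))

-- Quadratic forms

sq : ℤ → ℕ
sq n = ∣ n ∣ ℕ.* ∣ n ∣

sq≡ : ∀ n → + sq n ≡ n ℤ.* n
sq≡ (+ n)    = sym (ℤ.+◃n≡+n _)
sq≡ -[1+ n ] = refl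

infix  9 □_
infixr 8 _·_
infixr 7 _⊞_
-- Exponents are kept as syntax with two readings: `size` in ℕ, where each summand is bounded by the
-- total, and `value` in ℤ, where polynomial identities are available. `size≡value` transports the
-- identities back to the exponents.
data Form : Set where
  □_  : ℤ → Form
  _⊞_ : Form → Form → Form
  _·_ : ℕ → Form → Form

size : Form → ℕ
size (□ x)   = sq x
size (f ⊞ g) = size f ℕ.+ size g
size (n · f) = n ℕ.* size f

value : Form → ℤ
value (□ x)   = x ℤ.* x
value (f ⊞ g) = value f ℤ.+ value g
value (n · f) = + n ℤ.* value f

size≡value : ∀ f → + size f ≡ value f
size≡value (□ x)   = sq≡ x
size≡value (f ⊞ g) = cong₂ ℤ._+_ (size≡value f) (size≡value g)
size≡value (n · f) = trans (ℤ.pos-* n (size f)) (cong (+ n ℤ.*_) (size≡value f))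

-- A pair (m , f) presents the monomial zᵐ Q^(size f).
QMon : Set
QMon = ℤ × Form

⌊_⌋ : QMon → Mon
⌊ m , f ⌋ = m , size f

infixr 7 _⊙_
_⊙_ : QMon → QMon → QMon
(m , f) ⊙ (m′ , f′) = m ℤ.+ m′ , f ⊞ f′

infix 4 _≐_ _&_
record _≐_ (p q : QMon) : Set where
  constructor _&_
  field
    exponent≡ : proj₁ p ≡ proj₁ q
    value≡    : value (proj₂ p) ≡ value (proj₂ q)

≐⇒≡ : {p q : QMon} → p ≐ q → ⌊ p ⌋ ≡ ⌊ q ⌋
≐⇒≡ {_ , f} {_ , g} (m≡ & e) = cong₂ _,_ m≡
  (ℤ.+-injective (trans (size≡value f) (trans e (sym (size≡value g)))))

opaque
  ⟪_⟫ : (I → QMon) → List I → Laurent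
  ⟪ F ⟫ is = map (⌊_⌋ ∘ F) is

  ∑-⟪⟫ : (φ : Mon → ℕ) (F : I → QMon) → ∀ is → ∑ φ (⟪ F ⟫ is) ≡ ∑ (λ i → φ ⌊ F i ⌋) is
  ∑-⟪⟫ φ F is = ∑-map φ (⌊_⌋ ∘ F) is

opaque
  unfolding ⟪_⟫ _⊛_

  ⟪⟫-⊛ : (F : I → QMon) (G : J → QMon) → ∀ is js →
         ⟪ F ⟫ is ⊛ ⟪ G ⟫ js ≡ ⟪ (λ (i , j) → F i ⊙ G j) ⟫ (cartesianProduct is js)
  ⟪⟫-⊛ F G []       js = refl
  ⟪⟫-⊛ {I} {J} F G (i ∷ is) js = begin
    map (⌊ F i ⌋ ∙_) (map (⌊_⌋ ∘ G) js) ++ ⟪ F ⟫ is ⊛ ⟪ G ⟫ js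
      ≡⟨ cong₂ _++_ (trans (sym (List.map-∘ js)) (List.map-∘ js)) (⟪⟫-⊛ F G is js) ⟩
    map H (map (i ,_) js) ++ map H (cartesianProduct is js)
      ≡⟨ List.map-++ H (map (i ,_) js) _ ⟨
    map H (map (i ,_) js ++ cartesianProduct is js) ∎
    where
    open ≡-Reasoning
    H : I × J → Mon
    H (i , j) = ⌊ F i ⊙ G j ⌋

  ⟪⟫-++ : (F : I → QMon) → ∀ is js → ⟪ F ⟫ (is ++ js) ≡ ⟪ F ⟫ is ⊕ ⟪ F ⟫ js
  ⟪⟫-++ F is js = List.map-++ (⌊_⌋ ∘ F) is js

  ⟪⟫-map : (F : I → QMon) (g : J → I) → ∀ js → ⟪ F ⟫ (map g js) ≡ ⟪ F ∘ g ⟫ js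
  ⟪⟫-map F g js = sym (List.map-∘ js)

  ⟪⟫-cong : {F G : I → QMon} → (∀ i → F i ≐ G i) → ∀ is → ⟪ F ⟫ is ≡ ⟪ G ⟫ is
  ⟪⟫-cong F≐G = List.map-cong (λ i → ≐⇒≡ (F≐G i))

σ : Mon → Mon
σ (m , k) = + 3 ℤ.* m , 3 ℕ.* k

σQ : QMon → QMon
σQ (m , f) = + 3 ℤ.* m , 3 · f

ϑQ : ℤ → QMon
ϑQ m = m , 3 · □ m

xQ EQ : Fin 3 → ℤ → QMon
xQ r j = tri r j , □ tri r j
EQ r = σQ ∘ xQ r

-- The form is 3 |l|² - ρ² for l = (ρ - y - z , y , z).
cubicQ : ℤ → ℤ × ℤ → QMon
cubicQ ρ (y , z) = + 0 , □ (ρ ℤ.- y ℤ.- z ℤ.- y) ⊞ □ (y ℤ.- z) ⊞ □ (z ℤ.- (ρ ℤ.- y ℤ.- z))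

-- The squared length of (-3(b + c), 3b + 1, 3c - 1), a general vector of coordinate sum 0 with
-- residues 0, 1, -1 modulo 3. So `MQ` enumerates the terms of z-degree 0 in `x₀ x₁ x₂`.
MQ : ℤ × ℤ → QMon
MQ (b , c) = + 0 , □ (+ 3 ℤ.* (b ℤ.+ c)) ⊞ □ (+ 3 ℤ.* b ℤ.+ + 1) ⊞ □ (+ 3 ℤ.* c ℤ.- + 1)

-- Lattice sums up to degree K

module Lattice (K : ℕ) where
  open Truncated K public
  open CommutativeSemiring laurent public
    using (setoid; +-cong; *-cong; +-identityʳ; +-comm; +-assoc; distribˡ; distribʳ)
  module ≈-Reasoning where
    open import Relation.Binary.Reasoning.Setoid setoid public

  -- Bounds are counted in units of `suc K`, so that they add under sums. The unit is not `K`, since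
  -- the constants 1 and -1 must be small even for `K = 0`.
  record Small (c : ℕ) (x : ℤ) : Set where
    constructor small
    field bound : ∣ x ∣ ≤ c ℕ.* suc K

  -- The factor 20 leaves room: the largest bound needed for membership in the box is 10 units, in
  -- `cubic-split`.
  N : ℕ
  N = 20 ℕ.* suc K

  B : List ℤ
  B = box N

  B² : List (ℤ × ℤ)
  B² = cartesianProduct B B

  B! : Unique B
  B! = box! N

  B²! : Unique B²
  B²! = Unique.cartesianProduct⁺ B! B!

  small-+ : ∀ {c d x y} → Small c x → Small d y → Small (c ℕ.+ d) (x ℤ.+ y)
  small-+ {c} {d} {x} {y} (small p) (small q) = small (ℕ.≤-trans (ℤ.∣i+j∣≤∣i∣+∣j∣ x y)
    (ℕ.≤-trans (ℕ.+-mono-≤ p q) (ℕ.≤-reflexive (sym (ℕ.*-distribʳ-+ (suc K) c d)))))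

  small-≤ : ∀ {c d x} → c ≤ d → Small c x → Small d x
  small-≤ c≤d (small p) = small (ℕ.≤-trans p (ℕ.*-monoˡ-≤ (suc K) c≤d))

  small-neg : ∀ {c x} → Small c x → Small c (- x)
  small-neg {c} {x} (small p) = small (subst (_≤ c ℕ.* suc K) (sym (ℤ.∣-i∣≡∣i∣ x)) p)

  small-- : ∀ {c d x y} → Small c x → Small d y → Small (c ℕ.+ d) (x ℤ.- y)
  small-- p q = small-+ p (small-neg q)

  small-const : ∀ x → {_ : True (∣ x ∣ ℕ.≤? 1)} → Small 1 x
  small-const x {p} = small (ℕ.≤-trans (toWitness p) (s≤s z≤n))

  small-ε : ∀ r → Small 1 (ε r)
  small-ε 0F = small-const _
  small-ε 1F = small-const _
  small-ε 2F = small-const _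

  small-3 : ∀ {c x} → Small c (+ 3 ℤ.* x) → Small c x
  small-3 {c} {x} (small p) =
    small (ℕ.≤-trans (ℕ.m≤n*m ∣ x ∣ 3) (subst (_≤ c ℕ.* suc K) (ℤ.abs-* (+ 3) x) p))

  small-sq : ∀ {x} → sq x ≤ K → Small 1 x
  small-sq {x} p = small (ℕ.≤-trans (n≤n*n ∣ x ∣)
    (ℕ.≤-trans p (ℕ.≤-trans (ℕ.n≤1+n K) (ℕ.≤-reflexive (sym (ℕ.*-identityˡ (suc K)))))))
    where
    n≤n*n : ∀ n → n ≤ n ℕ.* n
    n≤n*n zero    = z≤n
    n≤n*n (suc n) = ℕ.m≤m+n (suc n) _

  small-summand : ∀ {c d x y} → Small c (x ℤ.+ y) → Small d y → Small (c ℕ.+ d) x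
  small-summand {c} {d} {x} {y} p q = subst (Small (c ℕ.+ d)) (cancel x y) (small-- p q)
    where
    cancel : ∀ x y → x ℤ.+ y ℤ.- y ≡ x
    cancel = ℤ.solve-∀

  small-tri : ∀ {c r j} → Small c (tri r j) → Small (c ℕ.+ 1) j
  small-tri {r = r} p = small-3 (small-summand p (small-ε r))

  small-∈B : ∀ {c x} {_ : True (c ℕ.≤? 20)} → Small c x → x ∈ B
  small-∈B {x = x} {c≤20} (small p) =
    ∈-box x (ℕ.≤-trans p (ℕ.*-monoˡ-≤ (suc K) (toWitness c≤20)))

  Within : (I → QMon) → (I → Set) → Set
  Within F P = ∀ i → size (proj₂ (F i)) ≤ K → P i

  -- Good functionals vanish above degree `K`, so a bijection of infinite lattices yields an
  -- equality of finite sums as soon as the boxes contain all indices of degree at most `K`.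
  ≈-reindex : (F : I → QMon) (G : J → QMon) (g : J → I) (h : I → J) {is : List I} {js : List J} →
              Unique is → Unique js →
              (∀ j → h (g j) ≡ j) → (∀ i → g (h i) ≡ i) → (∀ j → F (g j) ≐ G j) →
              Within F (_∈ is) → Within F (λ i → h i ∈ js) →
              ⟪ F ⟫ is ≈ ⟪ G ⟫ js
  ≈-reindex F G g h {is} {js} is! js! hg gh F≐G is⊇ js⊇ .at φ good = begin
    ∑ φ (⟪ F ⟫ is)              ≡⟨ ∑-⟪⟫ φ F is ⟩
    ∑ (λ i → φ ⌊ F i ⌋) is      ≡⟨ ∑-reindex _ g h is! js! hg (λ i _ → gh i)
                                     (λ i nz → is⊇ i (low ⌊ F i ⌋ nz))
                                     (λ j nz → subst (_∈ js) (hg j) (js⊇ (g j) (low ⌊ F (g j) ⌋ nz))) ⟩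
    ∑ (λ j → φ ⌊ F (g j) ⌋) js  ≡⟨ ∑-cong (λ j → cong φ (≐⇒≡ (F≐G j))) js ⟩
    ∑ (λ j → φ ⌊ G j ⌋) js      ≡⟨ ∑-⟪⟫ φ G js ⟨
    ∑ φ (⟪ G ⟫ js)              ∎
    where
    open ≡-Reasoning
    low : ∀ s → φ s ≢ 0 → deg s ≤ K
    low s nz = ℕ.≮⇒≥ (λ K<s → nz (good s K<s))

  ⟪⟫-allFin₃ : (G : Fin 3 × J → QMon) → ∀ js →
    ⟪ G ⟫ (cartesianProduct (allFin 3) js) ≈
    ⟪ (λ j → G (0F , j)) ⟫ js ⊕ (⟪ (λ j → G (1F , j)) ⟫ js ⊕ ⟪ (λ j → G (2F , j)) ⟫ js)
  ⟪⟫-allFin₃ G js = ≡⇒≈ (begin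
    ⟪ G ⟫ (row 0F ++ (row 1F ++ (row 2F ++ [])))
      ≡⟨ cong (λ r → ⟪ G ⟫ (row 0F ++ (row 1F ++ r))) (List.++-identityʳ _) ⟩
    ⟪ G ⟫ (row 0F ++ (row 1F ++ row 2F))
      ≡⟨ ⟪⟫-++ G (row 0F) _ ⟩
    ⟪ G ⟫ (row 0F) ⊕ ⟪ G ⟫ (row 1F ++ row 2F)
      ≡⟨ cong (⟪ G ⟫ (row 0F) ⊕_) (⟪⟫-++ G (row 1F) _) ⟩
    ⟪ G ⟫ (row 0F) ⊕ (⟪ G ⟫ (row 1F) ⊕ ⟪ G ⟫ (row 2F))
      ≡⟨ cong₂ _⊕_ (⟪⟫-map G _ js) (cong₂ _⊕_ (⟪⟫-map G _ js) (⟪⟫-map G _ js)) ⟩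
    _ ∎)
    where
    open ≡-Reasoning
    row : Fin 3 → List _
    row r = map (r ,_) js

  -- Substituting mᵢ = j + lᵢ, where the lᵢ have sum 0, 1 or -1.
  trilinear : (f g h : ℤ → QMon) (D : Fin 3 → ℤ × ℤ → QMon) (X : Fin 3 → ℤ → QMon) →
    (∀ r j y z → f (j ℤ.+ (ε r ℤ.- y ℤ.- z)) ⊙ g (j ℤ.+ y) ⊙ h (j ℤ.+ z) ≐ D r (y , z) ⊙ X r j) →
    Within f (Small 2) → Within g (Small 2) → Within h (Small 2) →
    ⟪ f ⟫ B ⊛ (⟪ g ⟫ B ⊛ ⟪ h ⟫ B) ≈
    ⟪ D 0F ⟫ B² ⊛ ⟪ X 0F ⟫ B ⊕
    (⟪ D 1F ⟫ B² ⊛ ⟪ X 1F ⟫ B ⊕ ⟪ D 2F ⟫ B² ⊛ ⟪ X 2F ⟫ B)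
  trilinear f g h D X eq f-small g-small h-small = begin
    ⟪ f ⟫ B ⊛ (⟪ g ⟫ B ⊛ ⟪ h ⟫ B)
      ≡⟨ cong (⟪ f ⟫ B ⊛_) (⟪⟫-⊛ g h B B) ⟩
    ⟪ f ⟫ B ⊛ ⟪ (λ (m , n) → g m ⊙ h n) ⟫ B²
      ≡⟨ ⟪⟫-⊛ f (λ (m , n) → g m ⊙ h n) B B² ⟩
    ⟪ F ⟫ (cartesianProduct B B²)
      ≈⟨ ≈-reindex F G to from (Unique.cartesianProduct⁺ B! B²!)
           (Unique.cartesianProduct⁺ (Unique.allFin⁺ 3) (Unique.cartesianProduct⁺ B²! B!))
           from-to to-from
           (λ (r , (y , z) , j) → eq r j y z)
           (λ i p → ∈-cartesianProduct⁺ (small-∈B (small₁ i p))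
                      (∈-cartesianProduct⁺ (small-∈B (small₂ i p)) (small-∈B (small₃ i p))))
           (λ i p → ∈-cartesianProduct⁺ (∈-allFin _)
                      (∈-cartesianProduct⁺
                        (∈-cartesianProduct⁺ (small-∈B (small-- (small₂ i p) (small-q i p)))
                                             (small-∈B (small-- (small₃ i p) (small-q i p))))
                        (small-∈B (small-q i p)))) ⟩
    ⟪ G ⟫ (cartesianProduct (allFin 3) (cartesianProduct B² B))
      ≈⟨ ⟪⟫-allFin₃ G (cartesianProduct B² B) ⟩
    ⟪ G ∘ (0F ,_) ⟫ (cartesianProduct B² B) ⊕
    (⟪ G ∘ (1F ,_) ⟫ (cartesianProduct B² B) ⊕ ⟪ G ∘ (2F ,_) ⟫ (cartesianProduct B² B))
      ≡⟨ cong₂ _⊕_ (unmap 0F) (cong₂ _⊕_ (unmap 1F) (unmap 2F)) ⟨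
    _ ∎
    where
    open ≈-Reasoning
    F : ℤ × ℤ × ℤ → QMon
    F (l , m , n) = f l ⊙ g m ⊙ h n
    G : Fin 3 × (ℤ × ℤ) × ℤ → QMon
    G (r , l , j) = D r l ⊙ X r j
    unmap : ∀ r → ⟪ D r ⟫ B² ⊛ ⟪ X r ⟫ B ≡ ⟪ G ∘ (r ,_) ⟫ (cartesianProduct B² B)
    unmap r = ⟪⟫-⊛ (D r) (X r) B² B
    to : Fin 3 × (ℤ × ℤ) × ℤ → ℤ × ℤ × ℤ
    to (r , (y , z) , j) = j ℤ.+ (ε r ℤ.- y ℤ.- z) , j ℤ.+ y , j ℤ.+ z
    -- The coordinate sum equals `3 j + ε r`, which determines `r` and `j`.
    from : ℤ × ℤ × ℤ → Fin 3 × (ℤ × ℤ) × ℤ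
    from (l , m , n) = residue s , (m ℤ.- quotient s , n ℤ.- quotient s) , quotient s
      where s = l ℤ.+ m ℤ.+ n
    total : ∀ j y z e → j ℤ.+ (e ℤ.- y ℤ.- z) ℤ.+ (j ℤ.+ y) ℤ.+ (j ℤ.+ z) ≡ + 3 ℤ.* j ℤ.+ e
    total = ℤ.solve-∀
    cancel : ∀ j y → j ℤ.+ y ℤ.- j ≡ y
    cancel = ℤ.solve-∀
    from-to : ∀ j → from (to j) ≡ j
    from-to (r , (y , z) , j)
      rewrite total j y z (ε r) | residue-tri r j | quotient-tri r j | cancel j y | cancel j z = refl
    to-from : ∀ i → to (from i) ≡ i
    to-from (l , m , n) = cong₂ _,_
      (trans (first (ε (residue s)) (quotient s) m n) (trans (cong (λ k → k ℤ.- m ℤ.- n) (tri-residue-quotient s)) (cancel₃ l m n)))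
      (cong₂ _,_ (uncancel m (quotient s)) (uncancel n (quotient s)))
      where
      s = l ℤ.+ m ℤ.+ n
      first : ∀ e q m n → q ℤ.+ (e ℤ.- (m ℤ.- q) ℤ.- (n ℤ.- q)) ≡ + 3 ℤ.* q ℤ.+ e ℤ.- m ℤ.- n
      first = ℤ.solve-∀
      uncancel : ∀ m q → q ℤ.+ (m ℤ.- q) ≡ m
      uncancel = ℤ.solve-∀
      cancel₃ : ∀ l m n → l ℤ.+ m ℤ.+ n ℤ.- m ℤ.- n ≡ l
      cancel₃ = ℤ.solve-∀
    small₁ : ∀ i → size (proj₂ (F i)) ≤ K → Small 2 (proj₁ i)
    small₁ (l , m , n) p = f-small l (ℕ.m+n≤o⇒m≤o _ p)
    small₂ : ∀ i → size (proj₂ (F i)) ≤ K → Small 2 (proj₁ (proj₂ i))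
    small₂ (l , m , n) p = g-small m (ℕ.m+n≤o⇒m≤o _ (ℕ.m+n≤o⇒n≤o (size (proj₂ (f l))) p))
    small₃ : ∀ i → size (proj₂ (F i)) ≤ K → Small 2 (proj₂ (proj₂ i))
    small₃ (l , m , n) p = h-small n (ℕ.m+n≤o⇒n≤o (size (proj₂ (g m))) (ℕ.m+n≤o⇒n≤o (size (proj₂ (f l))) p))
    small-q : ∀ i → size (proj₂ (F i)) ≤ K → Small 7 (proj₂ (proj₂ (from i)))
    small-q i@(l , m , n) p = small-tri {r = residue s}
      (subst (Small 6) (sym (tri-residue-quotient s))
        (subst (Small 6) (sym (ℤ.+-assoc l m n)) (small-+ (small₁ i p) (small-+ (small₂ i p) (small₃ i p)))))
      where s = l ℤ.+ m ℤ.+ n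

-- Cubes and products of theta series

module Theta (K : ℕ) where
  open Lattice K public

  ϑ M t : Laurent
  ϑ = ⟪ ϑQ ⟫ B
  M = ⟪ MQ ⟫ B²
  t = ⟪ σQ ∘ MQ ⟫ B²

  x E : Fin 3 → Laurent
  x r = ⟪ xQ r ⟫ B
  E r = ⟪ EQ r ⟫ B

  cubic cubic³ : ℤ → Laurent
  cubic ρ = ⟪ cubicQ ρ ⟫ B²
  cubic³ ρ = ⟪ σQ ∘ cubicQ ρ ⟫ B²

  a c A C : Laurent
  a = cubic (+ 0)
  c = cubic (+ 1)
  A = cubic³ (+ 0)
  C = cubic³ (+ 1)

  opaque
    σ* : Laurent → Laurent
    σ* = map σ

    ∑-σ* : (φ : Mon → ℕ) → ∀ u → ∑ φ (σ* u) ≡ ∑ (φ ∘ σ) u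
    ∑-σ* φ = ∑-map φ σ

  opaque
    unfolding σ* ⟪_⟫

    σ*-⟪⟫ : ∀ {I : Set} (F : I → QMon) is → σ* (⟪ F ⟫ is) ≡ ⟪ σQ ∘ F ⟫ is
    σ*-⟪⟫ F is = sym (List.map-∘ is)

  σ*-cong : ∀ {u v} → u ≈ v → σ* u ≈ σ* v
  σ*-cong {u} {v} p .at φ good = trans (∑-σ* φ u) (trans
    (p .at (φ ∘ σ) (λ s K<s → good (σ s) (ℕ.<-≤-trans K<s (ℕ.m≤n*m (deg s) 3))))
    (sym (∑-σ* φ v)))

  ⟪σQ⟫-cong : ∀ {I J : Set} {F : I → QMon} {G : J → QMon} {is js} →
              ⟪ F ⟫ is ≈ ⟪ G ⟫ js → ⟪ σQ ∘ F ⟫ is ≈ ⟪ σQ ∘ G ⟫ js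
  ⟪σQ⟫-cong {F = F} {G} {is} {js} p =
    ≈-trans (≡⇒≈ (sym (σ*-⟪⟫ F is))) (≈-trans (σ*-cong p) (≡⇒≈ (σ*-⟪⟫ G js)))

  ϑ-small : Within ϑQ (Small 2)
  ϑ-small m p = small-≤ (s≤s z≤n) (small-sq (ℕ.≤-trans (ℕ.m≤n*m (sq m) 3) p))

  x-small : ∀ r → Within (xQ r) (Small 2)
  x-small r j p = small-tri {r = r} (small-sq p)

  small-pair : ∀ {y z} → Small 3 y × Small 3 z → (y , z) ∈ B²
  small-pair (p , q) = ∈-cartesianProduct⁺ (small-∈B p) (small-∈B q)

  -- `3 y` and `3 z` are combinations of `ρ` and of the three differences whose squares make up the
  -- form, and each of these squares is at most `K`.
  cubic-small : ∀ {ρ} → Small 1 ρ → Within (cubicQ ρ) (λ (y , z) → Small 3 y × Small 3 z)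
  cubic-small {ρ} ρ-small (y , z) p =
    small-3 (subst (Small 3) (3y ρ y z) (small-+ (small-- ρ-small d₁) d₂)) ,
    small-3 (subst (Small 3) (3z ρ y z) (small-- (small-+ ρ-small d₃) d₂))
    where
    d₁ : Small 1 (ρ ℤ.- y ℤ.- z ℤ.- y)
    d₁ = small-sq (ℕ.m+n≤o⇒m≤o _ p)
    d₂ : Small 1 (y ℤ.- z)
    d₂ = small-sq (ℕ.m+n≤o⇒m≤o _ (ℕ.m+n≤o⇒n≤o (sq (ρ ℤ.- y ℤ.- z ℤ.- y)) p))
    d₃ : Small 1 (z ℤ.- (ρ ℤ.- y ℤ.- z))
    d₃ = small-sq (ℕ.m+n≤o⇒n≤o (sq (y ℤ.- z)) (ℕ.m+n≤o⇒n≤o (sq (ρ ℤ.- y ℤ.- z ℤ.- y)) p))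
    3y : ∀ ρ y z → ρ ℤ.- (ρ ℤ.- y ℤ.- z ℤ.- y) ℤ.+ (y ℤ.- z) ≡ + 3 ℤ.* y
    3y = ℤ.solve-∀
    3z : ∀ ρ y z → ρ ℤ.+ (z ℤ.- (ρ ℤ.- y ℤ.- z)) ℤ.- (y ℤ.- z) ≡ + 3 ℤ.* z
    3z = ℤ.solve-∀

  M-small : Within MQ (λ (b , c) → Small 2 b × Small 2 c)
  M-small (b , c) p =
    small-tri {r = 1F} (small-sq (ℕ.m+n≤o⇒m≤o _ p′)) ,
    small-tri {r = 2F} (small-sq (ℕ.m+n≤o⇒n≤o (sq (+ 3 ℤ.* b ℤ.+ + 1)) p′))
    where p′ = ℕ.m+n≤o⇒n≤o (sq (+ 3 ℤ.* (b ℤ.+ c))) p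

  -- Negating the lattice vector exchanges the coordinate sums 1 and -1 and preserves the form.
  cubic-neg : cubic -[1+ 0 ] ≈ c
  cubic-neg = ≈-sym (≈-reindex (cubicQ (+ 1)) (cubicQ -[1+ 0 ]) neg neg B²! B²!
    neg-neg neg-neg (λ (y , z) → refl & sym (values y z))
    (λ i p → small-pair (cubic-small {+ 1} (small-const _) i p))
    (λ i p → small-pair (Product.map small-neg small-neg (cubic-small {+ 1} (small-const _) i p))))
    where
    neg : ℤ × ℤ → ℤ × ℤ
    neg (y , z) = - y , - z
    neg-neg : ∀ i → neg (neg i) ≡ i
    neg-neg (y , z) = cong₂ _,_ (ℤ.neg-involutive y) (ℤ.neg-involutive z)
    values : ∀ y z → value (proj₂ (cubicQ -[1+ 0 ] (y , z))) ≡ value (proj₂ (cubicQ (+ 1) (- y , - z)))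
    values y z = identity y z
      where
      identity : ∀ y z →
        (-[1+ 0 ] ℤ.- y ℤ.- z ℤ.- y) ℤ.* (-[1+ 0 ] ℤ.- y ℤ.- z ℤ.- y) ℤ.+
        ((y ℤ.- z) ℤ.* (y ℤ.- z) ℤ.+
         (z ℤ.- (-[1+ 0 ] ℤ.- y ℤ.- z)) ℤ.* (z ℤ.- (-[1+ 0 ] ℤ.- y ℤ.- z))) ≡
        (+ 1 ℤ.- - y ℤ.- - z ℤ.- - y) ℤ.* (+ 1 ℤ.- - y ℤ.- - z ℤ.- - y) ℤ.+
        ((- y ℤ.- - z) ℤ.* (- y ℤ.- - z) ℤ.+
         (- z ℤ.- (+ 1 ℤ.- - y ℤ.- - z)) ℤ.* (- z ℤ.- (+ 1 ℤ.- - y ℤ.- - z)))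
      identity = ℤ.solve-∀

  -- For mᵢ = j + lᵢ with l of coordinate sum e, completing the square gives 3|m|² = (3|l|² - e²) +
  -- (3j + e)², and the z-exponent is 3j + e as well.
  ϑ-cube : ϑ ⊛ (ϑ ⊛ ϑ) ≈ a ⊛ x 0F ⊕ (c ⊛ x 1F ⊕ c ⊛ x 2F)
  ϑ-cube = ≈-trans
    (trilinear ϑQ ϑQ ϑQ (cubicQ ∘ ε) xQ (λ r j y z → exponents (ε r) j y z & values (ε r) j y z)
      ϑ-small ϑ-small ϑ-small)
    (+-cong (≡⇒≈ refl) (+-cong (≡⇒≈ refl) (⊛-congʳ (x 2F) cubic-neg)))
    where
    exponents : ∀ e j y z → j ℤ.+ (e ℤ.- y ℤ.- z) ℤ.+ (j ℤ.+ y ℤ.+ (j ℤ.+ z)) ≡ + 0 ℤ.+ (+ 3 ℤ.* j ℤ.+ e)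
    exponents = ℤ.solve-∀
    values : ∀ e j y z →
      + 3 ℤ.* ((j ℤ.+ (e ℤ.- y ℤ.- z)) ℤ.* (j ℤ.+ (e ℤ.- y ℤ.- z))) ℤ.+
      (+ 3 ℤ.* ((j ℤ.+ y) ℤ.* (j ℤ.+ y)) ℤ.+ + 3 ℤ.* ((j ℤ.+ z) ℤ.* (j ℤ.+ z))) ≡
      (e ℤ.- y ℤ.- z ℤ.- y) ℤ.* (e ℤ.- y ℤ.- z ℤ.- y) ℤ.+
      ((y ℤ.- z) ℤ.* (y ℤ.- z) ℤ.+ (z ℤ.- (e ℤ.- y ℤ.- z)) ℤ.* (z ℤ.- (e ℤ.- y ℤ.- z))) ℤ.+
      (+ 3 ℤ.* j ℤ.+ e) ℤ.* (+ 3 ℤ.* j ℤ.+ e)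
    values = ℤ.solve-∀

  -- The sum `ε r + ε e` is a balanced residue up to a carry of `s` multiples of 3, and the carry
  -- only translates `j`.
  E-shift : ∀ r e r′ s → Small 1 s → (∀ j → tri r j ℤ.+ ε e ≡ tri r′ (j ℤ.+ s)) →
            ⟪ (λ j → σQ (tri r j ℤ.+ ε e , □ (tri r j ℤ.+ ε e))) ⟫ B ≈ E r′
  E-shift r e r′ s s-small eq = ≈-sym (≈-reindex (EQ r′) _ (ℤ._+ s) (ℤ._- s) B! B!
    (λ j → cancel₁ j s) (λ j → cancel₂ j s)
    (λ j → cong (+ 3 ℤ.*_) (sym (eq j)) & cong (λ n → + 3 ℤ.* (n ℤ.* n)) (sym (eq j)))
    (λ j p → small-∈B (E-small j p))
    (λ j p → small-∈B (small-- (E-small j p) s-small)))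
    where
    E-small : Within (EQ r′) (Small 2)
    E-small j p = x-small r′ j (ℕ.≤-trans (ℕ.m≤n*m _ 3) p)
    cancel₁ : ∀ j s → j ℤ.+ s ℤ.- s ≡ j
    cancel₁ = ℤ.solve-∀
    cancel₂ : ∀ j s → j ℤ.- s ℤ.+ s ≡ j
    cancel₂ = ℤ.solve-∀

  -- With k = 3j + ε e and l of coordinate sum ρ, the squares of k + 3lᵢ add up to 3 (3|l|² - ρ²) +
  -- 3 (k + ρ)², and the z-exponent is 3 (k + ρ). The common factor 3 is why the right-hand side
  -- consists of series in z³ and Q³.
  x-cube′ : ∀ e → x e ⊛ (x e ⊛ x e) ≈
    A ⊛ ⟪ (λ j → σQ (tri 0F j ℤ.+ ε e , □ (tri 0F j ℤ.+ ε e))) ⟫ B ⊕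
    (C ⊛ ⟪ (λ j → σQ (tri 1F j ℤ.+ ε e , □ (tri 1F j ℤ.+ ε e))) ⟫ B ⊕
     C ⊛ ⟪ (λ j → σQ (tri 2F j ℤ.+ ε e , □ (tri 2F j ℤ.+ ε e))) ⟫ B)
  x-cube′ e = ≈-trans
    (trilinear (xQ e) (xQ e) (xQ e) (λ r → σQ ∘ cubicQ (ε r))
      (λ r j → σQ (tri r j ℤ.+ ε e , □ (tri r j ℤ.+ ε e)))
      (λ r j y z → exponents (ε e) (ε r) j y z & values (ε e) (ε r) j y z)
      (x-small e) (x-small e) (x-small e))
    (+-cong (≡⇒≈ refl) (+-cong (≡⇒≈ refl) (⊛-congʳ _
      (⟪σQ⟫-cong {F = cubicQ -[1+ 0 ]} {cubicQ (+ 1)} cubic-neg))))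
    where
    exponents : ∀ e r j y z →
      + 3 ℤ.* (j ℤ.+ (r ℤ.- y ℤ.- z)) ℤ.+ e ℤ.+ (+ 3 ℤ.* (j ℤ.+ y) ℤ.+ e ℤ.+ (+ 3 ℤ.* (j ℤ.+ z) ℤ.+ e)) ≡
      + 0 ℤ.+ + 3 ℤ.* (+ 3 ℤ.* j ℤ.+ r ℤ.+ e)
    exponents = ℤ.solve-∀
    values : ∀ e r j y z →
      (+ 3 ℤ.* (j ℤ.+ (r ℤ.- y ℤ.- z)) ℤ.+ e) ℤ.* (+ 3 ℤ.* (j ℤ.+ (r ℤ.- y ℤ.- z)) ℤ.+ e) ℤ.+
      ((+ 3 ℤ.* (j ℤ.+ y) ℤ.+ e) ℤ.* (+ 3 ℤ.* (j ℤ.+ y) ℤ.+ e) ℤ.+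
       (+ 3 ℤ.* (j ℤ.+ z) ℤ.+ e) ℤ.* (+ 3 ℤ.* (j ℤ.+ z) ℤ.+ e)) ≡
      + 3 ℤ.* ((r ℤ.- y ℤ.- z ℤ.- y) ℤ.* (r ℤ.- y ℤ.- z ℤ.- y) ℤ.+
               ((y ℤ.- z) ℤ.* (y ℤ.- z) ℤ.+ (z ℤ.- (r ℤ.- y ℤ.- z)) ℤ.* (z ℤ.- (r ℤ.- y ℤ.- z)))) ℤ.+
      + 3 ℤ.* ((+ 3 ℤ.* j ℤ.+ r ℤ.+ e) ℤ.* (+ 3 ℤ.* j ℤ.+ r ℤ.+ e))
    values = ℤ.solve-∀

  private
    tri+0 : ∀ r j → tri r j ℤ.+ + 0 ≡ tri r (j ℤ.+ + 0)
    tri+0 r j = identity j (ε r)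
      where
      identity : ∀ j e → + 3 ℤ.* j ℤ.+ e ℤ.+ + 0 ≡ + 3 ℤ.* (j ℤ.+ + 0) ℤ.+ e
      identity = ℤ.solve-∀

    0+tri : ∀ e j → tri 0F j ℤ.+ ε e ≡ tri e (j ℤ.+ + 0)
    0+tri e j = identity j (ε e)
      where
      identity : ∀ j e → + 3 ℤ.* j ℤ.+ + 0 ℤ.+ e ≡ + 3 ℤ.* (j ℤ.+ + 0) ℤ.+ e
      identity = ℤ.solve-∀

    1+1 : ∀ j → + 3 ℤ.* j ℤ.+ + 1 ℤ.+ + 1 ≡ + 3 ℤ.* (j ℤ.+ + 1) ℤ.+ -[1+ 0 ]
    1+1 = ℤ.solve-∀

    -1-1 : ∀ j → + 3 ℤ.* j ℤ.+ -[1+ 0 ] ℤ.+ -[1+ 0 ] ≡ + 3 ℤ.* (j ℤ.+ -[1+ 0 ]) ℤ.+ + 1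
    -1-1 = ℤ.solve-∀

    -1+1 : ∀ j → + 3 ℤ.* j ℤ.+ -[1+ 0 ] ℤ.+ + 1 ≡ + 3 ℤ.* (j ℤ.+ + 0) ℤ.+ + 0
    -1+1 = ℤ.solve-∀

    1-1 : ∀ j → + 3 ℤ.* j ℤ.+ + 1 ℤ.+ -[1+ 0 ] ≡ + 3 ℤ.* (j ℤ.+ + 0) ℤ.+ + 0
    1-1 = ℤ.solve-∀

  x₀-cube : x 0F ⊛ (x 0F ⊛ x 0F) ≈ A ⊛ E 0F ⊕ (C ⊛ E 1F ⊕ C ⊛ E 2F)
  x₀-cube = ≈-trans (x-cube′ 0F) (+-cong
    (⊛-congˡ A (E-shift 0F 0F 0F (+ 0) (small-const _) (tri+0 0F))) (+-cong
    (⊛-congˡ C (E-shift 1F 0F 1F (+ 0) (small-const _) (tri+0 1F)))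
    (⊛-congˡ C (E-shift 2F 0F 2F (+ 0) (small-const _) (tri+0 2F)))))

  x₁-cube : x 1F ⊛ (x 1F ⊛ x 1F) ≈
            A ⊛ E 1F ⊕ (C ⊛ E 2F ⊕ C ⊛ E 0F)
  x₁-cube = ≈-trans (x-cube′ 1F) (+-cong
    (⊛-congˡ A (E-shift 0F 1F 1F (+ 0) (small-const _) (0+tri 1F))) (+-cong
    (⊛-congˡ C (E-shift 1F 1F 2F (+ 1) (small-const _) 1+1))
    (⊛-congˡ C (E-shift 2F 1F 0F (+ 0) (small-const _) -1+1))))

  x₂-cube : x 2F ⊛ (x 2F ⊛ x 2F) ≈
            A ⊛ E 2F ⊕ (C ⊛ E 0F ⊕ C ⊛ E 1F)
  x₂-cube = ≈-trans (x-cube′ 2F) (+-cong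
    (⊛-congˡ A (E-shift 0F 2F 2F (+ 0) (small-const _) (0+tri 2F))) (+-cong
    (⊛-congˡ C (E-shift 1F 2F 0F (+ 0) (small-const _) 1-1))
    (⊛-congˡ C (E-shift 2F 2F 1F -[1+ 0 ] (small-const _) -1-1))))

  M-reindex : (G : ℤ × ℤ → QMon) (g h : ℤ × ℤ → ℤ × ℤ) →
              (∀ j → h (g j) ≡ j) → (∀ i → g (h i) ≡ i) → (∀ j → MQ (g j) ≐ G j) →
              (∀ {b c} → Small 2 b → Small 2 c → h (b , c) ∈ B²) →
              ⟪ G ⟫ B² ≈ M
  M-reindex G g h hg gh eq h-small = ≈-sym (≈-reindex (MQ) (G) g h B²! B²! hg gh
    eq
    (λ i p → ∈-cartesianProduct⁺ (small-∈B (proj₁ (M-small i p))) (small-∈B (proj₂ (M-small i p))))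
    (λ i p → h-small (proj₁ (M-small i p)) (proj₂ (M-small i p))))

  -- The three coordinates have mean `3 j + ε r`. Subtracting it leaves a vector of sum 0 whose
  -- residues modulo 3 are 0, 1, -1 in some cyclic order depending on `r`. The mean accounts for
  -- `EQ r`, and `D r` is `MQ` up to the cyclic order of the coordinates.
  x₀x₁x₂ : x 0F ⊛ (x 1F ⊛ x 2F) ≈
           M ⊛ E 0F ⊕ (M ⊛ E 1F ⊕ M ⊛ E 2F)
  x₀x₁x₂ = ≈-trans
    (trilinear (xQ 0F) (xQ 1F) (xQ 2F) D EQ
      (λ r j y z → exponents (ε r) j y z & values (ε r) j y z)
      (x-small 0F) (x-small 1F) (x-small 2F))
    (+-cong (⊛-congʳ _ D₀) (+-cong (⊛-congʳ _ D₁) (⊛-congʳ _ D₂)))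
    where
    D : Fin 3 → ℤ × ℤ → QMon
    D r (y , z) = + 0 , □ (+ 3 ℤ.* (ε r ℤ.- y ℤ.- z) ℤ.- ε r) ⊞ □ (+ 3 ℤ.* y ℤ.+ + 1 ℤ.- ε r)
                          ⊞ □ (+ 3 ℤ.* z ℤ.- + 1 ℤ.- ε r)
    exponents : ∀ e j y z →
      + 3 ℤ.* (j ℤ.+ (e ℤ.- y ℤ.- z)) ℤ.+ + 0 ℤ.+ (+ 3 ℤ.* (j ℤ.+ y) ℤ.+ + 1 ℤ.+ (+ 3 ℤ.* (j ℤ.+ z) ℤ.+ -[1+ 0 ])) ≡
      + 0 ℤ.+ + 3 ℤ.* (+ 3 ℤ.* j ℤ.+ e)
    exponents = ℤ.solve-∀
    values : ∀ e j y z →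
      (+ 3 ℤ.* (j ℤ.+ (e ℤ.- y ℤ.- z)) ℤ.+ + 0) ℤ.* (+ 3 ℤ.* (j ℤ.+ (e ℤ.- y ℤ.- z)) ℤ.+ + 0) ℤ.+
      ((+ 3 ℤ.* (j ℤ.+ y) ℤ.+ + 1) ℤ.* (+ 3 ℤ.* (j ℤ.+ y) ℤ.+ + 1) ℤ.+
       (+ 3 ℤ.* (j ℤ.+ z) ℤ.+ -[1+ 0 ]) ℤ.* (+ 3 ℤ.* (j ℤ.+ z) ℤ.+ -[1+ 0 ])) ≡
      (+ 3 ℤ.* (e ℤ.- y ℤ.- z) ℤ.- e) ℤ.* (+ 3 ℤ.* (e ℤ.- y ℤ.- z) ℤ.- e) ℤ.+
      ((+ 3 ℤ.* y ℤ.+ + 1 ℤ.- e) ℤ.* (+ 3 ℤ.* y ℤ.+ + 1 ℤ.- e) ℤ.+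
       (+ 3 ℤ.* z ℤ.- + 1 ℤ.- e) ℤ.* (+ 3 ℤ.* z ℤ.- + 1 ℤ.- e)) ℤ.+
      + 3 ℤ.* ((+ 3 ℤ.* j ℤ.+ e) ℤ.* (+ 3 ℤ.* j ℤ.+ e))
    values = ℤ.solve-∀
    D₀ : ⟪ D 0F ⟫ B² ≈ M
    D₀ = ≡⇒≈ (⟪⟫-cong (λ (y , z) → refl & identity y z) B²)
      where
      identity : ∀ y z →
        (+ 3 ℤ.* (+ 0 ℤ.- y ℤ.- z) ℤ.- + 0) ℤ.* (+ 3 ℤ.* (+ 0 ℤ.- y ℤ.- z) ℤ.- + 0) ℤ.+
        ((+ 3 ℤ.* y ℤ.+ + 1 ℤ.- + 0) ℤ.* (+ 3 ℤ.* y ℤ.+ + 1 ℤ.- + 0) ℤ.+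
         (+ 3 ℤ.* z ℤ.- + 1 ℤ.- + 0) ℤ.* (+ 3 ℤ.* z ℤ.- + 1 ℤ.- + 0)) ≡
        + 3 ℤ.* (y ℤ.+ z) ℤ.* (+ 3 ℤ.* (y ℤ.+ z)) ℤ.+
        ((+ 3 ℤ.* y ℤ.+ + 1) ℤ.* (+ 3 ℤ.* y ℤ.+ + 1) ℤ.+ (+ 3 ℤ.* z ℤ.- + 1) ℤ.* (+ 3 ℤ.* z ℤ.- + 1))
      identity = ℤ.solve-∀
    D₁ : ⟪ D 1F ⟫ B² ≈ M
    D₁ = M-reindex (D 1F) (λ (y , z) → z ℤ.- + 1 , + 1 ℤ.- y ℤ.- z) (λ (b , c) → - b ℤ.- c , b ℤ.+ + 1)
      (λ (y , z) → cong₂ _,_ (hg₁ y z) (hg₂ z)) (λ (b , c) → cong₂ _,_ (gh₁ b) (gh₂ b c))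
      (λ (y , z) → refl & sym (identity y z))
      (λ p q → ∈-cartesianProduct⁺ (small-∈B (small-- (small-neg p) q)) (small-∈B (small-+ p (small-const _))))
      where
      hg₁ : ∀ y z → - (z ℤ.- + 1) ℤ.- (+ 1 ℤ.- y ℤ.- z) ≡ y
      hg₁ = ℤ.solve-∀
      hg₂ : ∀ z → z ℤ.- + 1 ℤ.+ + 1 ≡ z
      hg₂ = ℤ.solve-∀
      gh₁ : ∀ b → b ℤ.+ + 1 ℤ.- + 1 ≡ b
      gh₁ = ℤ.solve-∀
      gh₂ : ∀ b c → + 1 ℤ.- (- b ℤ.- c) ℤ.- (b ℤ.+ + 1) ≡ c
      gh₂ = ℤ.solve-∀
      identity : ∀ y z →
        (+ 3 ℤ.* (+ 1 ℤ.- y ℤ.- z) ℤ.- + 1) ℤ.* (+ 3 ℤ.* (+ 1 ℤ.- y ℤ.- z) ℤ.- + 1) ℤ.+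
        ((+ 3 ℤ.* y ℤ.+ + 1 ℤ.- + 1) ℤ.* (+ 3 ℤ.* y ℤ.+ + 1 ℤ.- + 1) ℤ.+
         (+ 3 ℤ.* z ℤ.- + 1 ℤ.- + 1) ℤ.* (+ 3 ℤ.* z ℤ.- + 1 ℤ.- + 1)) ≡
        + 3 ℤ.* (z ℤ.- + 1 ℤ.+ (+ 1 ℤ.- y ℤ.- z)) ℤ.* (+ 3 ℤ.* (z ℤ.- + 1 ℤ.+ (+ 1 ℤ.- y ℤ.- z))) ℤ.+
        ((+ 3 ℤ.* (z ℤ.- + 1) ℤ.+ + 1) ℤ.* (+ 3 ℤ.* (z ℤ.- + 1) ℤ.+ + 1) ℤ.+
         (+ 3 ℤ.* (+ 1 ℤ.- y ℤ.- z) ℤ.- + 1) ℤ.* (+ 3 ℤ.* (+ 1 ℤ.- y ℤ.- z) ℤ.- + 1))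
      identity = ℤ.solve-∀
    D₂ : ⟪ D 2F ⟫ B² ≈ M
    D₂ = M-reindex (D 2F) (λ (y , z) → -[1+ 0 ] ℤ.- y ℤ.- z , y ℤ.+ + 1) (λ (b , c) → c ℤ.- + 1 , - b ℤ.- c)
      (λ (y , z) → cong₂ _,_ (hg₁ y) (hg₂ y z)) (λ (b , c) → cong₂ _,_ (gh₁ b c) (gh₂ c))
      (λ (y , z) → refl & sym (identity y z))
      (λ p q → ∈-cartesianProduct⁺ (small-∈B (small-- q (small-const _))) (small-∈B (small-- (small-neg p) q)))
      where
      hg₁ : ∀ y → y ℤ.+ + 1 ℤ.- + 1 ≡ y
      hg₁ = ℤ.solve-∀
      hg₂ : ∀ y z → - (-[1+ 0 ] ℤ.- y ℤ.- z) ℤ.- (y ℤ.+ + 1) ≡ z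
      hg₂ = ℤ.solve-∀
      gh₁ : ∀ b c → -[1+ 0 ] ℤ.- (c ℤ.- + 1) ℤ.- (- b ℤ.- c) ≡ b
      gh₁ = ℤ.solve-∀
      gh₂ : ∀ c → c ℤ.- + 1 ℤ.+ + 1 ≡ c
      gh₂ = ℤ.solve-∀
      identity : ∀ y z →
        (+ 3 ℤ.* (-[1+ 0 ] ℤ.- y ℤ.- z) ℤ.- -[1+ 0 ]) ℤ.* (+ 3 ℤ.* (-[1+ 0 ] ℤ.- y ℤ.- z) ℤ.- -[1+ 0 ]) ℤ.+
        ((+ 3 ℤ.* y ℤ.+ + 1 ℤ.- -[1+ 0 ]) ℤ.* (+ 3 ℤ.* y ℤ.+ + 1 ℤ.- -[1+ 0 ]) ℤ.+
         (+ 3 ℤ.* z ℤ.- + 1 ℤ.- -[1+ 0 ]) ℤ.* (+ 3 ℤ.* z ℤ.- + 1 ℤ.- -[1+ 0 ])) ≡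
        + 3 ℤ.* (-[1+ 0 ] ℤ.- y ℤ.- z ℤ.+ (y ℤ.+ + 1)) ℤ.* (+ 3 ℤ.* (-[1+ 0 ] ℤ.- y ℤ.- z ℤ.+ (y ℤ.+ + 1))) ℤ.+
        ((+ 3 ℤ.* (-[1+ 0 ] ℤ.- y ℤ.- z) ℤ.+ + 1) ℤ.* (+ 3 ℤ.* (-[1+ 0 ] ℤ.- y ℤ.- z) ℤ.+ + 1) ℤ.+
         (+ 3 ℤ.* (y ℤ.+ + 1) ℤ.- + 1) ℤ.* (+ 3 ℤ.* (y ℤ.+ + 1) ℤ.- + 1))
      identity = ℤ.solve-∀

-- Dissection of the cubic theta functions a and c

module Cubic (K : ℕ) where
  open Theta K public

  -- Splitting the lattice sum by y - z modulo 3.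
  splitQ : Fin 3 → ℤ × ℤ → ℤ × ℤ
  splitQ r (p , q) = q ℤ.- p , - p ℤ.- + 2 ℤ.* q ℤ.- ε r

  cubic-split : ∀ {ρ} → Small 1 ρ →
    cubic ρ ≈ ⟪ cubicQ ρ ∘ splitQ 0F ⟫ B² ⊕
              (⟪ cubicQ ρ ∘ splitQ 1F ⟫ B² ⊕ ⟪ cubicQ ρ ∘ splitQ 2F ⟫ B²)
  cubic-split {ρ} ρ-small = ≈-trans
    (≈-reindex (cubicQ ρ) (λ (r , p) → cubicQ ρ (splitQ r p)) (λ (r , p) → splitQ r p) from B²!
      (Unique.cartesianProduct⁺ (Unique.allFin⁺ 3) B²!)
      from-split split-from (λ _ → refl & refl)
      (λ i p → small-pair (cubic-small {ρ} ρ-small i p))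
      (λ i p → ∈-cartesianProduct⁺ (∈-allFin _) (from-small i (cubic-small {ρ} ρ-small i p))))
    (⟪⟫-allFin₃ (λ (r , p) → cubicQ ρ (splitQ r p)) B²)
    where
    from : ℤ × ℤ → Fin 3 × ℤ × ℤ
    from (y , z) = residue (y ℤ.- z) , quotient (y ℤ.- z) ℤ.- y , quotient (y ℤ.- z)
    difference : ∀ p q e → q ℤ.- p ℤ.- (- p ℤ.- + 2 ℤ.* q ℤ.- e) ≡ + 3 ℤ.* q ℤ.+ e
    difference = ℤ.solve-∀
    cancel : ∀ p q → q ℤ.- (q ℤ.- p) ≡ p
    cancel = ℤ.solve-∀
    from-split : ∀ j → from (splitQ (proj₁ j) (proj₂ j)) ≡ j
    from-split (r , p , q)
      rewrite difference p q (ε r) | residue-tri r q | quotient-tri r q | cancel p q = refl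
    split-from : ∀ i → splitQ (proj₁ (from i)) (proj₂ (from i)) ≡ i
    split-from (y , z) = cong₂ _,_ (cancel y (quotient d))
      (trans (second y (quotient d) (ε (residue d))) (trans (cong (λ k → y ℤ.- k) (tri-residue-quotient d)) (cancel z y)))
      where
      d = y ℤ.- z
      second : ∀ y q e → - (q ℤ.- y) ℤ.- + 2 ℤ.* q ℤ.- e ≡ y ℤ.- (+ 3 ℤ.* q ℤ.+ e)
      second = ℤ.solve-∀
    from-small : ∀ ((y , z) : ℤ × ℤ) → Small 3 y × Small 3 z → proj₂ (from (y , z)) ∈ B²
    from-small (y , z) (p , q) = ∈-cartesianProduct⁺ (small-∈B (small-- q-small p)) (small-∈B q-small)
      where
      q-small : Small 7 (quotient (y ℤ.- z))
      q-small = small-tri {r = residue (y ℤ.- z)}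
        (subst (Small 6) (sym (tri-residue-quotient (y ℤ.- z))) (small-- p q))

  -- For coordinate sum 1, a cyclic permutation of (1 - y - z, y, z) preserves the form and changes
  -- the class of `y - z` modulo 3. So the three classes contribute equally, and in suitable
  -- coordinates each of them is `MQ`.
  c≈3M : c ≈ M ⊕ (M ⊕ M)
  c≈3M = ≈-trans (cubic-split {+ 1} (small-const _)) (+-cong
    (M-reindex (cubicQ (+ 1) ∘ splitQ 0F)
      (λ (p , q) → p , - (p ℤ.+ q)) (λ (b , c) → b , - (b ℤ.+ c))
      (λ (p , q) → cong (p ,_) (cancel₁ p q)) (λ (b , c) → cong (b ,_) (cancel₁ b c))
      (λ (p , q) → refl & values₀ p q)
      (λ p q → ∈-cartesianProduct⁺ (small-∈B p) (small-∈B (small-neg (small-+ p q))))) (+-cong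
    (M-reindex (cubicQ (+ 1) ∘ splitQ 1F)
      (λ (p , q) → q , p ℤ.+ + 1) (λ (b , c) → c ℤ.- + 1 , b)
      (λ (p , q) → cong (_, q) (cancel₂ p)) (λ (b , c) → cong (b ,_) (cancel₃ c))
      (λ (p , q) → refl & values₁ p q)
      (λ p q → ∈-cartesianProduct⁺ (small-∈B (small-- q (small-const _))) (small-∈B p)))
    (M-reindex (cubicQ (+ 1) ∘ splitQ 2F)
      (λ (p , q) → - (p ℤ.+ q) , q) (λ (b , c) → - (b ℤ.+ c) , c)
      (λ (p , q) → cong (_, q) (cancel₄ p q)) (λ (b , c) → cong (_, c) (cancel₄ b c))
      (λ (p , q) → refl & values₂ p q)
      (λ p q → ∈-cartesianProduct⁺ (small-∈B (small-neg (small-+ p q))) (small-∈B q)))))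
    where
    cancel₁ : ∀ p q → - (p ℤ.+ - (p ℤ.+ q)) ≡ q
    cancel₁ = ℤ.solve-∀
    cancel₂ : ∀ p → p ℤ.+ + 1 ℤ.- + 1 ≡ p
    cancel₂ = ℤ.solve-∀
    cancel₃ : ∀ p → p ℤ.- + 1 ℤ.+ + 1 ≡ p
    cancel₃ = ℤ.solve-∀
    cancel₄ : ∀ p q → - (- (p ℤ.+ q) ℤ.+ q) ≡ p
    cancel₄ = ℤ.solve-∀
    values₀ : ∀ p q →
      + 3 ℤ.* (p ℤ.+ - (p ℤ.+ q)) ℤ.* (+ 3 ℤ.* (p ℤ.+ - (p ℤ.+ q))) ℤ.+
      ((+ 3 ℤ.* p ℤ.+ + 1) ℤ.* (+ 3 ℤ.* p ℤ.+ + 1) ℤ.+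
       (+ 3 ℤ.* (- (p ℤ.+ q)) ℤ.- + 1) ℤ.* (+ 3 ℤ.* (- (p ℤ.+ q)) ℤ.- + 1)) ≡
      (+ 1 ℤ.- (q ℤ.- p) ℤ.- (- p ℤ.- + 2 ℤ.* q ℤ.- + 0) ℤ.- (q ℤ.- p)) ℤ.*
        (+ 1 ℤ.- (q ℤ.- p) ℤ.- (- p ℤ.- + 2 ℤ.* q ℤ.- + 0) ℤ.- (q ℤ.- p)) ℤ.+
      ((q ℤ.- p ℤ.- (- p ℤ.- + 2 ℤ.* q ℤ.- + 0)) ℤ.* (q ℤ.- p ℤ.- (- p ℤ.- + 2 ℤ.* q ℤ.- + 0)) ℤ.+
       (- p ℤ.- + 2 ℤ.* q ℤ.- + 0 ℤ.- (+ 1 ℤ.- (q ℤ.- p) ℤ.- (- p ℤ.- + 2 ℤ.* q ℤ.- + 0))) ℤ.*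
         (- p ℤ.- + 2 ℤ.* q ℤ.- + 0 ℤ.- (+ 1 ℤ.- (q ℤ.- p) ℤ.- (- p ℤ.- + 2 ℤ.* q ℤ.- + 0))))
    values₀ = ℤ.solve-∀
    values₁ : ∀ p q →
      + 3 ℤ.* (q ℤ.+ (p ℤ.+ + 1)) ℤ.* (+ 3 ℤ.* (q ℤ.+ (p ℤ.+ + 1))) ℤ.+
      ((+ 3 ℤ.* q ℤ.+ + 1) ℤ.* (+ 3 ℤ.* q ℤ.+ + 1) ℤ.+
       (+ 3 ℤ.* (p ℤ.+ + 1) ℤ.- + 1) ℤ.* (+ 3 ℤ.* (p ℤ.+ + 1) ℤ.- + 1)) ≡
      (+ 1 ℤ.- (q ℤ.- p) ℤ.- (- p ℤ.- + 2 ℤ.* q ℤ.- + 1) ℤ.- (q ℤ.- p)) ℤ.*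
        (+ 1 ℤ.- (q ℤ.- p) ℤ.- (- p ℤ.- + 2 ℤ.* q ℤ.- + 1) ℤ.- (q ℤ.- p)) ℤ.+
      ((q ℤ.- p ℤ.- (- p ℤ.- + 2 ℤ.* q ℤ.- + 1)) ℤ.* (q ℤ.- p ℤ.- (- p ℤ.- + 2 ℤ.* q ℤ.- + 1)) ℤ.+
       (- p ℤ.- + 2 ℤ.* q ℤ.- + 1 ℤ.- (+ 1 ℤ.- (q ℤ.- p) ℤ.- (- p ℤ.- + 2 ℤ.* q ℤ.- + 1))) ℤ.*
         (- p ℤ.- + 2 ℤ.* q ℤ.- + 1 ℤ.- (+ 1 ℤ.- (q ℤ.- p) ℤ.- (- p ℤ.- + 2 ℤ.* q ℤ.- + 1))))
    values₁ = ℤ.solve-∀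
    values₂ : ∀ p q →
      + 3 ℤ.* (- (p ℤ.+ q) ℤ.+ q) ℤ.* (+ 3 ℤ.* (- (p ℤ.+ q) ℤ.+ q)) ℤ.+
      ((+ 3 ℤ.* (- (p ℤ.+ q)) ℤ.+ + 1) ℤ.* (+ 3 ℤ.* (- (p ℤ.+ q)) ℤ.+ + 1) ℤ.+
       (+ 3 ℤ.* q ℤ.- + 1) ℤ.* (+ 3 ℤ.* q ℤ.- + 1)) ≡
      (+ 1 ℤ.- (q ℤ.- p) ℤ.- (- p ℤ.- + 2 ℤ.* q ℤ.- -[1+ 0 ]) ℤ.- (q ℤ.- p)) ℤ.*
        (+ 1 ℤ.- (q ℤ.- p) ℤ.- (- p ℤ.- + 2 ℤ.* q ℤ.- -[1+ 0 ]) ℤ.- (q ℤ.- p)) ℤ.+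
      ((q ℤ.- p ℤ.- (- p ℤ.- + 2 ℤ.* q ℤ.- -[1+ 0 ])) ℤ.* (q ℤ.- p ℤ.- (- p ℤ.- + 2 ℤ.* q ℤ.- -[1+ 0 ])) ℤ.+
       (- p ℤ.- + 2 ℤ.* q ℤ.- -[1+ 0 ] ℤ.- (+ 1 ℤ.- (q ℤ.- p) ℤ.- (- p ℤ.- + 2 ℤ.* q ℤ.- -[1+ 0 ]))) ℤ.*
         (- p ℤ.- + 2 ℤ.* q ℤ.- -[1+ 0 ] ℤ.- (+ 1 ℤ.- (q ℤ.- p) ℤ.- (- p ℤ.- + 2 ℤ.* q ℤ.- -[1+ 0 ]))))
    values₂ = ℤ.solve-∀

  C≈3t : C ≈ t ⊕ (t ⊕ t)
  C≈3t = ≈-trans (≡⇒≈ (sym (σ*-⟪⟫ (cubicQ (+ 1)) B²)))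
    (≈-trans (σ*-cong c≈3M) (≡⇒≈ (trans (σ*-⊕ M (M ⊕ M)) (cong₂ _⊕_ (σ*-⟪⟫ MQ B²)
      (trans (σ*-⊕ M M) (cong₂ _⊕_ (σ*-⟪⟫ MQ B²) (σ*-⟪⟫ MQ B²)))))))
    where
    opaque
      unfolding σ* _⊕_
      σ*-⊕ : ∀ u v → σ* (u ⊕ v) ≡ σ* u ⊕ σ* v
      σ*-⊕ = List.map-++ σ

  -- For coordinate sum 0 the classes are not permuted: on the class of `ε r` the form is three
  -- times the form of coordinate sum `- ε r`. The class 0 is the copy of the hexagonal lattice
  -- inside itself of index 3, scaled by √3; the other two classes are its translates.
  a≈A+2C : a ≈ A ⊕ (C ⊕ C)
  a≈A+2C = ≈-trans (cubic-split {+ 0} (small-const _)) (+-cong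
    (≡⇒≈ (⟪⟫-cong (λ (p , q) → refl & values (+ 0) p q) B²)) (+-cong
    (≈-trans (≡⇒≈ (⟪⟫-cong (λ (p , q) → refl & values (+ 1) p q) B²))
             (⟪σQ⟫-cong {F = cubicQ -[1+ 0 ]} {cubicQ (+ 1)} cubic-neg))
    (≡⇒≈ (⟪⟫-cong (λ (p , q) → refl & values -[1+ 0 ] p q) B²))))
    where
    values : ∀ e p q →
      (+ 0 ℤ.- (q ℤ.- p) ℤ.- (- p ℤ.- + 2 ℤ.* q ℤ.- e) ℤ.- (q ℤ.- p)) ℤ.*
        (+ 0 ℤ.- (q ℤ.- p) ℤ.- (- p ℤ.- + 2 ℤ.* q ℤ.- e) ℤ.- (q ℤ.- p)) ℤ.+
      ((q ℤ.- p ℤ.- (- p ℤ.- + 2 ℤ.* q ℤ.- e)) ℤ.* (q ℤ.- p ℤ.- (- p ℤ.- + 2 ℤ.* q ℤ.- e)) ℤ.+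
       (- p ℤ.- + 2 ℤ.* q ℤ.- e ℤ.- (+ 0 ℤ.- (q ℤ.- p) ℤ.- (- p ℤ.- + 2 ℤ.* q ℤ.- e))) ℤ.*
         (- p ℤ.- + 2 ℤ.* q ℤ.- e ℤ.- (+ 0 ℤ.- (q ℤ.- p) ℤ.- (- p ℤ.- + 2 ℤ.* q ℤ.- e)))) ≡
      + 3 ℤ.* ((- e ℤ.- p ℤ.- q ℤ.- p) ℤ.* (- e ℤ.- p ℤ.- q ℤ.- p) ℤ.+
               ((p ℤ.- q) ℤ.* (p ℤ.- q) ℤ.+ (q ℤ.- (- e ℤ.- p ℤ.- q)) ℤ.* (q ℤ.- (- e ℤ.- p ℤ.- q))))
    values = ℤ.solve-∀

∑-zero-All : {A : Set} {f : A → ℕ} {xs : List A} → All (λ x → f x ≡ 0) xs → ∑ f xs ≡ 0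
∑-zero-All []       = refl
∑-zero-All (p ∷ ps) = cong₂ ℕ._+_ p (∑-zero-All ps)

-- Gradings

zdeg qdeg : Mon → ℤ
zdeg s = proj₁ s
qdeg s = + proj₂ s

Additive : (Mon → ℤ) → Set
Additive χ = ∀ s t → χ (s ∙ t) ≡ χ s ℤ.+ χ t

zdeg-additive : Additive zdeg
zdeg-additive s t = refl

qdeg-additive : Additive qdeg
qdeg-additive s t = refl

record Congruent (d r n : ℤ) : Set where
  constructor _by_
  field
    multiplier : ℤ
    equation   : n ≡ d ℤ.* multiplier ℤ.+ r

congruent-+ : ∀ {d r r′ n n′} → Congruent d r n → Congruent d r′ n′ → Congruent d (r ℤ.+ r′) (n ℤ.+ n′)
congruent-+ {d} {r} {r′} (k by e) (k′ by e′) = (k ℤ.+ k′) by trans (cong₂ ℤ._+_ e e′) (identity d k r k′ r′)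
  where
  identity : ∀ d k r k′ r′ → d ℤ.* k ℤ.+ r ℤ.+ (d ℤ.* k′ ℤ.+ r′) ≡ d ℤ.* (k ℤ.+ k′) ℤ.+ (r ℤ.+ r′)
  identity = ℤ.solve-∀

record Graded (χ : Mon → ℤ) (d r : ℤ) (u : Laurent) : Set where
  constructor graded
  field all : All (λ s → Congruent d r (χ s)) u

module _ {χ : Mon → ℤ} {d : ℤ} where
  opaque
    unfolding _⊕_ ⟪_⟫

    graded-𝟘 : ∀ {r} → Graded χ d r 𝟘
    graded-𝟘 = graded []

    graded-⊕ : ∀ {r u v} → Graded χ d r u → Graded χ d r v → Graded χ d r (u ⊕ v)
    graded-⊕ (graded p) (graded q) = graded (All.++⁺ p q)

    graded-⊛ : ∀ {r r′ u v} → Additive χ → Graded χ d r u → Graded χ d r′ v → Graded χ d (r ℤ.+ r′) (u ⊛ v)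
    graded-⊛ χ-+ (graded [])       (graded qs) = graded []
    graded-⊛ χ-+ (graded (_∷_ {s} p ps)) (graded qs) = graded (All.++⁺
      (All.map⁺ (All.map (λ {t} q → subst (Congruent d _) (sym (χ-+ s t)) (congruent-+ p q)) qs))
      (Graded.all (graded-⊛ χ-+ (graded ps) (graded qs))))

    graded-⟪⟫ : ∀ {r} {F : I → QMon} → (∀ i → Congruent d r (χ ⌊ F i ⌋)) → ∀ is → Graded χ d r (⟪ F ⟫ is)
    graded-⟪⟫ p is = graded (All.map⁺ (All.tabulate (λ _ → p _)))

  graded-shift : ∀ {r r′ u} → Congruent d r′ r → Graded χ d r u → Graded χ d r′ u
  graded-shift {r} {r′} (k by e) (graded p) = graded (All.map shift p)
    where
    identity : ∀ d k j r′ → d ℤ.* j ℤ.+ (d ℤ.* k ℤ.+ r′) ≡ d ℤ.* (j ℤ.+ k) ℤ.+ r′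
    identity = ℤ.solve-∀
    shift : ∀ {n} → Congruent d r n → Congruent d r′ n
    shift (j by e′) = (j ℤ.+ k) by trans e′ (trans (cong (λ r → d ℤ.* j ℤ.+ r) e) (identity d k j r′))

-- Congruence modulo 0 is equality, so z does not occur in u.
ZFree : Laurent → Set
ZFree = Graded zdeg (+ 0) (+ 0)

zfree-⊕ : ∀ {u v} → ZFree u → ZFree v → ZFree (u ⊕ v)
zfree-⊕ = graded-⊕

zfree-⊛ : ∀ {u v} → ZFree u → ZFree v → ZFree (u ⊛ v)
zfree-⊛ = graded-⊛ zdeg-additive

zfree-⟪⟫ : {F : I → QMon} → (∀ i → proj₁ (F i) ≡ + 0) → ∀ is → ZFree (⟪ F ⟫ is)
zfree-⟪⟫ p = graded-⟪⟫ (λ i → (+ 0) by p i)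

zdeg≡0 : ∀ {n} → Congruent (+ 0) (+ 0) n → n ≡ + 0
zdeg≡0 (k by e) = trans e (trans (ℤ.+-identityʳ _) (ℤ.*-zeroˡ k))

-- Extraction of constant terms, and cancellation

module Parts (K : ℕ) where
  open Cubic K public

  restrict : (Mon → Bool) → (Mon → ℕ) → Mon → ℕ
  restrict p φ s = if p s then φ s else 0

  module _ (p : Mon → Bool) where

    opaque
      keep : Laurent → Laurent
      keep []      = []
      keep (s ∷ u) = if p s then s ∷ keep u else keep u

      ∑-keep : ∀ φ u → ∑ φ (keep u) ≡ ∑ (restrict p φ) u
      ∑-keep φ []      = refl
      ∑-keep φ (s ∷ u) with p s
      ... | true  = cong (φ s ℕ.+_) (∑-keep φ u)
      ... | false = ∑-keep φ u

      keep-all : ∀ u → All (λ s → p s ≡ true) (keep u)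
      keep-all []      = []
      keep-all (s ∷ u) with p s in ps
      ... | true  = ps ∷ keep-all u
      ... | false = keep-all u

    restrict-good : ∀ {φ} → Good φ → Good (restrict p φ)
    restrict-good good s K<s with p s
    ... | true  = good s K<s
    ... | false = refl

    keep-cong : ∀ {u v} → u ≈ v → keep u ≈ keep v
    keep-cong {u} {v} e .at φ good =
      trans (∑-keep φ u) (trans (e .at _ (restrict-good good)) (sym (∑-keep φ v)))

    keep-⊕ : ∀ u v → keep (u ⊕ v) ≈ keep u ⊕ keep v
    keep-⊕ u v .at φ _ = begin
      ∑ φ (keep (u ⊕ v))                         ≡⟨ ∑-keep φ (u ⊕ v) ⟩
      ∑ (restrict p φ) (u ⊕ v)                   ≡⟨ ∑-⊕ _ u v ⟩
      ∑ (restrict p φ) u ℕ.+ ∑ (restrict p φ) v  ≡⟨ cong₂ ℕ._+_ (∑-keep φ u) (∑-keep φ v) ⟨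
      ∑ φ (keep u) ℕ.+ ∑ φ (keep v)              ≡⟨ ∑-⊕ φ _ _ ⟨
      ∑ φ (keep u ⊕ keep v)                      ∎
      where open ≡-Reasoning

    keep-none : ∀ {u} → All (λ s → p s ≡ false) u → keep u ≈ 𝟘
    keep-none {u} none .at φ _ = trans (∑-keep φ u) (trans
      (∑-zero-All (All.map (λ {s} → cong (λ b → if b then φ s else 0)) none)) (sym (∑-𝟘 φ)))

    -- Unlike in `≈-reindex`, `g` only has to reach the kept indices, so it may parametrise a
    -- sublattice, such as the pairs (j , -j) in a constant term.
    keep-⟪⟫ : (F : I → QMon) (G : J → QMon) (g : J → I) (h : I → J) {is : List I} {js : List J} →
              Unique is → Unique js →
              (∀ j → h (g j) ≡ j) → (∀ i → p ⌊ F i ⌋ ≡ true → g (h i) ≡ i) →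
              (∀ j → F (g j) ≐ G j) → (∀ j → p ⌊ G j ⌋ ≡ true) →
              Within F (_∈ is) → Within F (λ i → h i ∈ js) →
              keep (⟪ F ⟫ is) ≈ ⟪ G ⟫ js
    keep-⟪⟫ F G g h {is} {js} is! js! hg gh F≐G PG is⊇ js⊇ .at φ good = begin
      ∑ φ (keep (⟪ F ⟫ is))    ≡⟨ ∑-keep φ _ ⟩
      ∑ ψ (⟪ F ⟫ is)              ≡⟨ ∑-⟪⟫ ψ F is ⟩
      ∑ (λ i → ψ ⌊ F i ⌋) is      ≡⟨ ∑-reindex _ g h is! js! hg (λ i nz → gh i (kept ⌊ F i ⌋ nz))
                                       (λ i nz → is⊇ i (low ⌊ F i ⌋ nz))
                                       (λ j nz → subst (_∈ js) (hg j) (js⊇ (g j) (low ⌊ F (g j) ⌋ nz))) ⟩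
      ∑ (λ j → ψ ⌊ F (g j) ⌋) js  ≡⟨ ∑-cong (λ j → trans (cong ψ (≐⇒≡ (F≐G j)))
                                       (cong (λ b → if b then φ ⌊ G j ⌋ else 0) (PG j))) js ⟩
      ∑ (λ j → φ ⌊ G j ⌋) js      ≡⟨ ∑-⟪⟫ φ G js ⟨
      ∑ φ (⟪ G ⟫ js)              ∎
      where
      open ≡-Reasoning
      ψ : Mon → ℕ
      ψ = restrict p φ
      low : ∀ s → ψ s ≢ 0 → deg s ≤ K
      low s nz = ℕ.≮⇒≥ (λ K<s → nz (restrict-good good s K<s))
      kept : ∀ s → ψ s ≢ 0 → p s ≡ true
      kept s nz with p s
      ... | true  = refl
      ... | false = contradiction refl nz

  keep-complement : ∀ p u → u ≈ keep p u ⊕ keep (not ∘ p) u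
  keep-complement p u .at φ _ = begin
    ∑ φ u                                                  ≡⟨ ∑-cong pointwise u ⟩
    ∑ (λ s → restrict p φ s ℕ.+ restrict (not ∘ p) φ s) u  ≡⟨ ∑-+ _ _ u ⟩
    ∑ (restrict p φ) u ℕ.+ ∑ (restrict (not ∘ p) φ) u      ≡⟨ cong₂ ℕ._+_ (∑-keep p φ u) (∑-keep (not ∘ p) φ u) ⟨
    ∑ φ (keep p u) ℕ.+ ∑ φ (keep (not ∘ p) u)              ≡⟨ ∑-⊕ φ _ _ ⟨
    ∑ φ (keep p u ⊕ keep (not ∘ p) u)                      ∎
    where
    open ≡-Reasoning
    pointwise : ∀ s → φ s ≡ restrict p φ s ℕ.+ restrict (not ∘ p) φ s
    pointwise s with p s
    ... | true  = sym (ℕ.+-identityʳ (φ s))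
    ... | false = refl

  z⁰ : Mon → Bool
  z⁰ s = does (proj₁ s ℤ.≟ + 0)

  ct : Laurent → Laurent
  ct = keep z⁰

  ct-⊛ : ∀ {w} u → ZFree w → ct (w ⊛ u) ≈ w ⊛ ct u
  ct-⊛ {w} u (graded free) .at φ _ = begin
    ∑ φ (ct (w ⊛ u))                                  ≡⟨ ∑-keep z⁰ φ (w ⊛ u) ⟩
    ∑ (restrict z⁰ φ) (w ⊛ u)                        ≡⟨ ∑-⊛ _ w u ⟩
    ∑ (λ s → ∑ (λ t → restrict z⁰ φ (s ∙ t)) u) w    ≡⟨ pointwise free ⟩
    ∑ (λ s → ∑ (λ t → φ (s ∙ t)) (ct u)) w            ≡⟨ ∑-⊛ φ w (ct u) ⟨
    ∑ φ (w ⊛ ct u)                                    ∎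
    where
    open ≡-Reasoning
    pointwise : ∀ {w} → All (λ s → Congruent (+ 0) (+ 0) (zdeg s)) w →
      ∑ (λ s → ∑ (λ t → restrict z⁰ φ (s ∙ t)) u) w ≡ ∑ (λ s → ∑ (λ t → φ (s ∙ t)) (ct u)) w
    pointwise []       = refl
    pointwise (_∷_ {s} p ps) = cong₂ ℕ._+_
      (trans (∑-cong (λ t → cong (λ m → if does (m ℤ.≟ + 0) then φ (s ∙ t) else 0)
                              (trans (cong (ℤ._+ proj₁ t) (zdeg≡0 p)) (ℤ.+-identityˡ (proj₁ t)))) u)
             (sym (∑-keep z⁰ (λ t → φ (s ∙ t)) u)))
      (pointwise ps)


  ct-𝟘 : ∀ {r u} → ¬ Congruent (+ 3) r (+ 0) → Graded zdeg (+ 3) r u → ct u ≈ 𝟘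
  ct-𝟘 {r} ¬0 (graded p) = keep-none z⁰ (All.map (λ {s} q → dec-false (proj₁ s ℤ.≟ + 0) (λ e → ¬0 (subst (Congruent (+ 3) r) e q))) p)

  deg⁰ : Mon → Bool
  deg⁰ s = does (deg s ℕ.≟ 0)

  -- Since h has no constant term, ∑ φ (u ⊛ h) only involves the part of u of
  -- degree less than the largest degree on which φ lives.
  ⊛-cancelʳ : ∀ {u v w h} → w ≈ 𝟙 ⊕ h → All (λ s → deg s ≢ 0) h → u ⊛ w ≈ v ⊛ w → u ≈ v
  ⊛-cancelʳ {u} {v} {w} {h} w≈1+h h>0 p .at φ good = below (suc K) ℕ.≤-refl φ good
    where
    open CommutativeSemiring laurent using (*-identityʳ)
    expand : ∀ u → u ⊕ u ⊛ h ≈ u ⊛ w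
    expand u = ≈-sym (≈-trans (⊛-congˡ u w≈1+h) (≈-trans (distribˡ u 𝟙 h)
      (+-cong (*-identityʳ u) (≡⇒≈ refl))))
    both : u ⊕ u ⊛ h ≈ v ⊕ v ⊛ h
    both = ≈-trans (expand u) (≈-trans p (≈-sym (expand v)))
    -- Here `φ` vanishes from degree `n` on. Since `h` starts in degree 1, the functional `ψ`
    -- vanishes one degree earlier than `φ`, which gives the induction; additive cancellation in ℕ
    -- takes the place of subtracting the terms with `h`.
    below : ∀ n → n ≤ suc K → ∀ φ → (∀ s → n ≤ deg s → φ s ≡ 0) → ∑ φ u ≡ ∑ φ v
    below zero    _   φ φ≡0 = trans (∑-zero (λ s → φ≡0 s z≤n) u) (sym (∑-zero (λ s → φ≡0 s z≤n) v))
    below (suc n) n≤K φ φ≡0 = ℕ.+-cancelʳ-≡ (∑ φ (u ⊛ h)) _ _ (begin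
      ∑ φ u ℕ.+ ∑ φ (u ⊛ h)  ≡⟨ ∑-⊕ φ u _ ⟨
      ∑ φ (u ⊕ u ⊛ h)        ≡⟨ both .at φ (λ s K<s → φ≡0 s (ℕ.≤-trans n≤K K<s)) ⟩
      ∑ φ (v ⊕ v ⊛ h)        ≡⟨ ∑-⊕ φ v _ ⟩
      ∑ φ v ℕ.+ ∑ φ (v ⊛ h)  ≡⟨ cong (∑ φ v ℕ.+_) tails ⟨
      ∑ φ v ℕ.+ ∑ φ (u ⊛ h)  ∎)
      where
      open ≡-Reasoning
      ψ : Mon → ℕ
      ψ s = ∑ (λ t → φ (s ∙ t)) h
      tails : ∑ φ (u ⊛ h) ≡ ∑ φ (v ⊛ h)
      tails = trans (∑-⊛ φ u h) (trans
        (below n (ℕ.≤-trans (ℕ.n≤1+n n) n≤K) ψ (λ s n≤s → ∑-zero-All (All.map (λ {t} t≢0 →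
          φ≡0 (s ∙ t) (ℕ.≤-trans (ℕ.≤-reflexive (ℕ.+-comm 1 n)) (ℕ.+-mono-≤ n≤s (ℕ.n≢0⇒n>0 t≢0)))) h>0)))
        (sym (∑-⊛ φ v h)))

  opaque
    unfolding 𝟙 ⟪_⟫
    𝟙≡⟪⟫ : 𝟙 ≡ ⟪ (λ (_ : ⊤) → + 0 , 0 · □ (+ 0)) ⟫ (tt ∷ [])
    𝟙≡⟪⟫ = refl

  ⊤! : Unique (tt ∷ [])
  ⊤! = [] ∷ []

  sq≡0 : ∀ n → sq n ≡ 0 → n ≡ + 0
  sq≡0 n e with ℕ.m*n≡0⇒m≡0∨n≡0 ∣ n ∣ e
  ... | inj₁ p = ℤ.∣i∣≡0⇒i≡0 p
  ... | inj₂ p = ℤ.∣i∣≡0⇒i≡0 p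

  -- The form is positive definite: if its squares vanish, then `y = z` and `3 y = 0`, so only the
  -- origin contributes in degree 0.
  a-constant : keep deg⁰ a ≈ 𝟙
  a-constant = ≈-trans
    (keep-⟪⟫ deg⁰ (cubicQ (+ 0)) (λ _ → + 0 , 0 · □ (+ 0)) (λ _ → + 0 , + 0) (λ _ → tt) B²! ⊤!
      (λ _ → refl) (λ (y , z) e → sym (cong₂ _,_ (y≡0 y z (true⇒≡0 _ e)) (z≡0 y z (true⇒≡0 _ e))))
      (λ _ → refl & refl) (λ _ → refl)
      (λ i p → small-pair (cubic-small {+ 0} (small-const _) i p)) (λ _ _ → here refl))
    (≡⇒≈ (sym 𝟙≡⟪⟫))
    where
    true⇒≡0 : ∀ n → does (n ℕ.≟ 0) ≡ true → n ≡ 0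
    true⇒≡0 zero _ = refl
    module _ (y z : ℤ) (e : size (proj₂ (cubicQ (+ 0) (y , z))) ≡ 0) where
      d₁ : + 0 ℤ.- y ℤ.- z ℤ.- y ≡ + 0
      d₁ = sq≡0 _ (ℕ.m+n≡0⇒m≡0 _ e)
      d₂ : y ℤ.- z ≡ + 0
      d₂ = sq≡0 _ (ℕ.m+n≡0⇒m≡0 _ (ℕ.m+n≡0⇒n≡0 (sq (+ 0 ℤ.- y ℤ.- z ℤ.- y)) e))
      3y : ∀ y z → y ℤ.- z ℤ.- (+ 0 ℤ.- y ℤ.- z ℤ.- y) ≡ + 3 ℤ.* y
      3y = ℤ.solve-∀
      y≡0 : y ≡ + 0
      y≡0 = ℤ.*-cancelˡ-≡ (+ 3) y (+ 0) (trans (sym (3y y z)) (cong₂ ℤ._-_ d₂ d₁))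
      z≡0 : z ≡ + 0
      z≡0 = trans (sym (ℤ.i-j≡0⇒i≡j y z d₂)) y≡0

  a-cancelʳ : ∀ {u v} → u ⊛ a ≈ v ⊛ a → u ≈ v
  a-cancelʳ = ⊛-cancelʳ
    (≈-trans (keep-complement deg⁰ a) (+-cong a-constant (≡⇒≈ refl)))
    (All.map (λ {s} → not-true⇒≢0 (deg s)) (keep-all (not ∘ deg⁰) a))
    where
    not-true⇒≢0 : ∀ n → not (does (n ℕ.≟ 0)) ≡ true → n ≢ 0
    not-true⇒≢0 (suc n) _ ()

-- With n = `tri r j`, the indices n and -n contribute Q^(2n²) to a constant term. After the
-- substitution `σQ` this is Q^(6n²) = q^(n²), a term of S_r.
sQ : Fin 3 → ℤ → QMon
sQ r j = + 0 , 2 · □ tri r j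

≢0-mod : ∀ d r {_ : False (d ∣? ∣ r ∣)} → ¬ Congruent (+ d) r (+ 0)
≢0-mod d r {d∤r} (k by e) = toWitnessFalse d∤r (divides ∣ k ∣
  (trans (cong ∣_∣ r≡) (trans (ℤ.∣-i∣≡∣i∣ (+ d ℤ.* k)) (trans (ℤ.abs-* (+ d) k) (ℕ.*-comm d ∣ k ∣)))))
  where
  identity : ∀ r m → r ≡ - m ℤ.+ (m ℤ.+ r)
  identity = ℤ.solve-∀
  r≡ : r ≡ - (+ d ℤ.* k)
  r≡ = trans (identity r (+ d ℤ.* k)) (trans (cong (λ n → - (+ d ℤ.* k) ℤ.+ n) (sym e)) (ℤ.+-identityʳ _))

-- Constant terms of products of theta series

module Pairing (K : ℕ) where
  open Parts K public
  open SemiringSolver laurent public using (solve; _:+_; _:*_; _:=_; con; _:^_)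

  s S : Fin 3 → Laurent
  s r = ⟪ sQ r ⟫ B
  S r = ⟪ σQ ∘ sQ r ⟫ B

  ≈-refl : ∀ {u} → u ≈ u
  ≈-refl = ≡⇒≈ refl

  A-zfree : ZFree A
  A-zfree = zfree-⟪⟫ (λ _ → refl) B²
  C-zfree : ZFree C
  C-zfree = zfree-⟪⟫ (λ _ → refl) B²
  M-zfree : ZFree M
  M-zfree = zfree-⟪⟫ (λ _ → refl) B²
  a-zfree : ZFree a
  a-zfree = zfree-⟪⟫ (λ _ → refl) B²

  x-graded : ∀ r → Graded zdeg (+ 3) (ε r) (x r)
  x-graded r = graded-⟪⟫ (λ j → j by refl) B

  σ*-⊕ : ∀ u v → σ* (u ⊕ v) ≈ σ* u ⊕ σ* v
  σ*-⊕ u v .at φ _ = begin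
    ∑ φ (σ* (u ⊕ v))             ≡⟨ ∑-σ* φ _ ⟩
    ∑ (φ ∘ σ) (u ⊕ v)            ≡⟨ ∑-⊕ _ u v ⟩
    ∑ (φ ∘ σ) u ℕ.+ ∑ (φ ∘ σ) v  ≡⟨ cong₂ ℕ._+_ (∑-σ* φ u) (∑-σ* φ v) ⟨
    ∑ φ (σ* u) ℕ.+ ∑ φ (σ* v)    ≡⟨ ∑-⊕ φ _ _ ⟨
    ∑ φ (σ* u ⊕ σ* v)            ∎
    where open ≡-Reasoning

  σ*-⊛ : ∀ u v → σ* (u ⊛ v) ≈ σ* u ⊛ σ* v
  σ*-⊛ u v .at φ _ = begin
    ∑ φ (σ* (u ⊛ v))                           ≡⟨ ∑-σ* φ _ ⟩
    ∑ (φ ∘ σ) (u ⊛ v)                          ≡⟨ ∑-⊛ _ u v ⟩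
    ∑ (λ s → ∑ (λ t → φ (σ (s ∙ t))) v) u      ≡⟨ ∑-cong (λ s → ∑-cong (λ t → cong φ (σ-∙ s t)) v) u ⟩
    ∑ (λ s → ∑ (λ t → φ (σ s ∙ σ t)) v) u      ≡⟨ ∑-cong (λ s → ∑-σ* _ v) u ⟨
    ∑ (λ s → ∑ (λ t → φ (σ s ∙ t)) (σ* v)) u   ≡⟨ ∑-σ* _ u ⟨
    ∑ (λ s → ∑ (λ t → φ (s ∙ t)) (σ* v)) (σ* u) ≡⟨ ∑-⊛ φ _ _ ⟨
    ∑ φ (σ* u ⊛ σ* v)                          ∎
    where
    open ≡-Reasoning
    σ-∙ : ∀ s t → σ (s ∙ t) ≡ σ s ∙ σ t
    σ-∙ (m , k) (m′ , k′) = cong₂ _,_ (ℤ.*-distribˡ-+ (+ 3) m m′) (ℕ.*-distribˡ-+ 3 k k′)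

  ct-σ* : ∀ u → ct (σ* u) ≈ σ* (ct u)
  ct-σ* u .at φ _ = begin
    ∑ φ (ct (σ* u))               ≡⟨ ∑-keep z⁰ φ _ ⟩
    ∑ (restrict z⁰ φ) (σ* u)      ≡⟨ ∑-σ* _ u ⟩
    ∑ (restrict z⁰ φ ∘ σ) u       ≡⟨ ∑-cong (λ s → cong (λ b → if b then φ (σ s) else 0) (3*≟0 (proj₁ s))) u ⟩
    ∑ (restrict z⁰ (φ ∘ σ)) u     ≡⟨ ∑-keep z⁰ _ u ⟨
    ∑ (φ ∘ σ) (ct u)              ≡⟨ ∑-σ* φ _ ⟨
    ∑ φ (σ* (ct u))               ∎
    where
    open ≡-Reasoning
    3*≟0 : ∀ m → does (+ 3 ℤ.* m ℤ.≟ + 0) ≡ does (m ℤ.≟ + 0)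
    3*≟0 (+ zero)  = refl
    3*≟0 (+ suc n) = refl
    3*≟0 -[1+ n ]  = refl

  σ*-𝟘 : σ* 𝟘 ≈ 𝟘
  σ*-𝟘 .at φ _ = trans (∑-σ* φ 𝟘) (trans (∑-𝟘 _) (sym (∑-𝟘 φ)))

  σ*x : ∀ r → σ* (x r) ≈ E r
  σ*x r = ≡⇒≈ (σ*-⟪⟫ (xQ r) B)

  ct-x : ∀ r r′ → ε r ℤ.+ ε r′ ≡ + 0 → (∀ j → sq (tri r′ (- j)) ≡ sq (tri r j)) → ct (x r ⊛ x r′) ≈ s r
  ct-x r r′ e sq-neg = ≈-trans (keep-cong z⁰ (≡⇒≈ (⟪⟫-⊛ (xQ r) (xQ r′) B B)))
    (keep-⟪⟫ z⁰ (λ (i , j) → xQ r i ⊙ xQ r′ j) (sQ r) (λ j → j , - j) proj₁ B²! B!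
      (λ _ → refl)
      (λ (i , j) p → cong (i ,_) (sym (opposite i j (true⇒≡0 _ p))))
      (λ j → trans (exponent j (ε r) (ε r′)) e & trans (cong (λ n → value (□ tri r j) ℤ.+ n) (squares j)) (double (value (□ tri r j))))
      (λ _ → refl)
      (λ (i , j) p → ∈-cartesianProduct⁺
        (small-∈B (x-small r i (ℕ.m+n≤o⇒m≤o _ p)))
        (small-∈B (x-small r′ j (ℕ.m+n≤o⇒n≤o (sq (tri r i)) p))))
      (λ (i , j) p → small-∈B (x-small r i (ℕ.m+n≤o⇒m≤o _ p))))
    where
    true⇒≡0 : ∀ n → does (n ℤ.≟ + 0) ≡ true → n ≡ + 0
    true⇒≡0 (+ zero) _ = refl
    exponent : ∀ j a b → + 3 ℤ.* j ℤ.+ a ℤ.+ (+ 3 ℤ.* (- j) ℤ.+ b) ≡ a ℤ.+ b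
    exponent = ℤ.solve-∀
    double : ∀ n → n ℤ.+ n ≡ + 2 ℤ.* n
    double = ℤ.solve-∀
    squares : ∀ j → value (□ tri r′ (- j)) ≡ value (□ tri r j)
    squares j = trans (sym (sq≡ (tri r′ (- j)))) (trans (cong +_ (sq-neg j)) (sq≡ (tri r j)))
    opposite : ∀ i j → tri r i ℤ.+ tri r′ j ≡ + 0 → j ≡ - i
    opposite i j p = ℤ.*-cancelˡ-≡ (+ 3) j (- i)
      (trans (identity i j (ε r) (ε r′)) (trans (cong₂ (λ m n → m ℤ.- n ℤ.+ + 3 ℤ.* (- i)) p e) (ℤ.+-identityˡ _)))
      where
      identity : ∀ i j a b → + 3 ℤ.* j ≡ (+ 3 ℤ.* i ℤ.+ a ℤ.+ (+ 3 ℤ.* j ℤ.+ b)) ℤ.- (a ℤ.+ b) ℤ.+ + 3 ℤ.* (- i)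
      identity = ℤ.solve-∀

  sq-neg : ∀ n → sq (- n) ≡ sq n
  sq-neg n = cong₂ ℕ._*_ (ℤ.∣-i∣≡∣i∣ n) (ℤ.∣-i∣≡∣i∣ n)

  ct-σ*-⊛ : ∀ u v {w} → ct (u ⊛ v) ≈ w → ct (σ* u ⊛ σ* v) ≈ σ* w
  ct-σ*-⊛ u v p = ≈-trans (keep-cong z⁰ (≈-sym (σ*-⊛ u v))) (≈-trans (ct-σ* (u ⊛ v)) (σ*-cong p))

  ct-E : ∀ r r′ {w} → ct (x r ⊛ x r′) ≈ w → ct (E r ⊛ E r′) ≈ σ* w
  ct-E r r′ p = ≈-trans (keep-cong z⁰ (≈-sym (*-cong (σ*x r) (σ*x r′)))) (ct-σ*-⊛ (x r) (x r′) p)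

  ct-E₀E₀ : ct (E 0F ⊛ E 0F) ≈ S 0F
  ct-E₀E₀ = ≈-trans (ct-E 0F 0F (ct-x 0F 0F refl
    (λ j → trans (cong sq (flip j)) (sq-neg (tri 0F j))))) (≡⇒≈ (σ*-⟪⟫ (sQ 0F) B))
    where
    flip : ∀ j → + 3 ℤ.* (- j) ℤ.+ + 0 ≡ - (+ 3 ℤ.* j ℤ.+ + 0)
    flip = ℤ.solve-∀

  ct-E₁E₂ : ct (E 1F ⊛ E 2F) ≈ S 1F
  ct-E₁E₂ = ≈-trans (ct-E 1F 2F (ct-x 1F 2F refl
    (λ j → trans (cong sq (flip j)) (sq-neg (tri 1F j))))) (≡⇒≈ (σ*-⟪⟫ (sQ 1F) B))
    where
    flip : ∀ j → + 3 ℤ.* (- j) ℤ.+ -[1+ 0 ] ≡ - (+ 3 ℤ.* j ℤ.+ + 1)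
    flip = ℤ.solve-∀

  ct-EE-𝟘 : ∀ r r′ → {_ : False (3 ∣? ∣ ε r ℤ.+ ε r′ ∣)} → ct (E r ⊛ E r′) ≈ 𝟘
  ct-EE-𝟘 r r′ {≢0} = ≈-trans (ct-E r r′ (ct-𝟘 (≢0-mod 3 (ε r ℤ.+ ε r′) {≢0})
    (graded-⊛ zdeg-additive (x-graded r) (x-graded r′)))) σ*-𝟘

  ct-EEE-𝟘 : ∀ r r′ r″ → {_ : False (3 ∣? ∣ ε r ℤ.+ (ε r′ ℤ.+ ε r″) ∣)} → ct (E r ⊛ (E r′ ⊛ E r″)) ≈ 𝟘
  ct-EEE-𝟘 r r′ r″ {≢0} = ≈-trans
    (keep-cong z⁰ (≈-sym (*-cong (σ*x r) (≈-trans (σ*-⊛ (x r′) (x r″)) (*-cong (σ*x r′) (σ*x r″))))))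
    (≈-trans (ct-σ*-⊛ (x r) (x r′ ⊛ x r″) (ct-𝟘 (≢0-mod 3 (ε r ℤ.+ (ε r′ ℤ.+ ε r″)) {≢0})
      (graded-⊛ zdeg-additive (x-graded r) (graded-⊛ zdeg-additive (x-graded r′) (x-graded r″))))) σ*-𝟘)

  ct-E₀ : ct (E 0F) ≈ 𝟙
  ct-E₀ = ≈-trans
    (keep-⟪⟫ z⁰ (EQ 0F) (λ _ → + 0 , 0 · □ (+ 0)) (λ _ → + 0) (λ _ → tt) B! ⊤!
      (λ _ → refl) (λ j p → sym (is-0 j p)) (λ _ → refl & refl) (λ _ → refl)
      (λ j p → small-∈B (x-small 0F j (ℕ.≤-trans (ℕ.m≤n*m _ 3) p))) (λ _ _ → here refl))
    (≡⇒≈ (sym 𝟙≡⟪⟫))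
    where
    is-0 : ∀ j → does (+ 3 ℤ.* (+ 3 ℤ.* j ℤ.+ + 0) ℤ.≟ + 0) ≡ true → j ≡ + 0
    is-0 (+ zero) _ = refl

  ct-E-𝟘 : ∀ r → {_ : False (3 ∣? ∣ ε r ∣)} → ct (E r) ≈ 𝟘
  ct-E-𝟘 r {≢0} = ≈-trans (keep-cong z⁰ (≈-sym (σ*x r))) (≈-trans (ct-σ* (x r))
    (≈-trans (σ*-cong (ct-𝟘 (≢0-mod 3 (ε r) {≢0}) (x-graded r))) σ*-𝟘))

  ct-⊕ : ∀ u v {u′ v′} → ct u ≈ u′ → ct v ≈ v′ → ct (u ⊕ v) ≈ u′ ⊕ v′
  ct-⊕ u v p q = ≈-trans (keep-⊕ z⁰ u v) (+-cong p q)

  ct-scale : ∀ {w} u {u′} → ZFree w → ct u ≈ u′ → ct (w ⊛ u) ≈ w ⊛ u′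
  ct-scale {w} u free p = ≈-trans (ct-⊛ u free) (⊛-congˡ w p)

  X Y Z T : Laurent
  X = x 0F ⊛ (x 0F ⊛ x 0F)
  Y = x 1F ⊛ (x 1F ⊛ x 1F)
  Z = x 2F ⊛ (x 2F ⊛ x 2F)
  T = x 0F ⊛ (x 1F ⊛ x 2F)

  -- Among the `E r` only `E 0F` has a constant term, so the cubes contribute `A`, `C` and `C`,
  -- which `a≈A+2C` adds up to `a`. Applying `σ*` then evaluates the sum of the cubes of the `E r`
  -- as `A`.
  ct-cubes : ct (X ⊕ (Y ⊕ Z)) ≈ a
  ct-cubes = ≈-trans (ct-⊕ X (Y ⊕ Z) (≈-trans (keep-cong z⁰ x₀-cube) ct-X) (ct-⊕ Y Z
    (≈-trans (keep-cong z⁰ x₁-cube) ct-Y) (≈-trans (keep-cong z⁰ x₂-cube) ct-Z))) (≈-trans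
    (solve 2 (λ A C → (A :* con 1 :+ (C :* con 0 :+ C :* con 0)) :+
                ((A :* con 0 :+ (C :* con 0 :+ C :* con 1)) :+ (A :* con 0 :+ (C :* con 1 :+ C :* con 0)))
                := A :+ (C :+ C)) ≈-refl A C)
    (≈-sym a≈A+2C))
    where
    ct-X : ct (A ⊛ E 0F ⊕ (C ⊛ E 1F ⊕ C ⊛ E 2F)) ≈ A ⊛ 𝟙 ⊕ (C ⊛ 𝟘 ⊕ C ⊛ 𝟘)
    ct-X = ct-⊕ _ _ (ct-scale _ A-zfree ct-E₀) (ct-⊕ _ _
      (ct-scale _ C-zfree (ct-E-𝟘 1F)) (ct-scale _ C-zfree (ct-E-𝟘 2F)))
    ct-Y : ct (A ⊛ E 1F ⊕ (C ⊛ E 2F ⊕ C ⊛ E 0F)) ≈ A ⊛ 𝟘 ⊕ (C ⊛ 𝟘 ⊕ C ⊛ 𝟙)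
    ct-Y = ct-⊕ _ _ (ct-scale _ A-zfree (ct-E-𝟘 1F)) (ct-⊕ _ _
      (ct-scale _ C-zfree (ct-E-𝟘 2F)) (ct-scale _ C-zfree ct-E₀))
    ct-Z : ct (A ⊛ E 2F ⊕ (C ⊛ E 0F ⊕ C ⊛ E 1F)) ≈ A ⊛ 𝟘 ⊕ (C ⊛ 𝟙 ⊕ C ⊛ 𝟘)
    ct-Z = ct-⊕ _ _ (ct-scale _ A-zfree (ct-E-𝟘 2F)) (ct-⊕ _ _
      (ct-scale _ C-zfree ct-E₀) (ct-scale _ C-zfree (ct-E-𝟘 1F)))

  ct-T : ct T ≈ M
  ct-T = ≈-trans (keep-cong z⁰ x₀x₁x₂) (≈-trans
    (ct-⊕ _ _ (ct-scale _ M-zfree ct-E₀) (ct-⊕ _ _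
      (ct-scale _ M-zfree (ct-E-𝟘 1F)) (ct-scale _ M-zfree (ct-E-𝟘 2F))))
    (solve 1 (λ M → M :* con 1 :+ (M :* con 0 :+ M :* con 0) := M) ≈-refl M))

-- The cubic relation between M, A and t

module CubicRelation (K : ℕ) where
  open Pairing K public

  private
    E₀ E₁ E₂ : Laurent
    E₀ = E 0F
    E₁ = E 1F
    E₂ = E 2F

    cubes mixed : Laurent
    cubes = E₀ ⊛ (E₀ ⊛ E₀) ⊕ (E₁ ⊛ (E₁ ⊛ E₁) ⊕ E₂ ⊛ (E₂ ⊛ E₂))
    mixed = E₀ ⊛ (E₀ ⊛ E₁) ⊕ (E₁ ⊛ (E₁ ⊛ E₂) ⊕ (E₂ ⊛ (E₂ ⊛ E₀) ⊕
            (E₀ ⊛ (E₀ ⊛ E₂) ⊕ (E₁ ⊛ (E₁ ⊛ E₀) ⊕ E₂ ⊛ (E₂ ⊛ E₁)))))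

  σ*-⊛³ : ∀ r r′ r″ → σ* (x r ⊛ (x r′ ⊛ x r″)) ≈ E r ⊛ (E r′ ⊛ E r″)
  σ*-⊛³ r r′ r″ = ≈-trans (σ*-⊛ (x r) _)
    (*-cong (σ*x r) (≈-trans (σ*-⊛ (x r′) (x r″)) (*-cong (σ*x r′) (σ*x r″))))

  ct-σ*-≈ : ∀ {u v w} → σ* u ≈ v → ct u ≈ w → ct v ≈ σ* w
  ct-σ*-≈ {u} p q = ≈-trans (keep-cong z⁰ (≈-sym p)) (≈-trans (ct-σ* u) (σ*-cong q))

  ct-E-cubes : ct cubes ≈ A
  ct-E-cubes = ≈-trans (ct-σ*-≈ (≈-trans (σ*-⊕ X (Y ⊕ Z)) (+-cong (σ*-⊛³ 0F 0F 0F)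
    (≈-trans (σ*-⊕ Y Z) (+-cong (σ*-⊛³ 1F 1F 1F)
                                (σ*-⊛³ 2F 2F 2F))))) ct-cubes)
    (≡⇒≈ (σ*-⟪⟫ (cubicQ (+ 0)) B²))

  ct-E₀E₁E₂ : ct (E₀ ⊛ (E₁ ⊛ E₂)) ≈ t
  ct-E₀E₁E₂ = ≈-trans (ct-σ*-≈ (σ*-⊛³ 0F 1F 2F) ct-T) (≡⇒≈ (σ*-⟪⟫ MQ B²))

  ct-mixed : ct mixed ≈ 𝟘
  ct-mixed = ≈-trans
    (ct-⊕ _ _ (ct-EEE-𝟘 0F 0F 1F) (ct-⊕ _ _ (ct-EEE-𝟘 1F 1F 2F)
      (ct-⊕ _ _ (ct-EEE-𝟘 2F 2F 0F) (ct-⊕ _ _ (ct-EEE-𝟘 0F 0F 2F)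
      (ct-⊕ _ _ (ct-EEE-𝟘 1F 1F 0F) (ct-EEE-𝟘 2F 2F 1F))))))
    (solve 0 (con 0 :+ (con 0 :+ (con 0 :+ (con 0 :+ (con 0 :+ con 0)))) := con 0) ≈-refl)

  ct-combination : ∀ {p q r} → ZFree p → ZFree q → ZFree r →
    ct (p ⊛ cubes ⊕ (q ⊛ (E₀ ⊛ (E₁ ⊛ E₂)) ⊕ r ⊛ mixed)) ≈ p ⊛ A ⊕ (q ⊛ t ⊕ r ⊛ 𝟘)
  ct-combination p q r = ct-⊕ _ _ (ct-scale _ p ct-E-cubes)
    (ct-⊕ _ _ (ct-scale _ q ct-E₀E₁E₂) (ct-scale _ r ct-mixed))

  M³ D : Laurent
  M³ = M ⊛ (M ⊛ M)
  D = t ⊛ (A ⊛ A ⊕ (A ⊛ t ⊕ A ⊛ t ⊕ A ⊛ t ⊕ (t ⊕ t ⊕ t) ⊛ (t ⊕ t ⊕ t)))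

  M³-zfree : ZFree M³
  M³-zfree = zfree-⊛ M-zfree (zfree-⊛ M-zfree M-zfree)

  private
    -- The product x₀³ x₁³ x₂³ is a product of three linear forms in `E₀`, `E₁`, `E₂` whose
    -- coefficient matrix has `A` on the diagonal and `C` elsewhere. Its coefficients are `AC²` at
    -- each cube, the permanent `perm` of the matrix at `E₀ E₁ E₂`, and `rest` at each square times
    -- another factor. For (x₀ x₁ x₂)³ the corresponding coefficients are `M³`, `6M³` and `3M³`.
    6M³ 3M³ AC² perm rest : Laurent
    3M³ = M³ ⊕ (M³ ⊕ M³)
    6M³ = 3M³ ⊕ 3M³
    AC² = A ⊛ (C ⊛ C)
    perm = A ⊛ (A ⊛ A) ⊕ (C ⊛ (C ⊛ C) ⊕ C ⊛ (C ⊛ C)) ⊕ (AC² ⊕ (AC² ⊕ AC²))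
    rest = AC² ⊕ (A ⊛ (A ⊛ C) ⊕ C ⊛ (C ⊛ C))

  -- The constant term of (x₀ x₁ x₂)³ = x₀³ x₁³ x₂³.
  M³⊛a≈D⊛a : M³ ⊛ a ≈ D ⊛ a
  M³⊛a≈D⊛a = begin
    -- The left-hand constant term is M³ (A + 6t). The right-hand one becomes t (A³ + 9A²t + 27At² +
    -- 54t³) on substituting C = 3t, and the cubic factor splits as (A² + 3At + 9t²) (A + 6t).
    M³ ⊛ a                                        ≈⟨ ⊛-congˡ M³ a≈A+6t ⟩
    M³ ⊛ A+6t                                     ≈⟨ solve 3 (λ M³ A t →
                                                     M³ :* (A :+ con 6 :* t) :=
                                                     M³ :* A :+ ((M³ :+ (M³ :+ M³) :+ (M³ :+ (M³ :+ M³))) :* t :+ (M³ :+ (M³ :+ M³)) :* con 0))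
                                                     ≈-refl M³ A t ⟩
    M³ ⊛ A ⊕ (6M³ ⊛ t ⊕ 3M³ ⊛ 𝟘)                  ≈⟨ ct-combination M³-zfree (zfree-⊕ 3M³-zfree 3M³-zfree) 3M³-zfree ⟨
    ct (M³ ⊛ cubes ⊕ (6M³ ⊛ (E₀ ⊛ (E₁ ⊛ E₂)) ⊕ 3M³ ⊛ mixed)) ≈⟨ keep-cong z⁰ (≈-sym left) ⟩
    ct (T ⊛ (T ⊛ T))                              ≈⟨ keep-cong z⁰ right ⟩
    ct (AC² ⊛ cubes ⊕ (perm ⊛ (E₀ ⊛ (E₁ ⊛ E₂)) ⊕ rest ⊛ mixed)) ≈⟨ ct-combination AC²-zfree perm-zfree rest-zfree ⟩
    AC² ⊛ A ⊕ (perm ⊛ t ⊕ rest ⊛ 𝟘)               ≈⟨ solve 3 (λ A C t → A :* (C :* C) :* A :+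
                                                     ((A :* (A :* A) :+ (C :* (C :* C) :+ C :* (C :* C)) :+ (A :* (C :* C) :+ (A :* (C :* C) :+ A :* (C :* C)))) :* t :+
                                                      (A :* (C :* C) :+ (A :* (A :* C) :+ C :* (C :* C))) :* con 0)
                                                     := C :* C :* A :* A :+ (A :* A :* A :+ con 2 :* C :* C :* C :+ con 3 :* A :* C :* C) :* t) ≈-refl A C t ⟩
    C ⊛ C ⊛ A ⊛ A ⊕ (A ⊛ A ⊛ A ⊕ (𝟙 ⊕ 𝟙) ⊛ C ⊛ C ⊛ C ⊕ (𝟙 ⊕ 𝟙 ⊕ 𝟙) ⊛ A ⊛ C ⊛ C) ⊛ t
      ≈⟨ +-cong (⊛-congʳ A (⊛-congʳ A (*-cong C≈3t C≈3t)))
           (⊛-congʳ t (+-cong (+-cong ≈-refl (*-cong (*-cong (⊛-congˡ _ C≈3t) C≈3t) C≈3t)) (*-cong (⊛-congˡ _ C≈3t) C≈3t))) ⟩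
    3t ⊛ 3t ⊛ A ⊛ A ⊕ (A ⊛ A ⊛ A ⊕ (𝟙 ⊕ 𝟙) ⊛ 3t ⊛ 3t ⊛ 3t ⊕ (𝟙 ⊕ 𝟙 ⊕ 𝟙) ⊛ A ⊛ 3t ⊛ 3t) ⊛ t
      ≈⟨ solve 2 (λ A t → let 3t = t :+ (t :+ t) in
           3t :* 3t :* A :* A :+ (A :* A :* A :+ con 2 :* 3t :* 3t :* 3t :+ con 3 :* A :* 3t :* 3t) :* t :=
           t :* (A :* A :+ (A :* t :+ A :* t :+ A :* t :+ (t :+ t :+ t) :* (t :+ t :+ t))) :* (A :+ con 6 :* t)) ≈-refl A t ⟩
    D ⊛ A+6t                                      ≈⟨ ⊛-congˡ D a≈A+6t ⟨
    D ⊛ a                                         ∎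
    where
    open ≈-Reasoning
    3t A+6t : Laurent
    3t = t ⊕ (t ⊕ t)
    A+6t = A ⊕ (𝟙 ⊕ 𝟙 ⊕ 𝟙 ⊕ 𝟙 ⊕ 𝟙 ⊕ 𝟙) ⊛ t
    a≈A+6t : a ≈ A+6t
    a≈A+6t = ≈-trans a≈A+2C (≈-trans (+-cong ≈-refl (+-cong C≈3t C≈3t))
      (solve 2 (λ A t → A :+ (t :+ (t :+ t) :+ (t :+ (t :+ t))) := A :+ con 6 :* t) ≈-refl A t))
    3M³-zfree : ZFree 3M³
    3M³-zfree = zfree-⊕ M³-zfree (zfree-⊕ M³-zfree M³-zfree)
    AC²-zfree : ZFree AC²
    AC²-zfree = zfree-⊛ A-zfree (zfree-⊛ C-zfree C-zfree)
    C³-zfree : ZFree (C ⊛ (C ⊛ C))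
    C³-zfree = zfree-⊛ C-zfree (zfree-⊛ C-zfree C-zfree)
    perm-zfree : ZFree perm
    perm-zfree = zfree-⊕ (zfree-⊕ (zfree-⊛ A-zfree (zfree-⊛ A-zfree A-zfree)) (zfree-⊕ C³-zfree C³-zfree))
                         (zfree-⊕ AC²-zfree (zfree-⊕ AC²-zfree AC²-zfree))
    rest-zfree : ZFree rest
    rest-zfree = zfree-⊕ AC²-zfree (zfree-⊕ (zfree-⊛ A-zfree (zfree-⊛ A-zfree C-zfree)) C³-zfree)
    left : T ⊛ (T ⊛ T) ≈ M³ ⊛ cubes ⊕ (6M³ ⊛ (E₀ ⊛ (E₁ ⊛ E₂)) ⊕ 3M³ ⊛ mixed)
    left = ≈-trans (*-cong x₀x₁x₂ (*-cong x₀x₁x₂ x₀x₁x₂))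
      (solve 4 (λ M e f g →
        let m = M :* e :+ (M :* f :+ M :* g)
            n = M :* (M :* M)
            n₃ = n :+ (n :+ n)
        in m :* (m :* m) :=
           n :* (e :* (e :* e) :+ (f :* (f :* f) :+ g :* (g :* g))) :+
           ((n₃ :+ n₃) :* (e :* (f :* g)) :+
            n₃ :* (e :* (e :* f) :+ (f :* (f :* g) :+ (g :* (g :* e) :+ (e :* (e :* g) :+ (f :* (f :* e) :+ g :* (g :* f))))))))
        ≈-refl M E₀ E₁ E₂)
    right : T ⊛ (T ⊛ T) ≈ AC² ⊛ cubes ⊕ (perm ⊛ (E₀ ⊛ (E₁ ⊛ E₂)) ⊕ rest ⊛ mixed)
    right = ≈-trans
      (solve 3 (λ x y z → x :* (y :* z) :* (x :* (y :* z) :* (x :* (y :* z))) :=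
                          x :* (x :* x) :* (y :* (y :* y) :* (z :* (z :* z))))
        ≈-refl (x 0F) (x 1F) (x 2F))
      (≈-trans (*-cong x₀-cube (*-cong x₁-cube x₂-cube))
      (solve 5 (λ A C e f g →
        let A′ = A :* (C :* C)
            C³ = C :* (C :* C)
        in (A :* e :+ (C :* f :+ C :* g)) :* ((A :* f :+ (C :* g :+ C :* e)) :* (A :* g :+ (C :* e :+ C :* f))) :=
           A′ :* (e :* (e :* e) :+ (f :* (f :* f) :+ g :* (g :* g))) :+
           ((A :* (A :* A) :+ (C³ :+ C³) :+ (A′ :+ (A′ :+ A′))) :* (e :* (f :* g)) :+
            (A′ :+ (A :* (A :* C) :+ C³)) :* (e :* (e :* f) :+ (f :* (f :* g) :+ (g :* (g :* e) :+ (e :* (e :* g) :+ (f :* (f :* e) :+ g :* (g :* f))))))))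
        ≈-refl A C E₀ E₁ E₂))

  M³≈D : M³ ≈ D
  M³≈D = a-cancelʳ M³⊛a≈D⊛a

-- Binary forms in A and t

-- The vector n₀ ∷ … ∷ n_d stands for the form n₀ Aᵈ + n₁ Aᵈ⁻¹ t + … + n_d tᵈ.
BinaryForm : ℕ → Set
BinaryForm d = Vec ℕ (suc d)

infixl 6 _+ᶠ_
infixl 7 _*ᶠ_

opaque
  _+ᶠ_ : ∀ {d} → BinaryForm d → BinaryForm d → BinaryForm d
  _+ᶠ_ = Vec.zipWith ℕ._+_

  scale : ∀ {d} → ℕ → BinaryForm d → BinaryForm d
  scale n = Vec.map (n ℕ.*_)

-- Multiplication by `Aᵈ` appends zeros at the end, just as multiplication by `t` puts a zero in
-- front.
raise : ∀ d {e} → BinaryForm e → BinaryForm (d ℕ.+ e)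
raise zero    q = q
raise (suc d) q = raise d q ∷ʳ 0

opaque
  _*ᶠ_ : ∀ {d e} → BinaryForm d → BinaryForm e → BinaryForm (d ℕ.+ e)
  _*ᶠ_ {zero}  (n ∷ []) q = scale n q
  _*ᶠ_ {suc d} (n ∷ p)  q = scale n (raise (suc d) q) +ᶠ (0 ∷ p *ᶠ q)

module Evaluation {c ℓ} (R : CommutativeSemiring c ℓ) (A t : CommutativeSemiring.Carrier R) where
  open CommutativeSemiring R hiding (zero) renaming (refl to ≈-refl; sym to ≈-sym; trans to ≈-trans)
  open Mult semiring using (×1-homo-*; ×-homo-+) renaming (_×_ to _×ᵣ_)
  open SemiringSolver R using (solve; _:+_; _:*_; _:=_; con)
  open import Relation.Binary.Reasoning.Setoid setoid

  num : ℕ → Carrier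
  num n = n ×ᵣ 1#

  pow : ℕ → Carrier
  pow zero    = 1#
  pow (suc d) = A * pow d

  ⟦_⟧ : ∀ {d} → BinaryForm d → Carrier
  ⟦_⟧ {zero}  (n ∷ []) = num n
  ⟦_⟧ {suc d} (n ∷ p)  = num n * pow (suc d) + t * ⟦ p ⟧

  opaque
    unfolding _+ᶠ_

    ⟦+⟧ : ∀ {d} (p q : BinaryForm d) → ⟦ p +ᶠ q ⟧ ≈ ⟦ p ⟧ + ⟦ q ⟧
    ⟦+⟧ {zero}  (m ∷ []) (n ∷ []) = ×-homo-+ 1# m n
    ⟦+⟧ {suc d} (m ∷ p)  (n ∷ q)  = begin
      num (m ℕ.+ n) * pow (suc d) + t * ⟦ p +ᶠ q ⟧
        ≈⟨ +-cong (*-congʳ (×-homo-+ 1# m n)) (*-congˡ (⟦+⟧ p q)) ⟩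
      (num m + num n) * pow (suc d) + t * (⟦ p ⟧ + ⟦ q ⟧)
        ≈⟨ solve 6 (λ m n a t p q → (m :+ n) :* a :+ t :* (p :+ q) := (m :* a :+ t :* p) :+ (n :* a :+ t :* q))
             ≈-refl (num m) (num n) (pow (suc d)) t ⟦ p ⟧ ⟦ q ⟧ ⟩
      ⟦ m ∷ p ⟧ + ⟦ n ∷ q ⟧ ∎

    ⟦scale⟧ : ∀ {d} n (q : BinaryForm d) → ⟦ scale n q ⟧ ≈ num n * ⟦ q ⟧
    ⟦scale⟧ {zero}  n (m ∷ []) = ×1-homo-* n m
    ⟦scale⟧ {suc d} n (m ∷ q)  = begin
      num (n ℕ.* m) * pow (suc d) + t * ⟦ scale n q ⟧
        ≈⟨ +-cong (*-congʳ (×1-homo-* n m)) (*-congˡ (⟦scale⟧ n q)) ⟩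
      num n * num m * pow (suc d) + t * (num n * ⟦ q ⟧)
        ≈⟨ solve 5 (λ n m a t q → n :* m :* a :+ t :* (n :* q) := n :* (m :* a :+ t :* q))
             ≈-refl (num n) (num m) (pow (suc d)) t ⟦ q ⟧ ⟩
      num n * ⟦ m ∷ q ⟧ ∎

  ⟦∷ʳ0⟧ : ∀ {d} (q : BinaryForm d) → ⟦ q ∷ʳ 0 ⟧ ≈ A * ⟦ q ⟧
  ⟦∷ʳ0⟧ {zero}  (n ∷ []) = solve 3 (λ n A t → n :* (A :* con 1) :+ t :* con 0 := A :* n) ≈-refl (num n) A t
  ⟦∷ʳ0⟧ {suc d} (n ∷ q)  = begin
    num n * (A * pow (suc d)) + t * ⟦ q ∷ʳ 0 ⟧
      ≈⟨ +-congˡ (*-congˡ (⟦∷ʳ0⟧ q)) ⟩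
    num n * (A * pow (suc d)) + t * (A * ⟦ q ⟧)
      ≈⟨ solve 5 (λ n A a t q → n :* (A :* a) :+ t :* (A :* q) := A :* (n :* a :+ t :* q))
           ≈-refl (num n) A (pow (suc d)) t ⟦ q ⟧ ⟩
    A * ⟦ n ∷ q ⟧ ∎

  ⟦raise⟧ : ∀ d {e} (q : BinaryForm e) → ⟦ raise d q ⟧ ≈ pow d * ⟦ q ⟧
  ⟦raise⟧ zero    q = ≈-sym (*-identityˡ ⟦ q ⟧)
  ⟦raise⟧ (suc d) q = ≈-trans (⟦∷ʳ0⟧ (raise d q))
    (≈-trans (*-congˡ (⟦raise⟧ d q)) (≈-sym (*-assoc A (pow d) ⟦ q ⟧)))

  opaque
    unfolding _*ᶠ_

    ⟦*⟧ : ∀ {d e} (p : BinaryForm d) (q : BinaryForm e) → ⟦ p *ᶠ q ⟧ ≈ ⟦ p ⟧ * ⟦ q ⟧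
    ⟦*⟧ {zero}  (n ∷ []) q = ⟦scale⟧ n q
    ⟦*⟧ {suc d} {e} (n ∷ p) q = begin
      ⟦ scale n (raise (suc d) q) +ᶠ (0 ∷ p *ᶠ q) ⟧
        ≈⟨ ⟦+⟧ (scale n (raise (suc d) q)) (0 ∷ p *ᶠ q) ⟩
      ⟦ scale n (raise (suc d) q) ⟧ + (0# * pow (suc d ℕ.+ e) + t * ⟦ p *ᶠ q ⟧)
        ≈⟨ +-cong (≈-trans (⟦scale⟧ n (raise (suc d) q)) (*-congˡ (⟦raise⟧ (suc d) q))) (+-congˡ (*-congˡ (⟦*⟧ p q))) ⟩
      num n * (pow (suc d) * ⟦ q ⟧) + (0# * pow (suc d ℕ.+ e) + t * (⟦ p ⟧ * ⟦ q ⟧))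
        ≈⟨ solve 6 (λ n a q b t p → n :* (a :* q) :+ (con 0 :* b :+ t :* (p :* q)) := (n :* a :+ t :* p) :* q)
             ≈-refl (num n) (pow (suc d)) ⟦ q ⟧ (pow (suc d ℕ.+ e)) t ⟦ p ⟧ ⟩
      ⟦ n ∷ p ⟧ * ⟦ q ⟧ ∎

  infix 4 _⊨_
  record _⊨_ {d} (u : Carrier) (p : BinaryForm d) : Set ℓ where
    constructor represents
    field proof : u ≈ ⟦ p ⟧
  open _⊨_ public

  infixl 6 _⊨+_
  infixl 7 _⊨*_
  _⊨+_ : ∀ {d u v} {p q : BinaryForm d} → u ⊨ p → v ⊨ q → u + v ⊨ p +ᶠ q
  _⊨+_ {p = p} {q} (represents e) (represents f) = represents (≈-trans (+-cong e f) (≈-sym (⟦+⟧ p q)))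

  _⊨*_ : ∀ {d e u v} {p : BinaryForm d} {q : BinaryForm e} → u ⊨ p → v ⊨ q → u * v ⊨ p *ᶠ q
  _⊨*_ {p = p} {q} (represents e) (represents f) = represents (≈-trans (*-cong e f) (≈-sym (⟦*⟧ p q)))

  ⊨scale : ∀ {d u} {p : BinaryForm d} n → u ⊨ p → num n * u ⊨ scale n p
  ⊨scale {p = p} n (represents e) = represents (≈-trans (*-congˡ e) (≈-sym (⟦scale⟧ n p)))

-- The constant term of the eighteenth power of ϑ

module Theta¹⁸ (K : ℕ) where
  open CubicRelation K public
  open Evaluation laurent A t public
  open Exp laurent public using (_^_; ^-congˡ; ^-distrib-*; ^-assocʳ; ^-homo-*)

  opaque
    unfolding 𝟙
    𝟙-zfree : ZFree 𝟙
    𝟙-zfree = graded (((+ 0) by refl) ∷ [])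

  num-zfree : ∀ n → ZFree (num n)
  num-zfree zero          = graded-𝟘
  num-zfree (suc zero)    = 𝟙-zfree
  num-zfree (suc (suc n)) = zfree-⊕ (num-zfree (suc n)) 𝟙-zfree

  zfree⇒graded : ∀ {u} → ZFree u → Graded zdeg (+ 3) (+ 0) u
  zfree⇒graded (graded p) = graded (All.map (λ q → (+ 0) by zdeg≡0 q) p)

  private
    x₀ x₁ x₂ E₀ E₁ E₂ : Laurent
    x₀ = x zero
    x₁ = x 1F
    x₂ = x 2F
    E₀ = E 0F
    E₁ = E 1F
    E₂ = E 2F

  comb : Laurent → Laurent → Laurent → Laurent
  comb p q r = p ⊛ E₀ ⊕ (q ⊛ E₁ ⊕ r ⊛ E₂)

  -- Of the six products of two `E r`, only `E₀ E₀` and `E₁ E₂` have z-exponents divisible by 9 and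
  -- hence a constant term.
  pairing : ∀ {p₀ p₁ p₂ q₀ q₁ q₂} → ZFree p₀ → ZFree p₁ → ZFree p₂ → ZFree q₀ → ZFree q₁ → ZFree q₂ →
            ct (comb p₀ p₁ p₂ ⊛ comb q₀ q₁ q₂) ≈ p₀ ⊛ q₀ ⊛ S 0F ⊕ (p₁ ⊛ q₂ ⊕ p₂ ⊛ q₁) ⊛ S 1F
  pairing {p₀} {p₁} {p₂} {q₀} {q₁} {q₂} fp₀ fp₁ fp₂ fq₀ fq₁ fq₂ = begin
    ct (comb p₀ p₁ p₂ ⊛ comb q₀ q₁ q₂)
      ≈⟨ keep-cong z⁰ (solve 9 (λ p₀ p₁ p₂ q₀ q₁ q₂ e f g →
           (p₀ :* e :+ (p₁ :* f :+ p₂ :* g)) :* (q₀ :* e :+ (q₁ :* f :+ q₂ :* g)) :=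
           p₀ :* q₀ :* (e :* e) :+ ((p₁ :* q₂ :+ p₂ :* q₁) :* (f :* g) :+
           ((p₀ :* q₁ :+ p₁ :* q₀) :* (e :* f) :+ ((p₀ :* q₂ :+ p₂ :* q₀) :* (e :* g) :+
           (p₁ :* q₁ :* (f :* f) :+ p₂ :* q₂ :* (g :* g))))))
           ≈-refl p₀ p₁ p₂ q₀ q₁ q₂ E₀ E₁ E₂) ⟩
    ct (p₀ ⊛ q₀ ⊛ (E₀ ⊛ E₀) ⊕ ((p₁ ⊛ q₂ ⊕ p₂ ⊛ q₁) ⊛ (E₁ ⊛ E₂) ⊕
       ((p₀ ⊛ q₁ ⊕ p₁ ⊛ q₀) ⊛ (E₀ ⊛ E₁) ⊕ ((p₀ ⊛ q₂ ⊕ p₂ ⊛ q₀) ⊛ (E₀ ⊛ E₂) ⊕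
       (p₁ ⊛ q₁ ⊛ (E₁ ⊛ E₁) ⊕ p₂ ⊛ q₂ ⊛ (E₂ ⊛ E₂))))))
      ≈⟨ ct-⊕ _ _ (ct-scale _ (zfree-⊛ fp₀ fq₀) ct-E₀E₀)
        (ct-⊕ _ _ (ct-scale _ (zfree-⊕ (zfree-⊛ fp₁ fq₂) (zfree-⊛ fp₂ fq₁)) ct-E₁E₂)
        (ct-⊕ _ _ (ct-scale _ (zfree-⊕ (zfree-⊛ fp₀ fq₁) (zfree-⊛ fp₁ fq₀)) (ct-EE-𝟘 0F 1F))
        (ct-⊕ _ _ (ct-scale _ (zfree-⊕ (zfree-⊛ fp₀ fq₂) (zfree-⊛ fp₂ fq₀)) (ct-EE-𝟘 0F 2F))
        (ct-⊕ _ _ (ct-scale _ (zfree-⊛ fp₁ fq₁) (ct-EE-𝟘 1F 1F))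
                  (ct-scale _ (zfree-⊛ fp₂ fq₂) (ct-EE-𝟘 2F 2F)))))) ⟩
    _
      ≈⟨ solve 8 (λ p₀ p₁ p₂ q₀ q₁ q₂ s₀ s₁ →
           p₀ :* q₀ :* s₀ :+ ((p₁ :* q₂ :+ p₂ :* q₁) :* s₁ :+
           ((p₀ :* q₁ :+ p₁ :* q₀) :* con 0 :+ ((p₀ :* q₂ :+ p₂ :* q₀) :* con 0 :+
           (p₁ :* q₁ :* con 0 :+ p₂ :* q₂ :* con 0)))) :=
           p₀ :* q₀ :* s₀ :+ (p₁ :* q₂ :+ p₂ :* q₁) :* s₁)
           ≈-refl p₀ p₁ p₂ q₀ q₁ q₂ (S 0F) (S 1F) ⟩
    p₀ ⊛ q₀ ⊛ S 0F ⊕ (p₁ ⊛ q₂ ⊕ p₂ ⊛ q₁) ⊛ S 1F ∎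
    where open ≈-Reasoning

  X-comb : X ≈ comb A C C
  X-comb = x₀-cube

  Y-comb : Y ≈ comb C A C
  Y-comb = ≈-trans x₁-cube (solve 5 (λ A C e f g → A :* f :+ (C :* g :+ C :* e) := C :* e :+ (A :* f :+ C :* g))
    ≈-refl A C E₀ E₁ E₂)

  Z-comb : Z ≈ comb C C A
  Z-comb = ≈-trans x₂-cube (solve 5 (λ A C e f g → A :* g :+ (C :* e :+ C :* f) := C :* e :+ (C :* f :+ A :* g))
    ≈-refl A C E₀ E₁ E₂)

  T-comb : T ≈ comb M M M
  T-comb = x₀x₁x₂

  -- The parts of ϑ⁹ of z-degree congruent to 0, 1 and -1 modulo 3.
  α β G₀ G₁ G₂ : Laurent
  α = a ⊛ a ⊛ a ⊛ A ⊕ num 2 ⊛ (c ⊛ c ⊛ c ⊛ C) ⊕ num 6 ⊛ (a ⊛ c ⊛ c ⊛ M)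
  β = a ⊛ a ⊛ a ⊛ C ⊕ c ⊛ c ⊛ c ⊛ (A ⊕ C) ⊕ num 6 ⊛ (a ⊛ c ⊛ c ⊛ M)
  G₀ = comb α β β
  G₁ = num 3 ⊛ (a ⊛ a ⊛ c ⊛ (x₀ ⊛ (x₀ ⊛ x₁)) ⊕
               (a ⊛ c ⊛ c ⊛ (x₀ ⊛ (x₂ ⊛ x₂)) ⊕ c ⊛ c ⊛ c ⊛ (x₁ ⊛ (x₁ ⊛ x₂))))
  G₂ = num 3 ⊛ (a ⊛ a ⊛ c ⊛ (x₀ ⊛ (x₀ ⊛ x₂)) ⊕
               (a ⊛ c ⊛ c ⊛ (x₀ ⊛ (x₁ ⊛ x₁)) ⊕ c ⊛ c ⊛ c ⊛ (x₂ ⊛ (x₂ ⊛ x₁))))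

  c-zfree : ZFree c
  c-zfree = zfree-⟪⟫ (λ _ → refl) B²

  ϑ⁹≈ : ϑ ^ 9 ≈ G₀ ⊕ (G₁ ⊕ G₂)
  ϑ⁹≈ = begin
    ϑ ^ 9
      ≈⟨ solve 1 (λ v → v :^ 9 := v :* (v :* v) :* (v :* (v :* v) :* (v :* (v :* v)))) ≈-refl ϑ ⟩
    ϑ ⊛ (ϑ ⊛ ϑ) ⊛ (ϑ ⊛ (ϑ ⊛ ϑ) ⊛ (ϑ ⊛ (ϑ ⊛ ϑ)))
      ≈⟨ *-cong ϑ-cube (*-cong ϑ-cube ϑ-cube) ⟩
    w ⊛ (w ⊛ w)
      ≈⟨ solve 5 (λ a c x y z →
           let w = a :* x :+ (c :* y :+ c :* z) in
           w :* (w :* w) :=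
           a :* a :* a :* (x :* (x :* x)) :+ (c :* c :* c :* (y :* (y :* y)) :+
           (c :* c :* c :* (z :* (z :* z)) :+ con 6 :* (a :* c :* c) :* (x :* (y :* z)))) :+
           (con 3 :* (a :* a :* c :* (x :* (x :* y)) :+ (a :* c :* c :* (x :* (z :* z)) :+ c :* c :* c :* (y :* (y :* z)))) :+
            con 3 :* (a :* a :* c :* (x :* (x :* z)) :+ (a :* c :* c :* (x :* (y :* y)) :+ c :* c :* c :* (z :* (z :* y))))))
           ≈-refl a c x₀ x₁ x₂ ⟩
    a ⊛ a ⊛ a ⊛ X ⊕ (c ⊛ c ⊛ c ⊛ Y ⊕ (c ⊛ c ⊛ c ⊛ Z ⊕ num 6 ⊛ (a ⊛ c ⊛ c) ⊛ T)) ⊕ (G₁ ⊕ G₂)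
      ≈⟨ +-cong (+-cong (⊛-congˡ _ X-comb) (+-cong (⊛-congˡ _ Y-comb) (+-cong (⊛-congˡ _ Z-comb) (⊛-congˡ _ T-comb)))) ≈-refl ⟩
    a ⊛ a ⊛ a ⊛ comb A C C ⊕ (c ⊛ c ⊛ c ⊛ comb C A C ⊕
      (c ⊛ c ⊛ c ⊛ comb C C A ⊕ num 6 ⊛ (a ⊛ c ⊛ c) ⊛ comb M M M)) ⊕ (G₁ ⊕ G₂)
      ≈⟨ +-cong (solve 8 (λ a c A C M e f g →
           let α = a :* a :* a :* A :+ con 2 :* (c :* c :* c :* C) :+ con 6 :* (a :* c :* c :* M)
               β = a :* a :* a :* C :+ c :* c :* c :* (A :+ C) :+ con 6 :* (a :* c :* c :* M)
           in
           a :* a :* a :* (A :* e :+ (C :* f :+ C :* g)) :+ (c :* c :* c :* (C :* e :+ (A :* f :+ C :* g)) :+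
           (c :* c :* c :* (C :* e :+ (C :* f :+ A :* g)) :+ con 6 :* (a :* c :* c) :* (M :* e :+ (M :* f :+ M :* g)))) :=
           α :* e :+ (β :* f :+ β :* g)) ≈-refl a c A C M E₀ E₁ E₂) ≈-refl ⟩
    G₀ ⊕ (G₁ ⊕ G₂) ∎
    where
    open ≈-Reasoning
    w : Laurent
    w = a ⊛ x₀ ⊕ (c ⊛ x₁ ⊕ c ⊛ x₂)

  α-zfree : ZFree α
  α-zfree = zfree-⊕ (zfree-⊕ (zfree-⊛ (zfree-⊛ (zfree-⊛ a-zfree a-zfree) a-zfree) A-zfree)
    (zfree-⊛ (num-zfree 2) (zfree-⊛ (zfree-⊛ (zfree-⊛ c-zfree c-zfree) c-zfree) C-zfree)))
    (zfree-⊛ (num-zfree 6) (zfree-⊛ (zfree-⊛ (zfree-⊛ a-zfree c-zfree) c-zfree) M-zfree))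

  β-zfree : ZFree β
  β-zfree = zfree-⊕ (zfree-⊕ (zfree-⊛ (zfree-⊛ (zfree-⊛ a-zfree a-zfree) a-zfree) C-zfree)
    (zfree-⊛ (zfree-⊛ (zfree-⊛ c-zfree c-zfree) c-zfree) (zfree-⊕ A-zfree C-zfree)))
    (zfree-⊛ (num-zfree 6) (zfree-⊛ (zfree-⊛ (zfree-⊛ a-zfree c-zfree) c-zfree) M-zfree))

  private
    Z₃ : ℤ → Laurent → Set
    Z₃ = Graded zdeg (+ 3)

    infixr 7 _⊗_
    _⊗_ : ∀ {w u r} → ZFree w → Z₃ r u → Z₃ r (w ⊛ u)
    _⊗_ {r = r} p q = subst (λ r → Z₃ r _) (ℤ.+-identityˡ r) (graded-⊛ zdeg-additive (zfree⇒graded p) q)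

    E-graded : ∀ r → Z₃ (+ 0) (E r)
    E-graded r = graded-⟪⟫ (λ j → tri r j by sym (ℤ.+-identityʳ _)) B

    xxx-graded : ∀ r r′ r″ → Z₃ (ε r ℤ.+ (ε r′ ℤ.+ ε r″)) (x r ⊛ (x r′ ⊛ x r″))
    xxx-graded r r′ r″ = graded-⊛ zdeg-additive (x-graded r) (graded-⊛ zdeg-additive (x-graded r′) (x-graded r″))

  G₀-graded : Z₃ (+ 0) G₀
  G₀-graded = graded-⊕ (α-zfree ⊗ E-graded 0F)
    (graded-⊕ (β-zfree ⊗ E-graded 1F) (β-zfree ⊗ E-graded 2F))

  G₁-graded : Z₃ (+ 1) G₁
  G₁-graded = num-zfree 3 ⊗ graded-⊕
    (zfree-⊛ (zfree-⊛ a-zfree a-zfree) c-zfree ⊗ xxx-graded 0F 0F 1F)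
    (graded-⊕ (zfree-⊛ (zfree-⊛ a-zfree c-zfree) c-zfree ⊗
                 graded-shift (-[1+ 0 ] by refl) (xxx-graded 0F 2F 2F))
              (zfree-⊛ (zfree-⊛ c-zfree c-zfree) c-zfree ⊗ xxx-graded 1F 1F 2F))

  G₂-graded : Z₃ -[1+ 0 ] G₂
  G₂-graded = num-zfree 3 ⊗ graded-⊕
    (zfree-⊛ (zfree-⊛ a-zfree a-zfree) c-zfree ⊗ xxx-graded 0F 0F 2F)
    (graded-⊕ (zfree-⊛ (zfree-⊛ a-zfree c-zfree) c-zfree ⊗
                 graded-shift ((+ 1) by refl) (xxx-graded 0F 1F 1F))
              (zfree-⊛ (zfree-⊛ c-zfree c-zfree) c-zfree ⊗ xxx-graded 2F 2F 1F))

  private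
    a⁴c² a³c³ a²c⁴ ac⁵ c⁶ : Laurent
    a⁴c² = a ⊛ a ⊛ a ⊛ a ⊛ c ⊛ c
    a³c³ = a ⊛ a ⊛ a ⊛ c ⊛ c ⊛ c
    a²c⁴ = num 3 ⊛ (a ⊛ a ⊛ c ⊛ c ⊛ c ⊛ c)
    ac⁵ = a ⊛ c ⊛ c ⊛ c ⊛ c ⊛ c
    c⁶ = c ⊛ c ⊛ c ⊛ c ⊛ c ⊛ c

    products : Laurent → Laurent → Laurent → Laurent → Laurent
    products X Y Z T = num 18 ⊛ (a⁴c² ⊛ (X ⊛ T) ⊕ (a³c³ ⊛ (X ⊛ Y) ⊕ (a³c³ ⊛ (X ⊛ Z) ⊕
      (a²c⁴ ⊛ (T ⊛ T) ⊕ (ac⁵ ⊛ (T ⊛ Y) ⊕ (ac⁵ ⊛ (T ⊛ Z) ⊕ c⁶ ⊛ (Y ⊛ Z)))))))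

    products-cong : ∀ {X X′ Y Y′ Z Z′ T T′} → X ≈ X′ → Y ≈ Y′ → Z ≈ Z′ → T ≈ T′ →
                    products X Y Z T ≈ products X′ Y′ Z′ T′
    products-cong p q r s = ⊛-congˡ _ (+-cong (⊛-congˡ _ (*-cong p s)) (+-cong (⊛-congˡ _ (*-cong p q))
      (+-cong (⊛-congˡ _ (*-cong p r)) (+-cong (⊛-congˡ _ (*-cong s s)) (+-cong (⊛-congˡ _ (*-cong s q))
      (+-cong (⊛-congˡ _ (*-cong s r)) (⊛-congˡ _ (*-cong q r))))))))

  G₁⊛G₂ : num 2 ⊛ (G₁ ⊛ G₂) ≈ products X Y Z T
  G₁⊛G₂ = solve 5 (λ a c x y z →
    let X = x :* (x :* x); Y = y :* (y :* y); Z = z :* (z :* z); T = x :* (y :* z) in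
    con 2 :* ((con 3 :* (a :* a :* c :* (x :* (x :* y)) :+ (a :* c :* c :* (x :* (z :* z)) :+ c :* c :* c :* (y :* (y :* z))))) :*
              (con 3 :* (a :* a :* c :* (x :* (x :* z)) :+ (a :* c :* c :* (x :* (y :* y)) :+ c :* c :* c :* (z :* (z :* y)))))) :=
    con 18 :* (a :* a :* a :* a :* c :* c :* (X :* T) :+ (a :* a :* a :* c :* c :* c :* (X :* Y) :+
      (a :* a :* a :* c :* c :* c :* (X :* Z) :+ (con 3 :* (a :* a :* c :* c :* c :* c) :* (T :* T) :+
      (a :* c :* c :* c :* c :* c :* (T :* Y) :+ (a :* c :* c :* c :* c :* c :* (T :* Z) :+
       c :* c :* c :* c :* c :* c :* (Y :* Z))))))))
    ≈-refl a c x₀ x₁ x₂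

  ct-products : ct (products (comb A C C) (comb C A C) (comb C C A) (comb M M M)) ≈
    num 18 ⊛ (a⁴c² ⊛ (A ⊛ M ⊛ S 0F ⊕ (C ⊛ M ⊕ C ⊛ M) ⊛ S 1F) ⊕
             (a³c³ ⊛ (A ⊛ C ⊛ S 0F ⊕ (C ⊛ C ⊕ C ⊛ A) ⊛ S 1F) ⊕
             (a³c³ ⊛ (A ⊛ C ⊛ S 0F ⊕ (C ⊛ A ⊕ C ⊛ C) ⊛ S 1F) ⊕
             (a²c⁴ ⊛ (M ⊛ M ⊛ S 0F ⊕ (M ⊛ M ⊕ M ⊛ M) ⊛ S 1F) ⊕
             (ac⁵ ⊛ (M ⊛ C ⊛ S 0F ⊕ (M ⊛ C ⊕ M ⊛ A) ⊛ S 1F) ⊕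
             (ac⁵ ⊛ (M ⊛ C ⊛ S 0F ⊕ (M ⊛ A ⊕ M ⊛ C) ⊛ S 1F) ⊕
              c⁶ ⊛ (C ⊛ C ⊛ S 0F ⊕ (A ⊛ A ⊕ C ⊛ C) ⊛ S 1F)))))))
  ct-products = ct-scale _ (num-zfree 18)
    (ct-⊕ _ _ (ct-scale _ (z-⊛ (z-⊛ (z-⊛ (z-⊛ (z-⊛ a-zfree a-zfree) a-zfree) a-zfree) c-zfree) c-zfree)
      (pairing A-zfree C-zfree C-zfree M-zfree M-zfree M-zfree))
    (ct-⊕ _ _ (ct-scale _ a³c³-zfree (pairing A-zfree C-zfree C-zfree C-zfree A-zfree C-zfree))
    (ct-⊕ _ _ (ct-scale _ a³c³-zfree (pairing A-zfree C-zfree C-zfree C-zfree C-zfree A-zfree))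
    (ct-⊕ _ _ (ct-scale _ (z-⊛ (num-zfree 3) (z-⊛ (z-⊛ (z-⊛ (z-⊛ (z-⊛ a-zfree a-zfree) c-zfree) c-zfree) c-zfree) c-zfree))
      (pairing M-zfree M-zfree M-zfree M-zfree M-zfree M-zfree))
    (ct-⊕ _ _ (ct-scale _ ac⁵-zfree (pairing M-zfree M-zfree M-zfree C-zfree A-zfree C-zfree))
    (ct-⊕ _ _ (ct-scale _ ac⁵-zfree (pairing M-zfree M-zfree M-zfree C-zfree C-zfree A-zfree))
    (ct-scale _ (z-⊛ (z-⊛ (z-⊛ (z-⊛ (z-⊛ c-zfree c-zfree) c-zfree) c-zfree) c-zfree) c-zfree)
      (pairing C-zfree A-zfree C-zfree C-zfree C-zfree A-zfree))))))))
    where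
    z-⊛ : ∀ {u v} → ZFree u → ZFree v → ZFree (u ⊛ v)
    z-⊛ = zfree-⊛
    a³c³-zfree : ZFree a³c³
    a³c³-zfree = z-⊛ (z-⊛ (z-⊛ (z-⊛ (z-⊛ a-zfree a-zfree) a-zfree) c-zfree) c-zfree) c-zfree
    ac⁵-zfree : ZFree ac⁵
    ac⁵-zfree = z-⊛ (z-⊛ (z-⊛ (z-⊛ (z-⊛ a-zfree c-zfree) c-zfree) c-zfree) c-zfree) c-zfree

  -- In `α`, `β` and the cross terms, `M` and `c` can be collected into c² M = 9M³ and c³ = 27M³,
  -- and M³ is `D`. Everything thus becomes a form in A and t; 162 is 18 · 9, the factor of the
  -- cross term with a single c² M.
  α′ β′ coefficient₀ coefficient₁ : Laurent
  α′ = a ⊛ a ⊛ a ⊛ A ⊕ num 54 ⊛ (D ⊛ C) ⊕ num 54 ⊛ (a ⊛ D)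
  β′ = a ⊛ a ⊛ a ⊛ C ⊕ num 27 ⊛ (D ⊛ (A ⊕ C)) ⊕ num 54 ⊛ (a ⊛ D)
  coefficient₀ = α′ ⊛ α′ ⊕ num 162 ⊛ (a ⊛ a ⊛ a ⊛ a ⊛ D ⊛ A ⊕ num 6 ⊛ (a ⊛ a ⊛ a ⊛ D ⊛ A ⊛ C) ⊕
    num 27 ⊛ (a ⊛ a ⊛ D ⊛ D) ⊕ num 54 ⊛ (a ⊛ D ⊛ D ⊛ C) ⊕ num 81 ⊛ (D ⊛ D ⊛ C ⊛ C))
  coefficient₁ = num 2 ⊛ (β′ ⊛ β′) ⊕ num 162 ⊛ (num 2 ⊛ (a ⊛ a ⊛ a ⊛ a ⊛ D ⊛ C) ⊕
    num 6 ⊛ (a ⊛ a ⊛ a ⊛ D ⊛ C ⊛ (A ⊕ C)) ⊕ num 54 ⊛ (a ⊛ a ⊛ D ⊛ D) ⊕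
    num 54 ⊛ (a ⊛ D ⊛ D ⊛ (A ⊕ C)) ⊕ num 81 ⊛ (D ⊛ D ⊛ (A ⊛ A ⊕ C ⊛ C)))

  c³≈27D : c ⊛ c ⊛ c ≈ num 27 ⊛ D
  c³≈27D = begin
    c ⊛ c ⊛ c          ≈⟨ *-cong (*-cong c≈3M c≈3M) c≈3M ⟩
    3M ⊛ 3M ⊛ 3M       ≈⟨ solve 1 (λ M → let 3M = M :+ (M :+ M) in 3M :* 3M :* 3M := con 27 :* (M :* (M :* M))) ≈-refl M ⟩
    num 27 ⊛ M³        ≈⟨ ⊛-congˡ _ M³≈D ⟩
    num 27 ⊛ D         ∎
    where
    open ≈-Reasoning
    3M : Laurent
    3M = M ⊕ (M ⊕ M)

  c²M≈9D : c ⊛ c ⊛ M ≈ num 9 ⊛ D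
  c²M≈9D = begin
    c ⊛ c ⊛ M          ≈⟨ ⊛-congʳ M (*-cong c≈3M c≈3M) ⟩
    3M ⊛ 3M ⊛ M        ≈⟨ solve 1 (λ M → let 3M = M :+ (M :+ M) in 3M :* 3M :* M := con 9 :* (M :* (M :* M))) ≈-refl M ⟩
    num 9 ⊛ M³         ≈⟨ ⊛-congˡ _ M³≈D ⟩
    num 9 ⊛ D          ∎
    where
    open ≈-Reasoning
    3M : Laurent
    3M = M ⊕ (M ⊕ M)

  α≈α′ : α ≈ α′
  α≈α′ = begin
    α ≈⟨ solve 5 (λ a c A C M → a :* a :* a :* A :+ con 2 :* (c :* c :* c :* C) :+ con 6 :* (a :* c :* c :* M) :=
           a :* a :* a :* A :+ con 2 :* (c :* c :* c :* C) :+ con 6 :* (a :* (c :* c :* M))) ≈-refl a c A C M ⟩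
    a ⊛ a ⊛ a ⊛ A ⊕ num 2 ⊛ (c ⊛ c ⊛ c ⊛ C) ⊕ num 6 ⊛ (a ⊛ (c ⊛ c ⊛ M))
      ≈⟨ +-cong (+-cong ≈-refl (⊛-congˡ _ (⊛-congʳ C c³≈27D))) (⊛-congˡ _ (⊛-congˡ a c²M≈9D)) ⟩
    a ⊛ a ⊛ a ⊛ A ⊕ num 2 ⊛ (num 27 ⊛ D ⊛ C) ⊕ num 6 ⊛ (a ⊛ (num 9 ⊛ D))
      ≈⟨ solve 4 (λ a A C D → a :* a :* a :* A :+ con 2 :* (con 27 :* D :* C) :+ con 6 :* (a :* (con 9 :* D)) :=
           a :* a :* a :* A :+ con 54 :* (D :* C) :+ con 54 :* (a :* D)) ≈-refl a A C D ⟩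
    α′ ∎
    where open ≈-Reasoning

  β≈β′ : β ≈ β′
  β≈β′ = begin
    β ≈⟨ solve 5 (λ a c A C M → a :* a :* a :* C :+ c :* c :* c :* (A :+ C) :+ con 6 :* (a :* c :* c :* M) :=
           a :* a :* a :* C :+ c :* c :* c :* (A :+ C) :+ con 6 :* (a :* (c :* c :* M))) ≈-refl a c A C M ⟩
    a ⊛ a ⊛ a ⊛ C ⊕ c ⊛ c ⊛ c ⊛ (A ⊕ C) ⊕ num 6 ⊛ (a ⊛ (c ⊛ c ⊛ M))
      ≈⟨ +-cong (+-cong ≈-refl (⊛-congʳ _ c³≈27D)) (⊛-congˡ _ (⊛-congˡ a c²M≈9D)) ⟩
    a ⊛ a ⊛ a ⊛ C ⊕ num 27 ⊛ D ⊛ (A ⊕ C) ⊕ num 6 ⊛ (a ⊛ (num 9 ⊛ D))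
      ≈⟨ solve 4 (λ a A C D → a :* a :* a :* C :+ con 27 :* D :* (A :+ C) :+ con 6 :* (a :* (con 9 :* D)) :=
           a :* a :* a :* C :+ con 27 :* (D :* (A :+ C)) :+ con 54 :* (a :* D)) ≈-refl a A C D ⟩
    β′ ∎
    where open ≈-Reasoning

  -- In the square of `G₀ ⊕ (G₁ ⊕ G₂)` only `G₀ ⊛ G₀` and twice `G₁ ⊛ G₂` have z-degrees divisible
  -- by 3; the remaining products have no constant term.
  ct-ϑ¹⁸ : ct (ϑ ^ 18) ≈ coefficient₀ ⊛ S 0F ⊕ coefficient₁ ⊛ S 1F
  ct-ϑ¹⁸ = begin
    ct (ϑ ^ 18)
      ≈⟨ keep-cong z⁰ (^-homo-* ϑ 9 9) ⟩
    ct (ϑ ^ 9 ⊛ ϑ ^ 9)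
      ≈⟨ keep-cong z⁰ (*-cong ϑ⁹≈ ϑ⁹≈) ⟩
    ct ((G₀ ⊕ (G₁ ⊕ G₂)) ⊛ (G₀ ⊕ (G₁ ⊕ G₂)))
      ≈⟨ keep-cong z⁰ (solve 3 (λ g h k → (g :+ (h :+ k)) :* (g :+ (h :+ k)) :=
           g :* g :+ (con 2 :* (h :* k) :+ ((g :+ g) :* h :+ ((g :+ g) :* k :+ (h :* h :+ k :* k))))) ≈-refl G₀ G₁ G₂) ⟩
    ct (G₀ ⊛ G₀ ⊕ (num 2 ⊛ (G₁ ⊛ G₂) ⊕ ((G₀ ⊕ G₀) ⊛ G₁ ⊕ ((G₀ ⊕ G₀) ⊛ G₂ ⊕ (G₁ ⊛ G₁ ⊕ G₂ ⊛ G₂)))))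
      ≈⟨ keep-cong z⁰ (+-cong ≈-refl (+-cong (≈-trans G₁⊛G₂ (products-cong X-comb Y-comb Z-comb T-comb)) ≈-refl)) ⟩
    ct (G₀ ⊛ G₀ ⊕ (products (comb A C C) (comb C A C) (comb C C A) (comb M M M) ⊕
      ((G₀ ⊕ G₀) ⊛ G₁ ⊕ ((G₀ ⊕ G₀) ⊛ G₂ ⊕ (G₁ ⊛ G₁ ⊕ G₂ ⊛ G₂)))))
      ≈⟨ ct-⊕ _ _ (pairing α-zfree β-zfree β-zfree α-zfree β-zfree β-zfree) (ct-⊕ _ _ ct-products
        (ct-⊕ _ _ (ct-𝟘 (≢0-mod 3 (+ 1)) (graded-⊛ zdeg-additive (graded-⊕ G₀-graded G₀-graded) G₁-graded))
        (ct-⊕ _ _ (ct-𝟘 (≢0-mod 3 -[1+ 0 ]) (graded-⊛ zdeg-additive (graded-⊕ G₀-graded G₀-graded) G₂-graded))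
        (ct-⊕ _ _ (ct-𝟘 (≢0-mod 3 (+ 2)) (graded-⊛ zdeg-additive G₁-graded G₁-graded))
                  (ct-𝟘 (≢0-mod 3 -[1+ 1 ]) (graded-⊛ zdeg-additive G₂-graded G₂-graded)))))) ⟩
    _
      ≈⟨ solve 9 (λ u v a c A C M s r →
           let d = c :* c :* M
               e = c :* c :* c
           in
           (u :* u :* s :+ (v :* v :+ v :* v) :* r) :+
           (con 18 :* (a :* a :* a :* a :* c :* c :* (A :* M :* s :+ (C :* M :+ C :* M) :* r) :+
             (a :* a :* a :* c :* c :* c :* (A :* C :* s :+ (C :* C :+ C :* A) :* r) :+
             (a :* a :* a :* c :* c :* c :* (A :* C :* s :+ (C :* A :+ C :* C) :* r) :+
             (con 3 :* (a :* a :* c :* c :* c :* c) :* (M :* M :* s :+ (M :* M :+ M :* M) :* r) :+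
             (a :* c :* c :* c :* c :* c :* (M :* C :* s :+ (M :* C :+ M :* A) :* r) :+
             (a :* c :* c :* c :* c :* c :* (M :* C :* s :+ (M :* A :+ M :* C) :* r) :+
              c :* c :* c :* c :* c :* c :* (C :* C :* s :+ (A :* A :+ C :* C) :* r))))))) :+
            (con 0 :+ (con 0 :+ (con 0 :+ con 0)))) :=
           (u :* u :* s :+ (v :* v :+ v :* v) :* r) :+ con 18 :* (
             (a :* a :* a :* a :* (d :* A) :+ con 2 :* (a :* a :* a :* e :* A :* C) :+ con 3 :* (a :* a :* (d :* d)) :+
               con 2 :* (a :* e :* d :* C) :+ e :* e :* C :* C) :* s :+
              (con 2 :* (a :* a :* a :* a :* d :* C) :+ con 2 :* (a :* a :* a :* e :* (C :* (A :+ C))) :+ con 6 :* (a :* a :* (d :* d)) :+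
               con 2 :* (a :* e :* d :* (A :+ C)) :+ e :* e :* (A :* A :+ C :* C)) :* r)) ≈-refl α β a c A C M S₀ S₁ ⟩
    (α ⊛ α ⊛ S₀ ⊕ (β ⊛ β ⊕ β ⊛ β) ⊛ S₁) ⊕ cross (c ⊛ c ⊛ M) (c ⊛ c ⊛ c)
      ≈⟨ +-cong (+-cong (⊛-congʳ S₀ (*-cong α≈α′ α≈α′)) (⊛-congʳ S₁ (+-cong (*-cong β≈β′ β≈β′) (*-cong β≈β′ β≈β′))))
           (cross-cong c²M≈9D c³≈27D) ⟩
    (α′ ⊛ α′ ⊛ S₀ ⊕ (β′ ⊛ β′ ⊕ β′ ⊛ β′) ⊛ S₁) ⊕ cross (num 9 ⊛ D) (num 27 ⊛ D)
      ≈⟨ solve 8 (λ u v a A C D s r →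
           let d = con 9 :* D
               e = con 27 :* D
           in
           (u :* u :* s :+ (v :* v :+ v :* v) :* r) :+ con 18 :* (
             (a :* a :* a :* a :* (d :* A) :+ con 2 :* (a :* a :* a :* e :* A :* C) :+ con 3 :* (a :* a :* (d :* d)) :+
               con 2 :* (a :* e :* d :* C) :+ e :* e :* C :* C) :* s :+
              (con 2 :* (a :* a :* a :* a :* d :* C) :+ con 2 :* (a :* a :* a :* e :* (C :* (A :+ C))) :+ con 6 :* (a :* a :* (d :* d)) :+
               con 2 :* (a :* e :* d :* (A :+ C)) :+ e :* e :* (A :* A :+ C :* C)) :* r) :=
           (u :* u :+ con 162 :* (a :* a :* a :* a :* D :* A :+ con 6 :* (a :* a :* a :* D :* A :* C) :+
             con 27 :* (a :* a :* D :* D) :+ con 54 :* (a :* D :* D :* C) :+ con 81 :* (D :* D :* C :* C))) :* s :+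
           (con 2 :* (v :* v) :+ con 162 :* (con 2 :* (a :* a :* a :* a :* D :* C) :+
             con 6 :* (a :* a :* a :* D :* C :* (A :+ C)) :+ con 54 :* (a :* a :* D :* D) :+
             con 54 :* (a :* D :* D :* (A :+ C)) :+ con 81 :* (D :* D :* (A :* A :+ C :* C)))) :* r)
           ≈-refl α′ β′ a A C D S₀ S₁ ⟩
    coefficient₀ ⊛ S 0F ⊕ coefficient₁ ⊛ S 1F ∎
    where
    open ≈-Reasoning
    S₀ S₁ : Laurent
    S₀ = S 0F
    S₁ = S 1F
    cross : Laurent → Laurent → Laurent
    cross d e = num 18 ⊛ (
      (a ⊛ a ⊛ a ⊛ a ⊛ (d ⊛ A) ⊕ num 2 ⊛ (a ⊛ a ⊛ a ⊛ e ⊛ A ⊛ C) ⊕ num 3 ⊛ (a ⊛ a ⊛ (d ⊛ d)) ⊕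
       num 2 ⊛ (a ⊛ e ⊛ d ⊛ C) ⊕ e ⊛ e ⊛ C ⊛ C) ⊛ S₀ ⊕
      (num 2 ⊛ (a ⊛ a ⊛ a ⊛ a ⊛ d ⊛ C) ⊕ num 2 ⊛ (a ⊛ a ⊛ a ⊛ e ⊛ (C ⊛ (A ⊕ C))) ⊕ num 6 ⊛ (a ⊛ a ⊛ (d ⊛ d)) ⊕
       num 2 ⊛ (a ⊛ e ⊛ d ⊛ (A ⊕ C)) ⊕ e ⊛ e ⊛ (A ⊛ A ⊕ C ⊛ C)) ⊛ S₁)
    cross-cong : ∀ {d d′ e e′} → d ≈ d′ → e ≈ e′ → cross d e ≈ cross d′ e′
    cross-cong p q = ⊛-congˡ _ (+-cong
      (⊛-congʳ S₀ (+-cong (+-cong (+-cong (+-cong (⊛-congˡ _ (⊛-congʳ A p)) (⊛-congˡ _ (⊛-congʳ C (⊛-congʳ A (⊛-congˡ _ q)))))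
        (⊛-congˡ _ (⊛-congˡ _ (*-cong p p)))) (⊛-congˡ _ (⊛-congʳ C (*-cong (⊛-congˡ a q) p)))) (⊛-congʳ C (⊛-congʳ C (*-cong q q)))))
      (⊛-congʳ S₁ (+-cong (+-cong (+-cong (+-cong (⊛-congˡ _ (⊛-congʳ C (⊛-congˡ _ p))) (⊛-congˡ _ (⊛-congʳ _ (⊛-congˡ _ q))))
        (⊛-congˡ _ (⊛-congˡ _ (*-cong p p)))) (⊛-congˡ _ (⊛-congʳ _ (*-cong (⊛-congˡ a q) p)))) (⊛-congʳ _ (*-cong q q)))))

-- The finite triple product and q-binomial coefficients

module Products {c ℓ} (R : CommutativeSemiring c ℓ) where
  open CommutativeSemiring R hiding (zero) renaming (refl to ≈-refl; sym to ≈-sym; trans to ≈-trans)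
  open SemiringSolver R using (solve; _:+_; _:*_; _:=_; con)

  sum prod : (ℕ → Carrier) → ℕ → Carrier
  sum f zero     = 0#
  sum f (suc n)  = f 0 + sum (f ∘ suc) n
  prod f zero    = 1#
  prod f (suc n) = f n * prod f n

  sum-cong : ∀ {f g} n → (∀ k → k < n → f k ≈ g k) → sum f n ≈ sum g n
  sum-cong zero    e = ≈-refl
  sum-cong (suc n) e = +-cong (e 0 (s≤s z≤n)) (sum-cong n (λ k k<n → e (suc k) (s≤s k<n)))

  sum-zero : ∀ {f} n → (∀ k → k < n → f k ≈ 0#) → sum f n ≈ 0#
  sum-zero zero    e = ≈-refl
  sum-zero (suc n) e = ≈-trans (+-cong (e 0 (s≤s z≤n)) (sum-zero n (λ k k<n → e (suc k) (s≤s k<n))))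
                             (+-identityˡ 0#)

  sum-*ʳ : ∀ f c n → sum (λ k → f k * c) n ≈ sum f n * c
  sum-*ʳ f c zero    = ≈-sym (zeroˡ c)
  sum-*ʳ f c (suc n) = ≈-trans (+-congˡ (sum-*ʳ (f ∘ suc) c n)) (≈-sym (distribʳ c _ _))

  prod-cong : ∀ {f g} n → (∀ k → f k ≈ g k) → prod f n ≈ prod g n
  prod-cong zero    e = ≈-refl
  prod-cong (suc n) e = *-cong (e n) (prod-cong n e)

  prod-mod3 : ∀ f n → prod f (n ℕ.* 3) ≈ prod (λ k → f (k ℕ.* 3)) n *
                (prod (λ k → f (suc (k ℕ.* 3))) n * prod (λ k → f (suc (suc (k ℕ.* 3)))) n)
  prod-mod3 f zero    = solve 0 (con 1 := con 1 :* (con 1 :* con 1)) ≈-refl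
  prod-mod3 f (suc n) = ≈-trans (*-congˡ (*-congˡ (*-congˡ (prod-mod3 f n))))
    (solve 6 (λ x y z p q r → z :* (y :* (x :* (p :* (q :* r)))) := x :* p :* (y :* q :* (z :* r)))
      ≈-refl (f (n ℕ.* 3)) _ _ _ _ _)

module TripleProduct {c ℓ} (R : CommutativeSemiring c ℓ) (q : CommutativeSemiring.Carrier R) where
  open CommutativeSemiring R hiding (zero) renaming (refl to ≈-refl; sym to ≈-sym; trans to ≈-trans)
  open Products R
  open Exp R using (_^_; ^-homo-*; ^-congʳ)
  open SemiringSolver R using (solve; _:+_; _:*_; _:=_; con)
  open import Relation.Binary.Reasoning.Setoid setoid

  -- pascal n f is the sum over k ≤ n of f k times the q-binomial coefficient.
  pascal : ℕ → (ℕ → Carrier) → Carrier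
  pascal zero    f = f 0
  pascal (suc n) f = pascal n (λ k → q ^ k * f k) + pascal n (f ∘ suc)

  pascal-cong : ∀ {f g} n → (∀ k → k ≤ n → f k ≈ g k) → pascal n f ≈ pascal n g
  pascal-cong zero    e = e 0 z≤n
  pascal-cong (suc n) e = +-cong
    (pascal-cong n (λ k k≤n → *-congˡ (e k (ℕ.m≤n⇒m≤1+n k≤n))))
    (pascal-cong n (λ k k≤n → e (suc k) (s≤s k≤n)))

  pascal-+ : ∀ f g n → pascal n (λ k → f k + g k) ≈ pascal n f + pascal n g
  pascal-+ f g zero    = ≈-refl
  pascal-+ f g (suc n) = begin
    pascal n (λ k → q ^ k * (f k + g k)) + pascal n (λ k → f (suc k) + g (suc k))
      ≈⟨ +-cong (≈-trans (pascal-cong n (λ k _ → distribˡ (q ^ k) (f k) (g k))) (pascal-+ _ _ n)) (pascal-+ _ _ n) ⟩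
    pascal n (λ k → q ^ k * f k) + pascal n (λ k → q ^ k * g k) + (pascal n (f ∘ suc) + pascal n (g ∘ suc))
      ≈⟨ solve 4 (λ a b c d → a :+ b :+ (c :+ d) := a :+ c :+ (b :+ d)) ≈-refl _ _ _ _ ⟩
    pascal (suc n) f + pascal (suc n) g ∎

  pascal-* : ∀ c f n → pascal n (λ k → c * f k) ≈ c * pascal n f
  pascal-* c f zero    = ≈-refl
  pascal-* c f (suc n) = begin
    pascal n (λ k → q ^ k * (c * f k)) + pascal n (λ k → c * f (suc k))
      ≈⟨ +-cong (≈-trans (pascal-cong n (λ k _ → solve 3 (λ x y z → x :* (y :* z) := y :* (x :* z)) ≈-refl (q ^ k) c (f k)))
                       (pascal-* c _ n)) (pascal-* c _ n) ⟩
    c * pascal n (λ k → q ^ k * f k) + c * pascal n (f ∘ suc)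
      ≈⟨ distribˡ c _ _ ⟨
    c * pascal (suc n) f ∎

  pascal-0 : ∀ n → pascal n (λ _ → 0#) ≈ 0#
  pascal-0 n = ≈-trans (pascal-cong n (λ _ _ → ≈-sym (zeroˡ 0#))) (≈-trans (pascal-* 0# (λ _ → 0#) n) (zeroˡ _))

  private
    powers : ∀ {k n} → k ≤ n → ∀ y → q ^ (n ∸ k) * (q ^ suc k * y) ≈ q ^ k * (q ^ (suc n ∸ k) * y)
    powers {k} {n} k≤n y = begin
      q ^ (n ∸ k) * (q ^ suc k * y)      ≈⟨ *-assoc _ _ y ⟨
      q ^ (n ∸ k) * q ^ suc k * y        ≈⟨ *-congʳ (^-homo-* q (n ∸ k) (suc k)) ⟨
      q ^ (n ∸ k ℕ.+ suc k) * y          ≈⟨ *-congʳ (^-congʳ q exponents) ⟩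
      q ^ (k ℕ.+ (suc n ∸ k)) * y        ≈⟨ *-congʳ (^-homo-* q k (suc n ∸ k)) ⟩
      q ^ k * q ^ (suc n ∸ k) * y        ≈⟨ *-assoc _ _ y ⟩
      q ^ k * (q ^ (suc n ∸ k) * y)      ∎
      where
      exponents : n ∸ k ℕ.+ suc k ≡ k ℕ.+ (suc n ∸ k)
      exponents = trans (ℕ.+-suc (n ∸ k) k) (trans (cong suc (ℕ.m∸n+n≡m k≤n))
        (sym (ℕ.m+[n∸m]≡n (ℕ.m≤n⇒m≤1+n k≤n))))

  -- The definition of `pascal` builds in one q-Pascal rule, [n+1, k+1] = q^(k+1) [n, k+1] + [n, k];
  -- this is the other one, [n+1, k+1] = [n, k+1] + q^(n-k) [n, k].
  pascal-suc : ∀ n f → pascal (suc n) f ≈ pascal n f + pascal n (λ k → q ^ (n ∸ k) * f (suc k))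
  pascal-suc zero    f = solve 2 (λ x y → con 1 :* x :+ y := x :+ con 1 :* y) ≈-refl (f 0) (f 1)
  pascal-suc (suc n) f = begin
    pascal (suc n) (λ k → q ^ k * f k) + pascal (suc n) (f ∘ suc)
      ≈⟨ +-cong (pascal-suc n _) (pascal-suc n _) ⟩
    pascal n (λ k → q ^ k * f k) + pascal n (λ k → q ^ (n ∸ k) * (q ^ suc k * f (suc k))) +
      (pascal n (f ∘ suc) + pascal n (λ k → q ^ (n ∸ k) * f (suc (suc k))))
      ≈⟨ +-congʳ (+-congˡ (pascal-cong n (λ k k≤n → powers k≤n (f (suc k))))) ⟩
    pascal n (λ k → q ^ k * f k) + pascal n (λ k → q ^ k * (q ^ (suc n ∸ k) * f (suc k))) +
      (pascal n (f ∘ suc) + pascal n (λ k → q ^ (n ∸ k) * f (suc (suc k))))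
      ≈⟨ solve 4 (λ a b c d → a :+ b :+ (c :+ d) := a :+ c :+ (b :+ d)) ≈-refl _ _ _ _ ⟩
    pascal (suc n) f + pascal (suc n) (λ k → q ^ (suc n ∸ k) * f (suc k)) ∎

  -- f s k stands for the monomial of index k - s of the theta series.
  finiteTripleProduct : ∀ u v (f : ℕ → ℕ → Carrier) →
    (∀ s k → f (suc s) (suc k) ≈ f s k) →
    (∀ r s k → k ≤ r ℕ.+ s → u * q ^ r * f s k ≈ q ^ (r ℕ.+ s ∸ k) * f s (suc k)) →
    (∀ s k → v * q ^ s * f s k ≈ q ^ k * f (suc s) k) →
    ∀ r s → prod (λ j → 1# + u * q ^ j) r * prod (λ j → 1# + v * q ^ j) s * f 0 0 ≈ pascal (r ℕ.+ s) (f s)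
  finiteTripleProduct u v f shift up down zero zero = ≈-trans (*-congʳ (*-identityˡ 1#)) (*-identityˡ _)
  -- A further factor with `v` extends the sum at its lower end and moves the origin, which fits the
  -- defining recursion.
  finiteTripleProduct u v f shift up down zero (suc s) = begin
    1# * ((1# + v * q ^ s) * prod (λ j → 1# + v * q ^ j) s) * f 0 0
      ≈⟨ solve 3 (λ x p y → con 1 :* ((con 1 :+ x) :* p) :* y := x :* (con 1 :* p :* y) :+ con 1 :* p :* y)
           ≈-refl (v * q ^ s) _ (f 0 0) ⟩
    v * q ^ s * (1# * prod (λ j → 1# + v * q ^ j) s * f 0 0) + 1# * prod (λ j → 1# + v * q ^ j) s * f 0 0
      ≈⟨ +-cong (*-congˡ (finiteTripleProduct u v f shift up down zero s)) (finiteTripleProduct u v f shift up down zero s) ⟩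
    v * q ^ s * pascal s (f s) + pascal s (f s)
      ≈⟨ +-congʳ (pascal-* (v * q ^ s) (f s) s) ⟨
    pascal s (λ k → v * q ^ s * f s k) + pascal s (f s)
      ≈⟨ +-cong (pascal-cong s (λ k _ → down s k)) (pascal-cong s (λ k _ → ≈-sym (shift s k))) ⟩
    pascal (suc s) (f (suc s)) ∎
  -- A further factor with `u` extends the sum at its upper end with the origin fixed, which fits
  -- `pascal-suc`.
  finiteTripleProduct u v f shift up down (suc r) s = begin
    (1# + u * q ^ r) * prod (λ j → 1# + u * q ^ j) r * prod (λ j → 1# + v * q ^ j) s * f 0 0
      ≈⟨ solve 4 (λ x p p′ y → (con 1 :+ x) :* p :* p′ :* y := p :* p′ :* y :+ x :* (p :* p′ :* y))
           ≈-refl (u * q ^ r) _ _ (f 0 0) ⟩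
    prod (λ j → 1# + u * q ^ j) r * prod (λ j → 1# + v * q ^ j) s * f 0 0 +
      u * q ^ r * (prod (λ j → 1# + u * q ^ j) r * prod (λ j → 1# + v * q ^ j) s * f 0 0)
      ≈⟨ +-cong (finiteTripleProduct u v f shift up down r s) (*-congˡ (finiteTripleProduct u v f shift up down r s)) ⟩
    pascal (r ℕ.+ s) (f s) + u * q ^ r * pascal (r ℕ.+ s) (f s)
      ≈⟨ +-congˡ (pascal-* (u * q ^ r) (f s) (r ℕ.+ s)) ⟨
    pascal (r ℕ.+ s) (f s) + pascal (r ℕ.+ s) (λ k → u * q ^ r * f s k)
      ≈⟨ +-congˡ (pascal-cong (r ℕ.+ s) (λ k k≤n → up r s k k≤n)) ⟩
    pascal (r ℕ.+ s) (f s) + pascal (r ℕ.+ s) (λ k → q ^ (r ℕ.+ s ∸ k) * f s (suc k))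
      ≈⟨ pascal-suc (r ℕ.+ s) (f s) ⟨
    pascal (suc (r ℕ.+ s)) (f s) ∎

  δ : ℕ → ℕ → Carrier
  δ zero    zero    = 1#
  δ zero    (suc j) = 0#
  δ (suc i) zero    = 0#
  δ (suc i) (suc j) = δ i j

  δ-* : ∀ (f : ℕ → Carrier) i j → f j * δ i j ≈ f i * δ i j
  δ-* f zero    zero    = ≈-refl
  δ-* f zero    (suc j) = ≈-trans (zeroʳ _) (≈-sym (zeroʳ _))
  δ-* f (suc i) zero    = ≈-trans (zeroʳ _) (≈-sym (zeroʳ _))
  δ-* f (suc i) (suc j) = δ-* (f ∘ suc) i j

  binomial : ℕ → ℕ → Carrier
  binomial n k = pascal n (δ k)

  sum-δ : ∀ (f : ℕ → Carrier) n j → j < n → f j ≈ sum (λ i → f i * δ i j) n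
  sum-δ f (suc n) zero    _         = ≈-sym (≈-trans
    (+-cong (*-identityʳ (f 0)) (sum-zero n (λ k _ → zeroʳ _))) (+-identityʳ (f 0)))
  sum-δ f (suc n) (suc j) (s≤s j<n) = ≈-sym (≈-trans
    (+-cong (zeroʳ (f 0)) (≈-sym (sum-δ (f ∘ suc) n j j<n))) (+-identityˡ _))

  pascal-sum : ∀ (F : ℕ → ℕ → Carrier) m n → pascal n (λ k → sum (λ i → F i k) m) ≈ sum (λ i → pascal n (F i)) m
  pascal-sum F zero    n = pascal-0 n
  pascal-sum F (suc m) n = ≈-trans (pascal-+ (F 0) _ n) (+-congˡ (pascal-sum (F ∘ suc) m n))

  pascal≈sum : ∀ f n → pascal n f ≈ sum (λ i → f i * binomial n i) (suc n)
  pascal≈sum f n = begin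
    pascal n f                                          ≈⟨ pascal-cong n (λ k k≤n → sum-δ f (suc n) k (s≤s k≤n)) ⟩
    pascal n (λ k → sum (λ i → f i * δ i k) (suc n))    ≈⟨ pascal-sum (λ i k → f i * δ i k) (suc n) n ⟩
    sum (λ i → pascal n (λ k → f i * δ i k)) (suc n)    ≈⟨ sum-cong (suc n) (λ i _ → pascal-* (f i) (δ i) n) ⟩
    sum (λ i → f i * binomial n i) (suc n)              ∎

  module Stable (K : ℕ) (q-nilpotent : ∀ k → K < k → q ^ k ≈ 0#) where

    private
      nilpotent-* : ∀ {k} x → K < k → q ^ k * x ≈ 0#
      nilpotent-* x K<k = ≈-trans (*-congʳ (q-nilpotent _ K<k)) (zeroˡ x)

    -- The discarded term of the first Pascal rule carries q^(k+1), which is 0 in this range.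
    binomial-suc-suc : ∀ n k → K ≤ k → binomial (suc n) (suc k) ≈ binomial n k
    binomial-suc-suc n k K≤k = begin
      pascal n (λ j → q ^ j * δ (suc k) j) + binomial n k
        ≈⟨ +-congʳ (pascal-cong n (λ j _ → ≈-trans (δ-* (q ^_) (suc k) j) (nilpotent-* _ (s≤s K≤k)))) ⟩
      pascal n (λ _ → 0#) + binomial n k
        ≈⟨ +-congʳ (pascal-0 n) ⟩
      0# + binomial n k
        ≈⟨ +-identityˡ _ ⟩
      binomial n k ∎

    -- The discarded term of the second Pascal rule carries q^(n-k), which is 0 in this range.
    binomial-suc : ∀ n k → K < n ∸ k → binomial (suc n) (suc k) ≈ binomial n (suc k)
    binomial-suc n k K<n-k = begin
      binomial (suc n) (suc k)
        ≈⟨ pascal-suc n (δ (suc k)) ⟩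
      binomial n (suc k) + pascal n (λ j → q ^ (n ∸ j) * δ k j)
        ≈⟨ +-congˡ (pascal-cong n (λ j _ → ≈-trans (δ-* (λ j → q ^ (n ∸ j)) k j) (nilpotent-* _ K<n-k))) ⟩
      binomial n (suc k) + pascal n (λ _ → 0#)
        ≈⟨ +-congˡ (pascal-0 n) ⟩
      binomial n (suc k) + 0#
        ≈⟨ +-identityʳ _ ⟩
      binomial n (suc k) ∎

    -- The partition generating function 1 / ((1 - q) (1 - q²) …).
    partitions : Carrier
    partitions = binomial (suc K ℕ.+ suc K) (suc K)

    private
      fixed : ∀ j → binomial (j ℕ.+ (suc K ℕ.+ suc K)) (suc K) ≈ partitions
      fixed zero    = ≈-refl
      fixed (suc j) = ≈-trans (binomial-suc (j ℕ.+ (suc K ℕ.+ suc K)) K K<) (fixed j)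
        where
        K< : K < j ℕ.+ (suc K ℕ.+ suc K) ∸ K
        K< = subst (suc K ≤_) (sym (trans (cong (_∸ K) (trans (sym (ℕ.+-assoc j (suc K) (suc K)))
               (trans (ℕ.+-suc (j ℕ.+ suc K) K) (cong (ℕ._+ K) (refl {x = suc (j ℕ.+ suc K)})))))
               (ℕ.m+n∸n≡m (suc (j ℕ.+ suc K)) K)))
             (ℕ.≤-trans (ℕ.m≤n+m (suc K) j) (ℕ.n≤1+n _))

      shifted : ∀ i j → binomial (i ℕ.+ (j ℕ.+ (suc K ℕ.+ suc K))) (i ℕ.+ suc K) ≈ partitions
      shifted zero    j = fixed j
      shifted (suc i) j = ≈-trans
        (binomial-suc-suc (i ℕ.+ (j ℕ.+ (suc K ℕ.+ suc K))) (i ℕ.+ suc K) (ℕ.≤-trans (ℕ.n≤1+n K) (ℕ.m≤n+m (suc K) i))) (shifted i j)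

    -- The coefficient is stable once both `k` and `n - k` exceed `K`: from the reference
    -- coefficient, `n` grows first with `k = suc K` fixed, and then both indices grow together.
    binomial≈partitions : ∀ n k → suc K ≤ k → k ℕ.+ suc K ≤ n → binomial n k ≈ partitions
    binomial≈partitions n k K<k k+K<n = ≈-trans
      (reflexive (cong₂ binomial n≡ (sym (ℕ.m∸n+n≡m K<k)))) (shifted (k ∸ suc K) (n ∸ (k ℕ.+ suc K)))
      where
      L = suc K
      n≡ : n ≡ (k ∸ L) ℕ.+ ((n ∸ (k ℕ.+ L)) ℕ.+ (L ℕ.+ L))
      n≡ = trans (sym (ℕ.m∸n+n≡m k+K<n)) (trans
        (cong (λ k → (n ∸ (k ℕ.+ L)) ℕ.+ (k ℕ.+ L)) (sym (ℕ.m∸n+n≡m K<k)))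
        (trans (cong (ℕ._+ ((k ∸ L ℕ.+ L) ℕ.+ L)) (cong (λ k → n ∸ (k ℕ.+ L)) (ℕ.m∸n+n≡m K<k)))
          (rearrange (n ∸ (k ℕ.+ L)) (k ∸ L) L)))
        where
        rearrange : ∀ x y z → x ℕ.+ ((y ℕ.+ z) ℕ.+ z) ≡ y ℕ.+ (x ℕ.+ (z ℕ.+ z))
        rearrange = solve-∀

-- Theta series as infinite products

opaque
  mon : Mon → Laurent
  mon s = s ∷ []

  ∑-mon : (φ : Mon → ℕ) → ∀ s → ∑ φ (mon s) ≡ φ s
  ∑-mon φ s = ℕ.+-identityʳ (φ s)

Q^ : ℕ → Laurent
Q^ d = mon (+ 0 , d)

module ThetaProduct (K : ℕ) where
  open Theta¹⁸ K public
  open Products laurent public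

  opaque
    unfolding mon _⊕_ ⟪_⟫

    mon-⊛ : ∀ s t → mon s ⊛ mon t ≈ mon (s ∙ t)
    mon-⊛ s t = ≈-refl

    𝟙≈mon : 𝟙 ≈ mon (+ 0 , 0)
    𝟙≈mon = ≈-refl

    mon-high : ∀ s → K < deg s → mon s ≈ 𝟘
    mon-high s K<s .at φ good = trans (ℕ.+-identityʳ (φ s)) (good s K<s)

    mon-graded : ∀ {χ d r s} → Congruent d r (χ s) → Graded χ d r (mon s)
    mon-graded p = graded (p ∷ [])

    ⟪⟫-applyUpTo : ∀ {I : Set} (F : I → QMon) (h : ℕ → I) n → ⟪ F ⟫ (applyUpTo h n) ≈ sum (λ k → mon ⌊ F (h k) ⌋) n
    ⟪⟫-applyUpTo F h zero    = ≈-refl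
    ⟪⟫-applyUpTo F h (suc n) = +-cong (≈-refl {mon ⌊ F (h 0) ⌋}) (⟪⟫-applyUpTo F (h ∘ suc) n)

  ⟪⟫-box : (F : ℤ → QMon) → ∀ n → ⟪ F ⟫ (box n) ≈ sum (λ k → mon ⌊ F (+ k ℤ.- + n) ⌋) (suc (n ℕ.+ n))
  ⟪⟫-box F n = ≈-trans (≡⇒≈ (⟪⟫-map F _ (upTo (suc (n ℕ.+ n))))) (⟪⟫-applyUpTo (λ k → F (+ k ℤ.- + n)) (λ k → k) (suc (n ℕ.+ n)))

  Q^-^ : ∀ d k → Q^ d ^ k ≈ Q^ (k ℕ.* d)
  Q^-^ d zero    = 𝟙≈mon
  Q^-^ d (suc k) = ≈-trans (⊛-congˡ (Q^ d) (Q^-^ d k)) (mon-⊛ _ _)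

  mon-⊛-Q^ : ∀ s d k → mon s ⊛ Q^ d ^ k ≈ mon (proj₁ s , deg s ℕ.+ k ℕ.* d)
  mon-⊛-Q^ s d k = ≈-trans (⊛-congˡ (mon s) (Q^-^ d k)) (≈-trans (mon-⊛ s _)
    (≡⇒≈ (cong (λ m → mon (m , deg s ℕ.+ k ℕ.* d)) (ℤ.+-identityʳ (proj₁ s)))))

  factors : Mon → ℕ → ℕ → Laurent
  factors s d = prod (λ j → 𝟙 ⊕ mon s ⊛ Q^ d ^ j)

  module Partitions (d : ℕ) (d>0 : 0 < d) where
    open TripleProduct laurent (Q^ d) public

    open Stable K (λ k K<k → ≈-trans (Q^-^ d k) (mon-high _ (ℕ.≤-trans K<k (ℕ.m≤m*n k d {{ℕ.>-nonZero d>0}})))) public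

    module _ {χ : Mon → ℤ} {e : ℤ} (χ-+ : Additive χ) (𝟙-graded : Graded χ e (+ 0) 𝟙)
             (q-graded : Graded χ e (+ 0) (Q^ d)) where

      ^-graded : ∀ k → Graded χ e (+ 0) (Q^ d ^ k)
      ^-graded zero    = 𝟙-graded
      ^-graded (suc k) = graded-⊛ χ-+ q-graded (^-graded k)

      pascal-graded : ∀ n {f} → (∀ k → Graded χ e (+ 0) (f k)) → Graded χ e (+ 0) (pascal n f)
      pascal-graded zero    p = p 0
      pascal-graded (suc n) p = graded-⊕ (pascal-graded n (λ k → graded-⊛ χ-+ (^-graded k) (p k)))
                                         (pascal-graded n (λ k → p (suc k)))

      δ-graded : ∀ i k → Graded χ e (+ 0) (δ i k)
      δ-graded zero    zero    = 𝟙-graded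
      δ-graded zero    (suc k) = graded-𝟘
      δ-graded (suc i) zero    = graded-𝟘
      δ-graded (suc i) (suc k) = δ-graded i k

      partitions-graded : Graded χ e (+ 0) partitions
      partitions-graded = pascal-graded (suc K ℕ.+ suc K) (δ-graded (suc K))

  -- The hypothesis on values says that F is the sequence of monomials of
  -- Ramanujan's theta function f(u , v) with u v = Qᵈ, up to a factor.
  tripleProduct : (F : ℤ → QMon) (ζ : ℤ) (a b : ℕ) (d>0 : 0 < a ℕ.+ b) →
    (∀ m → proj₁ (F (m ℤ.+ + 1)) ≡ proj₁ (F m) ℤ.+ ζ) →
    (∀ m → value (proj₂ (F (m ℤ.+ + 1))) ≡ value (proj₂ (F m)) ℤ.+ + a ℤ.+ + (a ℕ.+ b) ℤ.* m) →
    ∀ n → Within F (λ m → ∣ m ∣ ℕ.+ suc K ≤ n) →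
    factors (ζ , a) (a ℕ.+ b) n ⊛ factors (- ζ , b) (a ℕ.+ b) n ⊛ mon ⌊ F (+ 0) ⌋ ≈
    ⟪ F ⟫ (box n) ⊛ Partitions.partitions (a ℕ.+ b) d>0
  tripleProduct F ζ a b d>0 exponents values n central = begin
    factors (ζ , a) d n ⊛ factors (- ζ , b) d n ⊛ f 0 0
      ≈⟨ P.finiteTripleProduct (mon (ζ , a)) (mon (- ζ , b)) f shift up down n n ⟩
    P.pascal (n ℕ.+ n) (f n)
      ≈⟨ P.pascal≈sum (f n) (n ℕ.+ n) ⟩
    sum (λ k → f n k ⊛ P.binomial (n ℕ.+ n) k) (suc (n ℕ.+ n))
      ≈⟨ sum-cong (suc (n ℕ.+ n)) (λ k k≤2n → term k (ℕ.s≤s⁻¹ k≤2n)) ⟩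
    sum (λ k → f n k ⊛ P.partitions) (suc (n ℕ.+ n))
      ≈⟨ sum-*ʳ (f n) P.partitions (suc (n ℕ.+ n)) ⟩
    sum (f n) (suc (n ℕ.+ n)) ⊛ P.partitions
      ≈⟨ ⊛-congʳ P.partitions (⟪⟫-box F n) ⟨
    ⟪ F ⟫ (box n) ⊛ P.partitions ∎
    where
    open ≈-Reasoning
    d : ℕ
    d = a ℕ.+ b
    module P = Partitions d d>0
    f : ℕ → ℕ → Laurent
    f s k = mon ⌊ F (+ k ℤ.- + s) ⌋
    index : ∀ s k → + suc k ℤ.- + s ≡ + k ℤ.- + s ℤ.+ + 1
    index s k = trans (cong (ℤ._- + s) (ℤ.pos-+ 1 k)) (identity (+ s) (+ k))
      where
      identity : ∀ s k → + 1 ℤ.+ k ℤ.- s ≡ k ℤ.- s ℤ.+ + 1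
      identity = ℤ.solve-∀
    index′ : ∀ s k → + k ℤ.- + suc s ℤ.+ + 1 ≡ + k ℤ.- + s
    index′ s k = trans (cong (λ s → + k ℤ.- s ℤ.+ + 1) (ℤ.pos-+ 1 s)) (identity (+ s) (+ k))
      where
      identity : ∀ s k → k ℤ.- (+ 1 ℤ.+ s) ℤ.+ + 1 ≡ k ℤ.- s
      identity = ℤ.solve-∀
    shift : ∀ s k → f (suc s) (suc k) ≈ f s k
    shift s k = ≡⇒≈ (cong (λ m → mon ⌊ F m ⌋) (trans (index (suc s) k) (index′ s k)))
    compare : ∀ s i j m m′ → proj₁ s ℤ.+ proj₁ (F m) ≡ proj₁ (F m′) →
      + deg s ℤ.+ + i ℤ.* + d ℤ.+ value (proj₂ (F m)) ≡ + j ℤ.* + d ℤ.+ value (proj₂ (F m′)) →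
      mon s ⊛ Q^ d ^ i ⊛ mon ⌊ F m ⌋ ≈ Q^ d ^ j ⊛ mon ⌊ F m′ ⌋
    compare s i j m m′ p e = ≈-trans (⊛-congʳ _ (mon-⊛-Q^ s d i)) (≈-trans (mon-⊛ _ _)
      (≈-trans (≡⇒≈ (cong mon (cong₂ _,_ (trans p (sym (ℤ.+-identityˡ _))) (ℤ.+-injective degrees))))
      (≈-sym (≈-trans (⊛-congʳ _ (Q^-^ d j)) (mon-⊛ _ _)))))
      where
      degrees : + (deg s ℕ.+ i ℕ.* d ℕ.+ size (proj₂ (F m))) ≡ + (j ℕ.* d ℕ.+ size (proj₂ (F m′)))
      degrees = trans (cong₂ (λ x y → + deg s ℤ.+ x ℤ.+ y) (ℤ.pos-* i d) (size≡value (proj₂ (F m))))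
        (trans e (sym (cong₂ ℤ._+_ (ℤ.pos-* j d) (size≡value (proj₂ (F m′))))))
    up : ∀ r s k → k ≤ r ℕ.+ s → mon (ζ , a) ⊛ Q^ d ^ r ⊛ f s k ≈ Q^ d ^ (r ℕ.+ s ∸ k) ⊛ f s (suc k)
    up r s k k≤n = compare (ζ , a) r (r ℕ.+ s ∸ k) m (+ suc k ℤ.- + s)
      (trans (ℤ.+-comm ζ _) (trans (sym (exponents m)) (cong (proj₁ ∘ F) (sym (index s k)))))
      (trans (identity (+ r) (+ s) (+ k) (+ a) (+ d) (value (proj₂ (F m))))
        (cong₂ (λ x y → x ℤ.* + d ℤ.+ y)
          (sym (trans (sym (ℤ.⊖-≥ k≤n)) (sym (ℤ.m-n≡m⊖n (r ℕ.+ s) k))))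
          (trans (sym (values m)) (cong (value ∘ proj₂ ∘ F) (sym (index s k))))))
      where
      m = + k ℤ.- + s
      identity : ∀ r s k a d v → a ℤ.+ r ℤ.* d ℤ.+ v ≡ (r ℤ.+ s ℤ.- k) ℤ.* d ℤ.+ (v ℤ.+ a ℤ.+ d ℤ.* (k ℤ.- s))
      identity = ℤ.solve-∀
    down : ∀ s k → mon (- ζ , b) ⊛ Q^ d ^ s ⊛ f s k ≈ Q^ d ^ k ⊛ f (suc s) k
    down s k = compare (- ζ , b) s k (+ k ℤ.- + s) m
      (trans (cong (λ z → - ζ ℤ.+ z) (trans (cong (proj₁ ∘ F) (sym (index′ s k))) (exponents m)))
             (cancel ζ (proj₁ (F m))))
      (trans (cong (λ v → + b ℤ.+ + s ℤ.* + d ℤ.+ v) (trans (cong (value ∘ proj₂ ∘ F) (sym (index′ s k))) (values m)))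
        (trans (cong (λ n → + b ℤ.+ + s ℤ.* + d ℤ.+ (value (proj₂ (F m)) ℤ.+ + a ℤ.+ + d ℤ.* n))
                 (cong (λ s → + k ℤ.- s) (ℤ.pos-+ 1 s)))
               (identity (+ s) (+ k) (+ a) (+ b) (value (proj₂ (F m))))))
      where
      m = + k ℤ.- + suc s
      cancel : ∀ z y → - z ℤ.+ (y ℤ.+ z) ≡ y
      cancel = ℤ.solve-∀
      identity : ∀ s k a b v → b ℤ.+ s ℤ.* (a ℤ.+ b) ℤ.+ (v ℤ.+ a ℤ.+ (a ℤ.+ b) ℤ.* (k ℤ.- (+ 1 ℤ.+ s))) ≡ k ℤ.* (a ℤ.+ b) ℤ.+ v
      identity = ℤ.solve-∀
    -- Either the monomial has degree above `K` and both sides vanish, or `central` keeps `k` and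
    -- `2n - k` above `K`, where the q-binomial coefficient is stable.
    term : ∀ k → k ≤ n ℕ.+ n → f n k ⊛ P.binomial (n ℕ.+ n) k ≈ f n k ⊛ P.partitions
    term k k≤2n with size (proj₂ (F (+ k ℤ.- + n))) ℕ.≤? K
    ... | no  high = ≈-trans (⊛-congʳ _ zero-term) (≈-trans (⊛-zeroˡ _)
                       (≈-sym (≈-trans (⊛-congʳ _ zero-term) (⊛-zeroˡ _))))
      where
      zero-term : f n k ≈ 𝟘
      zero-term = mon-high _ (ℕ.≰⇒> high)
    ... | yes low = ⊛-congˡ (f n k) (P.binomial≈partitions (n ℕ.+ n) k
      (ℕ.+-cancelʳ-≤ ∣ m ∣ _ _ (ℕ.≤-trans (ℕ.≤-reflexive (ℕ.+-comm (suc K) ∣ m ∣)) (ℕ.≤-trans bound n≤k+∣m∣)))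
      (ℕ.≤-trans (ℕ.+-monoˡ-≤ (suc K) k≤n+∣m∣) (ℕ.≤-trans (ℕ.≤-reflexive (ℕ.+-assoc n ∣ m ∣ (suc K))) (ℕ.+-monoʳ-≤ n bound))))
      where
      m = + k ℤ.- + n
      bound : ∣ m ∣ ℕ.+ suc K ≤ n
      bound = central m low
      identity₁ : ∀ k n → k ℤ.- (k ℤ.- n) ≡ n
      identity₁ = ℤ.solve-∀
      identity₂ : ∀ k n → n ℤ.+ (k ℤ.- n) ≡ k
      identity₂ = ℤ.solve-∀
      n≤k+∣m∣ : n ≤ k ℕ.+ ∣ m ∣
      n≤k+∣m∣ = subst (_≤ k ℕ.+ ∣ m ∣) (cong ∣_∣ (identity₁ (+ k) (+ n))) (ℤ.∣i-j∣≤∣i∣+∣j∣ (+ k) m)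
      k≤n+∣m∣ : k ≤ n ℕ.+ ∣ m ∣
      k≤n+∣m∣ = subst (_≤ n ℕ.+ ∣ m ∣) (cong ∣_∣ (identity₂ (+ k) (+ n))) (ℤ.∣i+j∣≤∣i∣+∣j∣ (+ n) m)

  small⇒central : ∀ {n m} → 3 ℕ.* suc K ≤ n → Small 2 m → ∣ m ∣ ℕ.+ suc K ≤ n
  small⇒central 3K≤n (small p) = ℕ.≤-trans (ℕ.+-monoˡ-≤ (suc K) p)
    (ℕ.≤-trans (ℕ.≤-reflexive (ℕ.+-comm (2 ℕ.* suc K) (suc K))) 3K≤n)

  3K≤N : 3 ℕ.* suc K ≤ N
  3K≤N = ℕ.*-monoˡ-≤ (suc K) {3} {20} (s≤s (s≤s (s≤s z≤n)))

  module P₆ = Partitions 6 (s≤s z≤n)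
  module P₁₈ = Partitions 18 (s≤s z≤n)

  ϑ-product : factors (+ 1 , 3) 6 N ⊛ factors (-[1+ 0 ] , 3) 6 N ≈ ϑ ⊛ P₆.partitions
  ϑ-product = ≈-trans (≈-sym (≈-trans (⊛-congˡ _ (≈-sym 𝟙≈mon)) (*-identityʳ _)))
    (tripleProduct ϑQ (+ 1) 3 3 (s≤s z≤n) (λ _ → refl) values N (λ m p → small⇒central 3K≤N (ϑ-small m p)))
    where
    open CommutativeSemiring laurent using (*-identityʳ)
    values : ∀ m → + 3 ℤ.* ((m ℤ.+ + 1) ℤ.* (m ℤ.+ + 1)) ≡ + 3 ℤ.* (m ℤ.* m) ℤ.+ + 3 ℤ.+ + 6 ℤ.* m
    values = ℤ.solve-∀

  EallQ : ℤ → QMon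
  EallQ m = σQ (m , □ m)

  -- This is ϑ with z³ for z. Its box has radius `N * 3`, so that the product has `N * 3` factors,
  -- `N` for each residue of j modulo 3.
  Eall : Laurent
  Eall = ⟪ EallQ ⟫ (box (N ℕ.* 3))

  Eall-small : Within EallQ (Small 2)
  Eall-small m p = small-≤ (s≤s z≤n) (small-sq (ℕ.≤-trans (ℕ.m≤n*m (sq m) 3) p))

  Eall≈E₀+E₁+E₂ : Eall ≈ E 0F ⊕ (E 1F ⊕ E 2F)
  Eall≈E₀+E₁+E₂ = ≈-trans
    (≈-reindex EallQ (λ (r , j) → EQ r j) (λ (r , j) → tri r j) (λ m → residue m , quotient m)
      (box! (N ℕ.* 3)) (Unique.cartesianProduct⁺ (Unique.allFin⁺ 3) B!)
      (λ (r , j) → cong₂ _,_ (residue-tri r j) (quotient-tri r j)) tri-residue-quotient (λ _ → refl & refl)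
      (λ m p → ∈-box m (ℕ.≤-trans (Small.bound (Eall-small m p)) (ℕ.≤-trans (ℕ.*-monoˡ-≤ (suc K) {2} {20} (s≤s (s≤s z≤n))) (ℕ.m≤m*n N 3))))
      (λ m p → ∈-cartesianProduct⁺ (∈-allFin _) (small-∈B (small-tri {r = residue m}
        (subst (Small 2) (sym (tri-residue-quotient m)) (Eall-small m p))))))
    (⟪⟫-allFin₃ (λ (r , j) → EQ r j) B)

  Eall-product : factors (+ 3 , 3) 6 (N ℕ.* 3) ⊛ factors (-[1+ 2 ] , 3) 6 (N ℕ.* 3) ≈ Eall ⊛ P₆.partitions
  Eall-product = ≈-trans (≈-sym (≈-trans (⊛-congˡ _ (≈-sym 𝟙≈mon)) (*-identityʳ _)))
    (tripleProduct EallQ (+ 3) 3 3 (s≤s z≤n) exponents values (N ℕ.* 3)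
      (λ m p → small⇒central (ℕ.≤-trans 3K≤N (ℕ.m≤m*n N 3)) (Eall-small m p)))
    where
    open CommutativeSemiring laurent using (*-identityʳ)
    exponents : ∀ m → + 3 ℤ.* (m ℤ.+ + 1) ≡ + 3 ℤ.* m ℤ.+ + 3
    exponents = ℤ.solve-∀
    values : ∀ m → + 3 ℤ.* ((m ℤ.+ + 1) ℤ.* (m ℤ.+ + 1)) ≡ + 3 ℤ.* (m ℤ.* m) ℤ.+ + 3 ℤ.+ + 6 ℤ.* m
    values = ℤ.solve-∀

  private
    x-exponents : ∀ r m → tri r (m ℤ.+ + 1) ≡ tri r m ℤ.+ + 3
    x-exponents r m = identity m (ε r)
      where
      identity : ∀ m e → + 3 ℤ.* (m ℤ.+ + 1) ℤ.+ e ≡ + 3 ℤ.* m ℤ.+ e ℤ.+ + 3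
      identity = ℤ.solve-∀

    x-values : ∀ r m → tri r (m ℤ.+ + 1) ℤ.* tri r (m ℤ.+ + 1) ≡
               tri r m ℤ.* tri r m ℤ.+ (+ 9 ℤ.+ + 6 ℤ.* ε r) ℤ.+ + 18 ℤ.* m
    x-values r m = identity m (ε r)
      where
      identity : ∀ m e → (+ 3 ℤ.* (m ℤ.+ + 1) ℤ.+ e) ℤ.* (+ 3 ℤ.* (m ℤ.+ + 1) ℤ.+ e) ≡
        (+ 3 ℤ.* m ℤ.+ e) ℤ.* (+ 3 ℤ.* m ℤ.+ e) ℤ.+ (+ 9 ℤ.+ + 6 ℤ.* e) ℤ.+ + 18 ℤ.* m
      identity = ℤ.solve-∀

    x-central : ∀ r → Within (xQ r) (λ m → ∣ m ∣ ℕ.+ suc K ≤ N)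
    x-central r m p = small⇒central 3K≤N (x-small r m p)

  x₀-product : factors (+ 3 , 9) 18 N ⊛ factors (-[1+ 2 ] , 9) 18 N ⊛ mon (+ 0 , 0) ≈ x 0F ⊛ P₁₈.partitions
  x₀-product = tripleProduct (xQ 0F) (+ 3) 9 9 (s≤s z≤n) (x-exponents 0F) (x-values 0F) N (x-central 0F)

  x₁-product : factors (+ 3 , 15) 18 N ⊛ factors (-[1+ 2 ] , 3) 18 N ⊛ mon (+ 1 , 1) ≈ x 1F ⊛ P₁₈.partitions
  x₁-product = tripleProduct (xQ 1F) (+ 3) 15 3 (s≤s z≤n) (x-exponents 1F) (x-values 1F) N (x-central 1F)

  x₂-product : factors (+ 3 , 3) 18 N ⊛ factors (-[1+ 2 ] , 15) 18 N ⊛ mon (-[1+ 0 ] , 1) ≈ x 2F ⊛ P₁₈.partitions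
  x₂-product = tripleProduct (xQ 2F) (+ 3) 3 15 (s≤s z≤n) (x-exponents 2F) (x-values 2F) N (x-central 2F)

  factors-mod3 : ∀ ζ → factors (ζ , 3) 6 (N ℕ.* 3) ≈
                 factors (ζ , 3) 18 N ⊛ (factors (ζ , 9) 18 N ⊛ factors (ζ , 15) 18 N)
  factors-mod3 ζ = ≈-trans (prod-mod3 _ N) (*-cong (prod-cong N (factor 0)) (*-cong (prod-cong N (factor 1)) (prod-cong N (factor 2))))
    where
    degrees : ∀ i k → 3 ℕ.+ (i ℕ.+ k ℕ.* 3) ℕ.* 6 ≡ 3 ℕ.+ i ℕ.* 6 ℕ.+ k ℕ.* 18
    degrees = solve-∀
    factor : ∀ i k → 𝟙 ⊕ mon (ζ , 3) ⊛ Q^ 6 ^ (i ℕ.+ k ℕ.* 3) ≈ 𝟙 ⊕ mon (ζ , 3 ℕ.+ i ℕ.* 6) ⊛ Q^ 18 ^ k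
    factor i k = +-cong ≈-refl (≈-trans (mon-⊛-Q^ _ 6 (i ℕ.+ k ℕ.* 3))
      (≈-trans (≡⇒≈ (cong (λ n → mon (ζ , n)) (degrees i k))) (≈-sym (mon-⊛-Q^ _ 18 k))))

  Q^-zfree : ∀ d → ZFree (Q^ d)
  Q^-zfree d = mon-graded ((+ 0) by refl)

  P₆-zfree : ZFree P₆.partitions
  P₆-zfree = P₆.partitions-graded zdeg-additive 𝟙-zfree (Q^-zfree 6)

  P₁₈-zfree : ZFree P₁₈.partitions
  P₁₈-zfree = P₁₈.partitions-graded zdeg-additive 𝟙-zfree (Q^-zfree 18)

  ct-Eall : ct Eall ≈ 𝟙
  ct-Eall = ≈-trans (keep-cong z⁰ Eall≈E₀+E₁+E₂) (≈-trans
    (ct-⊕ _ _ ct-E₀ (ct-⊕ _ _ (ct-E-𝟘 1F) (ct-E-𝟘 2F)))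
    (solve 0 (con 1 :+ (con 0 :+ con 0) := con 1) ≈-refl))

  -- Both sides are the constant term of ∏ (1 + z³ Q⁶ʲ⁺³) (1 + z⁻³ Q⁶ʲ⁺³), whose factors
  -- are grouped by j modulo 3 on the left.
  P₁₈³⊛M : P₁₈.partitions ^ 3 ⊛ M ≈ Q^ 2 ⊛ P₆.partitions
  P₁₈³⊛M = begin
    p ^ 3 ⊛ M                                     ≈⟨ *-identityʳ _ ⟨
    p ^ 3 ⊛ M ⊛ 𝟙                                 ≈⟨ ct-scale Eall (zfree-⊛ p³-zfree M-zfree) ct-Eall ⟨
    ct (p ^ 3 ⊛ M ⊛ Eall)                         ≈⟨ keep-cong z⁰ (begin
      p ^ 3 ⊛ M ⊛ Eall
        ≈⟨ ⊛-congˡ _ Eall≈E₀+E₁+E₂ ⟩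
      p ^ 3 ⊛ M ⊛ (E 0F ⊕ (E 1F ⊕ E 2F))
        ≈⟨ solve 5 (λ p M e f g → p :^ 3 :* M :* (e :+ (f :+ g)) := p :^ 3 :* (M :* e :+ (M :* f :+ M :* g)))
             ≈-refl p M (E 0F) (E 1F) (E 2F) ⟩
      p ^ 3 ⊛ (M ⊛ E 0F ⊕ (M ⊛ E 1F ⊕ M ⊛ E 2F))
        ≈⟨ ⊛-congˡ _ x₀x₁x₂ ⟨
      p ^ 3 ⊛ (x 0F ⊛ (x 1F ⊛ x 2F))
        ≈⟨ solve 4 (λ p x y z → p :^ 3 :* (x :* (y :* z)) := x :* p :* (y :* p :* (z :* p)))
             ≈-refl p (x 0F) (x 1F) (x 2F) ⟩
      x 0F ⊛ p ⊛ (x 1F ⊛ p ⊛ (x 2F ⊛ p))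
        ≈⟨ *-cong x₀-product (*-cong x₁-product x₂-product) ⟨
      u₉ ⊛ v₉ ⊛ mon (+ 0 , 0) ⊛ (u₁₅ ⊛ v₃ ⊛ mon (+ 1 , 1) ⊛ (u₃ ⊛ v₁₅ ⊛ mon (-[1+ 0 ] , 1)))
        ≈⟨ solve 9 (λ u₃ u₉ u₁₅ v₃ v₉ v₁₅ a b c → u₉ :* v₉ :* a :* (u₁₅ :* v₃ :* b :* (u₃ :* v₁₅ :* c)) :=
             a :* (b :* c) :* (u₃ :* (u₉ :* u₁₅) :* (v₃ :* (v₉ :* v₁₅))))
             ≈-refl u₃ u₉ u₁₅ v₃ v₉ v₁₅ (mon (+ 0 , 0)) (mon (+ 1 , 1)) (mon (-[1+ 0 ] , 1)) ⟩
      mon (+ 0 , 0) ⊛ (mon (+ 1 , 1) ⊛ mon (-[1+ 0 ] , 1)) ⊛ (u₃ ⊛ (u₉ ⊛ u₁₅) ⊛ (v₃ ⊛ (v₉ ⊛ v₁₅)))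
        ≈⟨ *-cong (≈-trans (⊛-congˡ _ (mon-⊛ _ _)) (mon-⊛ _ _)) (≈-sym (*-cong (factors-mod3 (+ 3)) (factors-mod3 -[1+ 2 ]))) ⟩
      Q^ 2 ⊛ (factors (+ 3 , 3) 6 (N ℕ.* 3) ⊛ factors (-[1+ 2 ] , 3) 6 (N ℕ.* 3))
        ≈⟨ ⊛-congˡ _ Eall-product ⟩
      Q^ 2 ⊛ (Eall ⊛ P₆.partitions)
        ≈⟨ solve 3 (λ q e p → q :* (e :* p) := q :* p :* e) ≈-refl (Q^ 2) Eall P₆.partitions ⟩
      Q^ 2 ⊛ P₆.partitions ⊛ Eall ∎) ⟩
    ct (Q^ 2 ⊛ P₆.partitions ⊛ Eall)              ≈⟨ ct-scale Eall (zfree-⊛ (Q^-zfree 2) P₆-zfree) ct-Eall ⟩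
    Q^ 2 ⊛ P₆.partitions ⊛ 𝟙                      ≈⟨ *-identityʳ _ ⟩
    Q^ 2 ⊛ P₆.partitions                          ∎
    where
    open ≈-Reasoning
    open CommutativeSemiring laurent using (*-identityʳ)
    p u₃ u₉ u₁₅ v₃ v₉ v₁₅ : Laurent
    p = P₁₈.partitions
    u₃ = factors (+ 3 , 3) 18 N
    u₉ = factors (+ 3 , 9) 18 N
    u₁₅ = factors (+ 3 , 15) 18 N
    v₃ = factors (-[1+ 2 ] , 3) 18 N
    v₉ = factors (-[1+ 2 ] , 9) 18 N
    v₁₅ = factors (-[1+ 2 ] , 15) 18 N
    p³-zfree : ZFree (p ^ 3)
    p³-zfree = zfree-⊛ P₁₈-zfree (zfree-⊛ P₁₈-zfree (zfree-⊛ P₁₈-zfree 𝟙-zfree))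

-- Frobenius partitions as coefficients of a product

∑-cong-All : {A : Set} {f g : A → ℕ} {xs : List A} → All (λ x → f x ≡ g x) xs → ∑ f xs ≡ ∑ g xs
∑-cong-All []       = refl
∑-cong-All (p ∷ ps) = cong₂ ℕ._+_ p (∑-cong-All ps)

indicator : {P : Set} → Dec P → ℕ
indicator P? = if does P? then 1 else 0

length-filter : {A : Set} {P : A → Set} (P? : U.Decidable P) → ∀ xs →
                length (filter P? xs) ≡ ∑ (λ x → indicator (P? x)) xs
length-filter P? []       = refl
length-filter P? (x ∷ xs) with does (P? x)
... | true  = cong suc (length-filter P? xs)
... | false = length-filter P? xs

_≟ᵐ_ : (s t : Mon) → Dec (s ≡ t)
_≟ᵐ_ = ≡-dec ℤ._≟_ ℕ._≟_

coefficientAt : Mon → Mon → ℕ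
coefficientAt s t = indicator (t ≟ᵐ s)

sublists-isRow : ∀ {k} {ys : List (Entry k)} → IsRow ys → All IsRow (sublists ys)
sublists-isRow []                = [] ∷ []
sublists-isRow {ys = y ∷ ys} (p ∷ r) = All.++⁺
  (All.map⁺ (All.tabulate λ {as} as∈ →
    All.tabulate (λ z∈as → All.lookup p (sublists-⊆ ys as∈ z∈as)) ∷ All.lookup (sublists-isRow r) as∈))
  (sublists-isRow r)

-- The 1 that each column adds to the size is shared equally by its two entries, so an entry j has
-- weight q^(j + 1/2) = Q^(6j + 3) in either row. This makes the product symmetric, and an array of
-- size n has degree 6n. With `ζ` equal to 1 above and -1 below, z-degree 0 means rows of equal
-- length.
entryWeight : ∀ {k} → ℤ → Entry k → Mon
entryWeight ζ (j , _) = ζ , 3 ℕ.+ j ℕ.* 6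

rowWeight : ∀ {k} → ℤ → List (Entry k) → Mon
rowWeight ζ = foldr (λ x s → entryWeight ζ x ∙ s) (+ 0 , 0)

rowWeight≡ : ∀ {k} ζ (as : List (Entry k)) →
             rowWeight ζ as ≡ (ζ ℤ.* + length as , 3 ℕ.* length as ℕ.+ 6 ℕ.* rowSum as)
rowWeight≡ ζ []       = cong (_, 0) (sym (ℤ.*-zeroʳ ζ))
rowWeight≡ ζ ((j , c) ∷ as) = trans (cong (entryWeight ζ (j , c) ∙_) (rowWeight≡ ζ as))
  (cong₂ _,_ (trans (z-identity ζ (+ length as)) (cong (ζ ℤ.*_) (sym (ℤ.pos-+ 1 (length as)))))
             (q-identity j (length as) (rowSum as)))
  where
  z-identity : ∀ z l → z ℤ.+ z ℤ.* l ≡ z ℤ.* (+ 1 ℤ.+ l)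
  z-identity = ℤ.solve-∀
  q-identity : ∀ j l r → 3 ℕ.+ j ℕ.* 6 ℕ.+ (3 ℕ.* l ℕ.+ 6 ℕ.* r) ≡ 3 ℕ.* suc l ℕ.+ 6 ℕ.* (j ℕ.+ r)
  q-identity = solve-∀

arrayWeight : ∀ {k} → Array k → Mon
arrayWeight (as , bs) = rowWeight (+ 1) as ∙ rowWeight -[1+ 0 ] bs

isFrobenius⇔weight : ∀ {k} n (as bs : List (Entry k)) → IsRow as → IsRow bs →
                     IsFrobenius n (as , bs) ⇔ arrayWeight (as , bs) ≡ (+ 0 , 6 ℕ.* n)
isFrobenius⇔weight n as bs ra rb = mk⇔ to from
  where
  weight≡ : arrayWeight (as , bs) ≡
    (+ length as ℤ.- + length bs , 3 ℕ.* length as ℕ.+ 6 ℕ.* rowSum as ℕ.+ (3 ℕ.* length bs ℕ.+ 6 ℕ.* rowSum bs))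
  weight≡ = trans (cong₂ _∙_ (rowWeight≡ (+ 1) as) (rowWeight≡ -[1+ 0 ] bs))
    (cong₂ _,_ (identity (+ length as) (+ length bs)) refl)
    where
    identity : ∀ l m → + 1 ℤ.* l ℤ.+ -[1+ 0 ] ℤ.* m ≡ l ℤ.- m
    identity = ℤ.solve-∀
  total : ∀ l a b → 3 ℕ.* l ℕ.+ 6 ℕ.* a ℕ.+ (3 ℕ.* l ℕ.+ 6 ℕ.* b) ≡ 6 ℕ.* (l ℕ.+ (a ℕ.+ b))
  total = solve-∀
  to : IsFrobenius n (as , bs) → arrayWeight (as , bs) ≡ (+ 0 , 6 ℕ.* n)
  to (_ , _ , l , w) = trans weight≡ (cong₂ _,_
    (trans (cong (λ m → + length as ℤ.- + m) (sym l)) (ℤ.+-inverseʳ (+ length as)))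
    (trans (cong (λ m → 3 ℕ.* length as ℕ.+ 6 ℕ.* rowSum as ℕ.+ (3 ℕ.* m ℕ.+ 6 ℕ.* rowSum bs)) (sym l))
           (trans (total (length as) (rowSum as) (rowSum bs)) (cong (6 ℕ.*_) (sym w)))))
  from : arrayWeight (as , bs) ≡ (+ 0 , 6 ℕ.* n) → IsFrobenius n (as , bs)
  from e = ra , rb , l , ℕ.*-cancelˡ-≡ n _ 6 (trans (sym (cong proj₂ e′))
    (trans (cong (λ m → 3 ℕ.* length as ℕ.+ 6 ℕ.* rowSum as ℕ.+ (3 ℕ.* m ℕ.+ 6 ℕ.* rowSum bs)) (sym l))
           (total (length as) (rowSum as) (rowSum bs))))
    where
    e′ = trans (sym weight≡) e
    l : length as ≡ length bs
    l = ℤ.+-injective (ℤ.i-j≡0⇒i≡j (+ length as) (+ length bs) (cong proj₁ e′))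

rows : ∀ k → ℕ → List (List (Entry k))
rows k n = sublists (entriesBelow k n)

cφ≡coefficient : ∀ k n → cφ k n ≡
  ∑ (coefficientAt (+ 0 , 6 ℕ.* n)) (map (rowWeight (+ 1)) (rows k n) ⊛ map (rowWeight -[1+ 0 ]) (rows k n))
cφ≡coefficient k n = begin
  cφ k n
    ≡⟨ length-filter (isFrobenius? n) (candidates k n) ⟩
  ∑ (λ π → indicator (isFrobenius? n π)) (candidates k n)
    ≡⟨ ∑-cartesianProductWith _ _,_ (rows k n) (rows k n) ⟩
  ∑ (λ as → ∑ (λ bs → indicator (isFrobenius? n (as , bs))) (rows k n)) (rows k n)
    ≡⟨ ∑-cong-All (All.map (λ {as} ra → ∑-cong-All (All.map (λ {bs} rb →
         cong (λ b → if b then 1 else 0) (does-⇔ (isFrobenius⇔weight n as bs ra rb) (isFrobenius? n (as , bs))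
           (arrayWeight (as , bs) ≟ᵐ (+ 0 , 6 ℕ.* n)))) all-rows)) all-rows) ⟩
  ∑ (λ as → ∑ (λ bs → φ (rowWeight (+ 1) as ∙ rowWeight -[1+ 0 ] bs)) (rows k n)) (rows k n)
    ≡⟨ ∑-cong (λ as → ∑-map _ (rowWeight -[1+ 0 ]) (rows k n)) (rows k n) ⟨
  ∑ (λ as → ∑ (λ t → φ (rowWeight (+ 1) as ∙ t)) (map (rowWeight -[1+ 0 ]) (rows k n))) (rows k n)
    ≡⟨ ∑-map _ (rowWeight (+ 1)) (rows k n) ⟨
  ∑ (λ s → ∑ (λ t → φ (s ∙ t)) (map (rowWeight -[1+ 0 ]) (rows k n))) (map (rowWeight (+ 1)) (rows k n))
    ≡⟨ ∑-⊛ φ _ _ ⟨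
  ∑ φ (map (rowWeight (+ 1)) (rows k n) ⊛ map (rowWeight -[1+ 0 ]) (rows k n)) ∎
  where
  open ≡-Reasoning
  φ = coefficientAt (+ 0 , 6 ℕ.* n)
  all-rows : All IsRow (rows k n)
  all-rows = sublists-isRow (entriesBelow-isRow k n)


factor : ℤ → ℕ → Laurent
factor ζ j = 𝟙 ⊕ mon (ζ , 3 ℕ.+ j ℕ.* 6)

opaque
  unfolding 𝟙 mon

  ∑-𝟙⊛ : ∀ φ u → ∑ φ (𝟙 ⊛ u) ≡ ∑ φ u
  ∑-𝟙⊛ φ u = trans (∑-⊛ φ 𝟙 u)
    (trans (ℕ.+-identityʳ _) (∑-cong (λ (m , k) → cong φ (cong (_, k) (ℤ.+-identityˡ m))) u))

  ∑-mon⊛ : ∀ φ s u → ∑ φ (mon s ⊛ u) ≡ ∑ (λ t → φ (s ∙ t)) u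
  ∑-mon⊛ φ s u = trans (∑-⊛ φ (mon s) u) (ℕ.+-identityʳ _)

  ∑-⊕⊛ : ∀ φ u v w → ∑ φ ((u ⊕ v) ⊛ w) ≡ ∑ φ (u ⊛ w) ℕ.+ ∑ φ (v ⊛ w)
  ∑-⊕⊛ φ u v w = trans (∑-⊛ φ (u ⊕ v) w) (trans (∑-⊕ _ u v) (sym (cong₂ ℕ._+_ (∑-⊛ φ u w) (∑-⊛ φ v w))))

module RowProduct (K : ℕ) where
  open Truncated K
  open CommutativeSemiring laurent using (setoid; *-cong; *-congˡ; *-assoc; *-comm; *-identityˡ; +-congˡ; +-identityʳ)
  open Products laurent
  open Exp laurent using (_^_; ^-distrib-*)
  open import Relation.Binary.Reasoning.Setoid setoid

  entryProduct : ∀ {k} → ℤ → List (Entry k) → Laurent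
  entryProduct ζ = foldr (λ x u → factor ζ (proj₁ x) ⊛ u) 𝟙

  -- Each entry is either taken or left out, which corresponds to the two summands of its factor.
  rows≈entryProduct : ∀ {k} ζ (xs : List (Entry k)) → map (rowWeight ζ) (sublists xs) ≈ entryProduct ζ xs
  rows≈entryProduct ζ []       = base
    where
    opaque
      unfolding 𝟙
      base : (+ 0 , 0) ∷ [] ≈ 𝟙
      base = ≡⇒≈ refl
  rows≈entryProduct ζ (x ∷ xs) = ≈-trans split (⊛-congˡ (factor ζ (proj₁ x)) (rows≈entryProduct ζ xs))
    where
    R = sublists xs
    split : map (rowWeight ζ) (sublists (x ∷ xs)) ≈ factor ζ (proj₁ x) ⊛ map (rowWeight ζ) R
    split .at φ _ = ≡.begin
      ∑ φ (map (rowWeight ζ) (map (x ∷_) R ++ R))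
        ≡.≡⟨ ∑-map φ (rowWeight ζ) (map (x ∷_) R ++ R) ⟩
      ∑ (φ ∘ rowWeight ζ) (map (x ∷_) R ++ R)
        ≡.≡⟨ ∑-++ _ (map (x ∷_) R) R ⟩
      ∑ (φ ∘ rowWeight ζ) (map (x ∷_) R) ℕ.+ ∑ (φ ∘ rowWeight ζ) R
        ≡.≡⟨ cong₂ ℕ._+_ (trans (∑-map _ (x ∷_) R) (sym (∑-map _ (rowWeight ζ) R))) (sym (∑-map φ (rowWeight ζ) R)) ⟩
      ∑ (λ t → φ (entryWeight ζ x ∙ t)) (map (rowWeight ζ) R) ℕ.+ ∑ φ (map (rowWeight ζ) R)
        ≡.≡⟨ ℕ.+-comm (∑ (λ t → φ (entryWeight ζ x ∙ t)) (map (rowWeight ζ) R)) _ ⟩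
      ∑ φ (map (rowWeight ζ) R) ℕ.+ ∑ (λ t → φ (entryWeight ζ x ∙ t)) (map (rowWeight ζ) R)
        ≡.≡⟨ cong₂ ℕ._+_ (∑-𝟙⊛ φ _) (∑-mon⊛ φ (entryWeight ζ x) _) ⟨
      ∑ φ (𝟙 ⊛ map (rowWeight ζ) R) ℕ.+ ∑ φ (mon (entryWeight ζ x) ⊛ map (rowWeight ζ) R)
        ≡.≡⟨ ∑-⊕⊛ φ 𝟙 _ _ ⟨
      ∑ φ (factor ζ (proj₁ x) ⊛ map (rowWeight ζ) R) ≡.∎
      where module ≡ = ≡-Reasoning

  entryProduct-row : ∀ {k} ζ j (cs : List (Fin k)) xs →
    entryProduct ζ (map (j ,_) cs ++ xs) ≈ factor ζ j ^ length cs ⊛ entryProduct ζ xs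
  entryProduct-row ζ j []       xs = ≈-sym (*-identityˡ _)
  entryProduct-row ζ j (c ∷ cs) xs =
    ≈-trans (⊛-congˡ (factor ζ j) (entryProduct-row ζ j cs xs)) (≈-sym (*-assoc _ _ _))

  entryProduct-rectangle : ∀ {k} ζ n (cs : List (Fin k)) →
    entryProduct ζ (cartesianProduct (downFrom n) cs) ≈ prod (λ j → factor ζ j ^ length cs) n
  entryProduct-rectangle ζ zero    cs = ≡⇒≈ refl
  entryProduct-rectangle ζ (suc n) cs =
    ≈-trans (entryProduct-row ζ n cs _) (⊛-congˡ _ (entryProduct-rectangle ζ n cs))

  𝟙^ : ∀ k → 𝟙 ≈ 𝟙 ^ k
  𝟙^ zero    = ≡⇒≈ refl
  𝟙^ (suc k) = ≈-trans (𝟙^ k) (≈-sym (*-identityˡ _))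

  prod-^ : ∀ f k n → prod (λ j → f j ^ k) n ≈ prod f n ^ k
  prod-^ f k zero    = 𝟙^ k
  prod-^ f k (suc n) = ≈-trans (⊛-congˡ _ (prod-^ f k n)) (≈-sym (^-distrib-* (f n) (prod f n) k))

  factor-high : ∀ ζ j → K < 3 ℕ.+ j ℕ.* 6 → factor ζ j ≈ 𝟙
  factor-high ζ j K< .at φ good = trans (∑-⊕ φ 𝟙 _)
    (trans (cong (∑ φ 𝟙 ℕ.+_) (trans (∑-mon φ _) (good _ K<))) (ℕ.+-identityʳ _))

  -- The enumeration stops at entries below `n`, whereas the triple product has more factors; those
  -- of degree above `K` are 1.
  prod-stable : ∀ ζ n i → K < 3 ℕ.+ n ℕ.* 6 → prod (factor ζ) (i ℕ.+ n) ≈ prod (factor ζ) n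
  prod-stable ζ n zero    K< = ≡⇒≈ refl
  prod-stable ζ n (suc i) K< = ≈-trans
    (*-cong (factor-high ζ (i ℕ.+ n) (ℕ.<-≤-trans K< (ℕ.+-monoʳ-≤ 3 (ℕ.*-monoˡ-≤ 6 (ℕ.m≤n+m n i))))) (prod-stable ζ n i K<))
    (*-identityˡ _)

  rows≈prod : ∀ k n i ζ → K < 3 ℕ.+ n ℕ.* 6 → map (rowWeight ζ) (rows k n) ≈ prod (factor ζ) (i ℕ.+ n) ^ k
  rows≈prod k n i ζ K< = begin
    map (rowWeight ζ) (rows k n)                     ≈⟨ rows≈entryProduct ζ (entriesBelow k n) ⟩
    entryProduct ζ (entriesBelow k n)                ≈⟨ entryProduct-rectangle ζ n (allFin k) ⟩
    prod (λ j → factor ζ j ^ length (allFin k)) n    ≈⟨ prod-^ (factor ζ) (length (allFin k)) n ⟩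
    prod (factor ζ) n ^ length (allFin k)            ≡⟨ cong (prod (factor ζ) n ^_) length-allFin ⟩
    prod (factor ζ) n ^ k                            ≈⟨ ^-cong k (prod-stable ζ n i K<) ⟨
    prod (factor ζ) (i ℕ.+ n) ^ k                    ∎
    where
    length-allFin : length (allFin k) ≡ k
    length-allFin = List.length-tabulate {n = k} (λ c → c)
    ^-cong : ∀ {u v} k → u ≈ v → u ^ k ≈ v ^ k
    ^-cong zero    e = ≡⇒≈ refl
    ^-cong (suc k) e = *-cong e (^-cong k e)

-- Divisibility in residue classes of degrees

∑-∣ : {A : Set} {f : A → ℕ} {m : ℕ} {xs : List A} → All (λ x → m ∣ f x) xs → m ∣ ∑ f xs
∑-∣ {m = m} []       = m ∣0
∑-∣         (p ∷ ps) = ∣m∣n⇒∣m+n p (∑-∣ ps)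

-- The coefficients of index congruent to r modulo 3 are divisible by m.
DivisibleAt : ℕ → Fin 3 → ∀ {d} → BinaryForm d → Set
DivisibleAt m 0F {zero} (n ∷ []) = m ∣ n
DivisibleAt m (suc _) {zero}  (n ∷ []) = ⊤
DivisibleAt m 0F {suc d} (n ∷ p)  = m ∣ n × DivisibleAt m 2F p
DivisibleAt m 1F {suc d} (n ∷ p)  = DivisibleAt m 0F p
DivisibleAt m 2F {suc d} (n ∷ p)  = DivisibleAt m 1F p

divisibleAt? : ∀ m r {d} (p : BinaryForm d) → Dec (DivisibleAt m r p)
divisibleAt? m 0F {zero}  (n ∷ []) = m ∣? n
divisibleAt? m (suc _) {zero}  (n ∷ []) = yes tt
divisibleAt? m 0F {suc d} (n ∷ p)  = m ∣? n ×-dec divisibleAt? m 2F p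
divisibleAt? m 1F {suc d} (n ∷ p)  = divisibleAt? m 0F p
divisibleAt? m 2F {suc d} (n ∷ p)  = divisibleAt? m 1F p

module Divisibility (K : ℕ) where
  open ThetaProduct K public

  -- The coefficients of w in degrees congruent to r modulo 9 are divisible by m.
  record Div (m : ℕ) (r : ℤ) (w : Laurent) : Set where
    constructor div
    field at-degree : ∀ φ → Good φ → (∀ s → ¬ Congruent (+ 9) r (qdeg s) → φ s ≡ 0) → m ∣ ∑ φ w
  open Div public

  div-≈ : ∀ {m r u v} → u ≈ v → Div m r v → Div m r u
  div-≈ {m} e d .at-degree φ good off = subst (m ∣_) (sym (e .at φ good)) (d .at-degree φ good off)

  div-⊕ : ∀ {m r u v} → Div m r u → Div m r v → Div m r (u ⊕ v)
  div-⊕ {m} {r} {u} {v} p q .at-degree φ good off =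
    subst (m ∣_) (sym (∑-⊕ φ u v)) (∣m∣n⇒∣m+n (p .at-degree φ good off) (q .at-degree φ good off))

  congruent-cancelˡ : ∀ {d r r′ n n′} → Congruent d r n → Congruent d (r ℤ.+ r′) (n ℤ.+ n′) → Congruent d r′ n′
  congruent-cancelˡ {d} {r} {r′} {n} {n′} (k by e) (j by e′) = (j ℤ.- k) by
    trans (identity n n′) (trans (cong₂ ℤ._-_ e′ e) (identity′ d j k r r′))
    where
    identity : ∀ n n′ → n′ ≡ n ℤ.+ n′ ℤ.- n
    identity = ℤ.solve-∀
    identity′ : ∀ d j k r r′ → d ℤ.* j ℤ.+ (r ℤ.+ r′) ℤ.- (d ℤ.* k ℤ.+ r) ≡ d ℤ.* (j ℤ.- k) ℤ.+ r′
    identity′ = ℤ.solve-∀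

  div-⊛ : ∀ {m r r′ u w} → Graded qdeg (+ 9) r u → Div m r′ w → Div m (r ℤ.+ r′) (u ⊛ w)
  div-⊛ {m} {u = u} {w} (graded g) d .at-degree φ good off = subst (m ∣_) (sym (∑-⊛ φ u w))
    (∑-∣ (All.map (λ {s} p → d .at-degree (λ t → φ (s ∙ t))
      (λ t K<t → good (s ∙ t) (ℕ.<-≤-trans K<t (ℕ.m≤n+m (deg t) (deg s))))
      (λ t ¬q → off (s ∙ t) (λ q → ¬q (congruent-cancelˡ p q)))) g))

  div-shift : ∀ {m r r′ w} → Congruent (+ 9) r r′ → Div m r′ w → Div m r w
  div-shift {r = r} {r′} p d .at-degree φ good off = d .at-degree φ good
    (λ s ¬q → off s (λ q → ¬q (congruent-back p q)))
    where
    congruent-back : ∀ {n} → Congruent (+ 9) r r′ → Congruent (+ 9) r n → Congruent (+ 9) r′ n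
    congruent-back {n} (k by e) (j by e′) = (j ℤ.- k) by trans e′ (trans (identity j k r) (cong (λ r′ → + 9 ℤ.* (j ℤ.- k) ℤ.+ r′) (sym e)))
      where
      identity : ∀ j k r → + 9 ℤ.* j ℤ.+ r ≡ + 9 ℤ.* (j ℤ.- k) ℤ.+ (+ 9 ℤ.* k ℤ.+ r)
      identity = ℤ.solve-∀

  div-off : ∀ {m r r′ w} → ¬ Congruent (+ 9) r r′ → Graded qdeg (+ 9) r′ w → Div m r w
  div-off {m} {r} {r′} ¬p (graded g) .at-degree φ good off =
    ∑-∣ (All.map (λ {s} q → subst (m ∣_) (sym (off s (λ q′ → ¬p (compare q q′)))) (m ∣0)) g)
    where
    compare : ∀ {n} → Congruent (+ 9) r′ n → Congruent (+ 9) r n → Congruent (+ 9) r r′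
    compare {n} (k by e) (j by e′) = (j ℤ.- k) by
      trans (identity k r′) (trans (cong (ℤ._- (+ 9 ℤ.* k)) (trans (sym e) e′)) (identity′ j k r))
      where
      identity : ∀ k r′ → r′ ≡ + 9 ℤ.* k ℤ.+ r′ ℤ.- + 9 ℤ.* k
      identity = ℤ.solve-∀
      identity′ : ∀ j k r → + 9 ℤ.* j ℤ.+ r ℤ.- + 9 ℤ.* k ≡ + 9 ℤ.* (j ℤ.- k) ℤ.+ r
      identity′ = ℤ.solve-∀

  ∑-num : ∀ n φ w → ∑ φ (num n ⊛ w) ≡ n ℕ.* ∑ φ w
  ∑-num zero          φ w = trans (∑-⊛ φ 𝟘 w) (∑-𝟘 _)
  ∑-num (suc zero)    φ w = trans (∑-𝟙⊛ φ w) (sym (ℕ.*-identityˡ _))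
  ∑-num (suc (suc n)) φ w = trans (∑-⊕⊛ φ (num (suc n)) 𝟙 w)
    (trans (cong₂ ℕ._+_ (∑-num (suc n) φ w) (∑-𝟙⊛ φ w)) (ℕ.+-comm _ (∑ φ w)))

  div-num : ∀ {m r n} w → m ∣ n → Div m r (num n ⊛ w)
  div-num {m} {n = n} w m∣n .at-degree φ _ _ = subst (m ∣_) (sym (∑-num n φ w)) (∣m⇒∣m*n (∑ φ w) m∣n)

  opaque
    unfolding 𝟙
    𝟙-graded : Graded qdeg (+ 9) (+ 0) 𝟙
    𝟙-graded = graded (((+ 0) by refl) ∷ [])

  num-graded : ∀ n → Graded qdeg (+ 9) (+ 0) (num n)
  num-graded zero          = graded-𝟘
  num-graded (suc zero)    = 𝟙-graded
  num-graded (suc (suc n)) = graded-⊕ (num-graded (suc n)) 𝟙-graded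

  A-graded : Graded qdeg (+ 9) (+ 0) A
  A-graded = graded-⟪⟫ (λ (y , z) → (y ℤ.* y ℤ.+ y ℤ.* z ℤ.+ z ℤ.* z ℤ.+ (y ℤ.* y ℤ.+ y ℤ.* z ℤ.+ z ℤ.* z)) by
    trans (size≡value (proj₂ (σQ (cubicQ (+ 0) (y , z))))) (identity y z)) B²
    where
    identity : ∀ y z →
      + 3 ℤ.* ((+ 0 ℤ.- y ℤ.- z ℤ.- y) ℤ.* (+ 0 ℤ.- y ℤ.- z ℤ.- y) ℤ.+
        ((y ℤ.- z) ℤ.* (y ℤ.- z) ℤ.+ (z ℤ.- (+ 0 ℤ.- y ℤ.- z)) ℤ.* (z ℤ.- (+ 0 ℤ.- y ℤ.- z)))) ≡
      + 9 ℤ.* (y ℤ.* y ℤ.+ y ℤ.* z ℤ.+ z ℤ.* z ℤ.+ (y ℤ.* y ℤ.+ y ℤ.* z ℤ.+ z ℤ.* z)) ℤ.+ + 0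
    identity = ℤ.solve-∀

  t-graded : Graded qdeg (+ 9) (+ 6) t
  t-graded = graded-⟪⟫ (λ (b , c) →
    (+ 3 ℤ.* ((b ℤ.+ c) ℤ.* (b ℤ.+ c)) ℤ.+ + 3 ℤ.* (b ℤ.* b) ℤ.+ + 2 ℤ.* b ℤ.+ + 3 ℤ.* (c ℤ.* c) ℤ.- + 2 ℤ.* c) by
    trans (size≡value (proj₂ (σQ (MQ (b , c))))) (identity b c)) B²
    where
    identity : ∀ b c →
      + 3 ℤ.* (+ 3 ℤ.* (b ℤ.+ c) ℤ.* (+ 3 ℤ.* (b ℤ.+ c)) ℤ.+
        ((+ 3 ℤ.* b ℤ.+ + 1) ℤ.* (+ 3 ℤ.* b ℤ.+ + 1) ℤ.+ (+ 3 ℤ.* c ℤ.- + 1) ℤ.* (+ 3 ℤ.* c ℤ.- + 1))) ≡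
      + 9 ℤ.* (+ 3 ℤ.* ((b ℤ.+ c) ℤ.* (b ℤ.+ c)) ℤ.+ + 3 ℤ.* (b ℤ.* b) ℤ.+ + 2 ℤ.* b ℤ.+ + 3 ℤ.* (c ℤ.* c) ℤ.- + 2 ℤ.* c) ℤ.+ + 6
    identity = ℤ.solve-∀

  S₀-graded : Graded qdeg (+ 9) (+ 0) (S 0F)
  S₀-graded = graded-⟪⟫ (λ j → (+ 6 ℤ.* (j ℤ.* j)) by
    trans (size≡value (proj₂ (σQ (sQ 0F j)))) (identity j)) B
    where
    identity : ∀ j → + 3 ℤ.* (+ 2 ℤ.* ((+ 3 ℤ.* j ℤ.+ + 0) ℤ.* (+ 3 ℤ.* j ℤ.+ + 0))) ≡ + 9 ℤ.* (+ 6 ℤ.* (j ℤ.* j)) ℤ.+ + 0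
    identity = ℤ.solve-∀

  S₁-graded : Graded qdeg (+ 9) (+ 6) (S 1F)
  S₁-graded = graded-⟪⟫ (λ j → (+ 6 ℤ.* (j ℤ.* j) ℤ.+ + 4 ℤ.* j) by
    trans (size≡value (proj₂ (σQ (sQ 1F j)))) (identity j)) B
    where
    identity : ∀ j → + 3 ℤ.* (+ 2 ℤ.* ((+ 3 ℤ.* j ℤ.+ + 1) ℤ.* (+ 3 ℤ.* j ℤ.+ + 1))) ≡ + 9 ℤ.* (+ 6 ℤ.* (j ℤ.* j) ℤ.+ + 4 ℤ.* j) ℤ.+ + 6
    identity = ℤ.solve-∀

  P₁₈-graded : Graded qdeg (+ 9) (+ 0) P₁₈.partitions
  P₁₈-graded = P₁₈.partitions-graded qdeg-additive 𝟙-graded (mon-graded ((+ 2) by refl))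

  ^-graded : ∀ {r u} → Graded qdeg (+ 9) r u → ∀ k → Graded qdeg (+ 9) (+ k ℤ.* r) (u ^ k)
  ^-graded {r} g zero    = 𝟙-graded
  ^-graded {r} g (suc k) = subst (λ r′ → Graded qdeg (+ 9) r′ _) (identity r k)
    (graded-⊛ qdeg-additive g (^-graded g k))
    where
    identity : ∀ r k → r ℤ.+ + k ℤ.* r ≡ + suc k ℤ.* r
    identity r k = trans (identity′ r (+ k)) (cong (ℤ._* r) (sym (ℤ.pos-+ 1 k)))
      where
      identity′ : ∀ r k → r ℤ.+ k ℤ.* r ≡ (+ 1 ℤ.+ k) ℤ.* r
      identity′ = ℤ.solve-∀

  pow-graded : ∀ k → Graded qdeg (+ 9) (+ 0) (pow k)
  pow-graded zero    = 𝟙-graded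
  pow-graded (suc k) = graded-⊛ qdeg-additive A-graded (pow-graded k)

  -- The Q-exponents of tⁱ are congruent to 6i modulo 9 and those of A to 0, so the index modulo 3
  -- of a term of a form determines its class.
  class : Fin 3 → ℤ
  class 0F = + 0
  class 1F = + 6
  class 2F = + 3

  -- The leading term is a power of A and lies in class 0: it needs divisibility for `r = 0F` and is
  -- invisible otherwise. The factor t in front of the rest lowers the index by one.
  div-⟦⟧ : ∀ m r {d} (p : BinaryForm d) → DivisibleAt m r p → Div m (class r) ⟦ p ⟧
  div-⟦⟧ m 0F {zero} (n ∷ []) m∣n = div-≈ (≈-sym (CommutativeSemiring.*-identityʳ laurent (num n))) (div-num 𝟙 m∣n)
  div-⟦⟧ m 1F {zero} (n ∷ []) _ = div-off (≢0-mod 9 (+ 6)) (num-graded n)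
  div-⟦⟧ m 2F {zero} (n ∷ []) _ = div-off (≢0-mod 9 (+ 3)) (num-graded n)
  div-⟦⟧ m 0F {suc d} (n ∷ p) (m∣n , q) = div-⊕ (div-num _ m∣n)
    (div-shift ((+ 1) by refl) (div-⊛ t-graded (div-⟦⟧ m 2F p q)))
  div-⟦⟧ m 1F {suc d} (n ∷ p) q = div-⊕
    (div-off (≢0-mod 9 (+ 6)) (graded-⊛ qdeg-additive (num-graded n) (pow-graded (suc d))))
    (div-⊛ t-graded (div-⟦⟧ m 0F p q))
  div-⟦⟧ m 2F {suc d} (n ∷ p) q = div-⊕
    (div-off (≢0-mod 9 (+ 3)) (graded-⊛ qdeg-additive (num-graded n) (pow-graded (suc d))))
    (div-shift ((+ 1) by refl) (div-⊛ t-graded (div-⟦⟧ m 1F p q)))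

-- The two explicit forms of degree 20

1ᶠ : BinaryForm 0
1ᶠ = 1 ∷ []

Aᶠ tᶠ Cᶠ aᶠ : BinaryForm 1
Aᶠ = 1 ∷ 0 ∷ []
tᶠ = 0 ∷ 1 ∷ []
Cᶠ = tᶠ +ᶠ (tᶠ +ᶠ tᶠ)
aᶠ = Aᶠ +ᶠ (Cᶠ +ᶠ Cᶠ)

-- From here on each form repeats the expression of its series, so that the proof that it represents
-- the series is assembled by the same operations.
Uᶠ : BinaryForm 2
Uᶠ = Aᶠ *ᶠ Aᶠ +ᶠ (Aᶠ *ᶠ tᶠ +ᶠ Aᶠ *ᶠ tᶠ +ᶠ Aᶠ *ᶠ tᶠ +ᶠ (tᶠ +ᶠ tᶠ +ᶠ tᶠ) *ᶠ (tᶠ +ᶠ tᶠ +ᶠ tᶠ))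

Dᶠ : BinaryForm 3
Dᶠ = tᶠ *ᶠ Uᶠ

αᶠ βᶠ : BinaryForm 4
αᶠ = aᶠ *ᶠ aᶠ *ᶠ aᶠ *ᶠ Aᶠ +ᶠ scale 54 (Dᶠ *ᶠ Cᶠ) +ᶠ scale 54 (aᶠ *ᶠ Dᶠ)
βᶠ = aᶠ *ᶠ aᶠ *ᶠ aᶠ *ᶠ Cᶠ +ᶠ scale 27 (Dᶠ *ᶠ (Aᶠ +ᶠ Cᶠ)) +ᶠ scale 54 (aᶠ *ᶠ Dᶠ)

coefficient₀ᶠ coefficient₁ᶠ : BinaryForm 8
coefficient₀ᶠ = αᶠ *ᶠ αᶠ +ᶠ scale 162 (aᶠ *ᶠ aᶠ *ᶠ aᶠ *ᶠ aᶠ *ᶠ Dᶠ *ᶠ Aᶠ +ᶠ scale 6 (aᶠ *ᶠ aᶠ *ᶠ aᶠ *ᶠ Dᶠ *ᶠ Aᶠ *ᶠ Cᶠ) +ᶠ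
  scale 27 (aᶠ *ᶠ aᶠ *ᶠ Dᶠ *ᶠ Dᶠ) +ᶠ scale 54 (aᶠ *ᶠ Dᶠ *ᶠ Dᶠ *ᶠ Cᶠ) +ᶠ scale 81 (Dᶠ *ᶠ Dᶠ *ᶠ Cᶠ *ᶠ Cᶠ))
coefficient₁ᶠ = scale 2 (βᶠ *ᶠ βᶠ) +ᶠ scale 162 (scale 2 (aᶠ *ᶠ aᶠ *ᶠ aᶠ *ᶠ aᶠ *ᶠ Dᶠ *ᶠ Cᶠ) +ᶠ
  scale 6 (aᶠ *ᶠ aᶠ *ᶠ aᶠ *ᶠ Dᶠ *ᶠ Cᶠ *ᶠ (Aᶠ +ᶠ Cᶠ)) +ᶠ scale 54 (aᶠ *ᶠ aᶠ *ᶠ Dᶠ *ᶠ Dᶠ) +ᶠ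
  scale 54 (aᶠ *ᶠ Dᶠ *ᶠ Dᶠ *ᶠ (Aᶠ +ᶠ Cᶠ)) +ᶠ scale 81 (Dᶠ *ᶠ Dᶠ *ᶠ (Aᶠ *ᶠ Aᶠ +ᶠ Cᶠ *ᶠ Cᶠ)))

U⁶ᶠ : BinaryForm 12
U⁶ᶠ = Uᶠ *ᶠ (Uᶠ *ᶠ (Uᶠ *ᶠ (Uᶠ *ᶠ (Uᶠ *ᶠ (Uᶠ *ᶠ 1ᶠ)))))

form₀ form₁ : BinaryForm 20
form₀ = U⁶ᶠ *ᶠ coefficient₀ᶠ
form₁ = U⁶ᶠ *ᶠ coefficient₁ᶠ

opaque
  unfolding _*ᶠ_ _+ᶠ_

  -- The forms are concrete vectors of 21 numbers, so the divisibilities are decided by evaluation.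
  -- They come in pairs in which the index of `form₁` is one less than that of `form₀`, because S₁
  -- already has the class of one factor t.
  form₀-1 : DivisibleAt 81 1F form₀
  form₀-1 = toWitness {a? = divisibleAt? 81 1F form₀} _

  form₁-0 : DivisibleAt 81 0F form₁
  form₁-0 = toWitness {a? = divisibleAt? 81 0F form₁} _

  form₀-2 : DivisibleAt 2187 2F form₀
  form₀-2 = toWitness {a? = divisibleAt? 2187 2F form₀} _

  form₁-1 : DivisibleAt 2187 1F form₁
  form₁-1 = toWitness {a? = divisibleAt? 2187 1F form₁} _

-- The generating function in residue classes

module Constant (K : ℕ) where
  open Divisibility K public

  U : Laurent
  U = A ⊛ A ⊕ (A ⊛ t ⊕ A ⊛ t ⊕ A ⊛ t ⊕ (t ⊕ t ⊕ t) ⊛ (t ⊕ t ⊕ t))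

  A⊨ : A ⊨ Aᶠ
  A⊨ = represents (solve 2 (λ A t → A := con 1 :* (A :* con 1) :+ t :* con 0) ≈-refl A t)
  t⊨ : t ⊨ tᶠ
  t⊨ = represents (solve 2 (λ A t → t := con 0 :* (A :* con 1) :+ t :* con 1) ≈-refl A t)
  C⊨ : C ⊨ Cᶠ
  C⊨ = represents (≈-trans C≈3t ((t⊨ ⊨+ (t⊨ ⊨+ t⊨)) .proof))
  a⊨ : a ⊨ aᶠ
  a⊨ = represents (≈-trans a≈A+2C ((A⊨ ⊨+ (C⊨ ⊨+ C⊨)) .proof))
  U⊨ : U ⊨ Uᶠ
  U⊨ = A⊨ ⊨* A⊨ ⊨+ (A⊨ ⊨* t⊨ ⊨+ A⊨ ⊨* t⊨ ⊨+ A⊨ ⊨* t⊨ ⊨+ (t⊨ ⊨+ t⊨ ⊨+ t⊨) ⊨* (t⊨ ⊨+ t⊨ ⊨+ t⊨))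
  D⊨ : D ⊨ Dᶠ
  D⊨ = t⊨ ⊨* U⊨
  1⊨ : 𝟙 ⊨ 1ᶠ
  1⊨ = represents ≈-refl

  α⊨ : α′ ⊨ αᶠ
  α⊨ = a⊨ ⊨* a⊨ ⊨* a⊨ ⊨* A⊨ ⊨+ ⊨scale 54 (D⊨ ⊨* C⊨) ⊨+ ⊨scale 54 (a⊨ ⊨* D⊨)
  β⊨ : β′ ⊨ βᶠ
  β⊨ = a⊨ ⊨* a⊨ ⊨* a⊨ ⊨* C⊨ ⊨+ ⊨scale 27 (D⊨ ⊨* (A⊨ ⊨+ C⊨)) ⊨+ ⊨scale 54 (a⊨ ⊨* D⊨)

  coefficient₀⊨ : coefficient₀ ⊨ coefficient₀ᶠ
  coefficient₀⊨ = α⊨ ⊨* α⊨ ⊨+ ⊨scale 162 (a⊨ ⊨* a⊨ ⊨* a⊨ ⊨* a⊨ ⊨* D⊨ ⊨* A⊨ ⊨+ ⊨scale 6 (a⊨ ⊨* a⊨ ⊨* a⊨ ⊨* D⊨ ⊨* A⊨ ⊨* C⊨) ⊨+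
    ⊨scale 27 (a⊨ ⊨* a⊨ ⊨* D⊨ ⊨* D⊨) ⊨+ ⊨scale 54 (a⊨ ⊨* D⊨ ⊨* D⊨ ⊨* C⊨) ⊨+ ⊨scale 81 (D⊨ ⊨* D⊨ ⊨* C⊨ ⊨* C⊨))

  coefficient₁⊨ : coefficient₁ ⊨ coefficient₁ᶠ
  coefficient₁⊨ = ⊨scale 2 (β⊨ ⊨* β⊨) ⊨+ ⊨scale 162 (⊨scale 2 (a⊨ ⊨* a⊨ ⊨* a⊨ ⊨* a⊨ ⊨* D⊨ ⊨* C⊨) ⊨+
    ⊨scale 6 (a⊨ ⊨* a⊨ ⊨* a⊨ ⊨* D⊨ ⊨* C⊨ ⊨* (A⊨ ⊨+ C⊨)) ⊨+ ⊨scale 54 (a⊨ ⊨* a⊨ ⊨* D⊨ ⊨* D⊨) ⊨+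
    ⊨scale 54 (a⊨ ⊨* D⊨ ⊨* D⊨ ⊨* (A⊨ ⊨+ C⊨)) ⊨+ ⊨scale 81 (D⊨ ⊨* D⊨ ⊨* (A⊨ ⊨* A⊨ ⊨+ C⊨ ⊨* C⊨)))

  U⁶⊨ : U ^ 6 ⊨ U⁶ᶠ
  U⁶⊨ = U⊨ ⊨* (U⊨ ⊨* (U⊨ ⊨* (U⊨ ⊨* (U⊨ ⊨* (U⊨ ⊨* 1⊨)))))

  G : ℤ → Laurent
  G ζ = prod (factor ζ) N

  factors≈G : ∀ ζ → factors (ζ , 3) 6 N ≈ G ζ
  factors≈G ζ = prod-cong N (λ j → +-cong ≈-refl (mon-⊛-Q^ (ζ , 3) 6 j))

  -- The factor Q³⁶ is that of (Q² P₆)¹⁸ = (P₁₈³ M)¹⁸.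
  shiftedSeries : Q^ 36 ⊛ ct ((G (+ 1) ⊛ G -[1+ 0 ]) ^ 18) ≈
    (P₁₈.partitions ^ 3) ^ 18 ⊛ (t ^ 6 ⊛ (S 0F ⊛ ⟦ form₀ ⟧ ⊕ S 1F ⊛ ⟦ form₁ ⟧))
  shiftedSeries = begin
    Q^ 36 ⊛ ct ((G (+ 1) ⊛ G -[1+ 0 ]) ^ 18)
      ≈⟨ *-cong (≈-sym (Q^-^ 2 18)) (≈-trans (keep-cong z⁰ series) (ct-⊛ (ϑ ^ 18) P₆¹⁸-zfree)) ⟩
    Q^ 2 ^ 18 ⊛ (P₆.partitions ^ 18 ⊛ ct (ϑ ^ 18))
      ≈⟨ ⊛-assoc (Q^ 2 ^ 18) (P₆.partitions ^ 18) (ct (ϑ ^ 18)) ⟨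
    Q^ 2 ^ 18 ⊛ P₆.partitions ^ 18 ⊛ ct (ϑ ^ 18)
      ≈⟨ *-cong (≈-trans (≈-sym (^-distrib-* (Q^ 2) P₆.partitions 18)) (^-congˡ 18 (≈-sym P₁₈³⊛M))) ct-ϑ¹⁸ ⟩
    (p³ ⊛ M) ^ 18 ⊛ (coefficient₀ ⊛ S 0F ⊕ coefficient₁ ⊛ S 1F)
      ≈⟨ ⊛-congʳ _ (≈-trans (^-distrib-* p³ M 18) (⊛-congˡ (p³ ^ 18) M¹⁸)) ⟩
    p³ ^ 18 ⊛ (t ^ 6 ⊛ U ^ 6) ⊛ (coefficient₀ ⊛ S 0F ⊕ coefficient₁ ⊛ S 1F)
      ≈⟨ solve 7 (λ p t u c s d r → p :* (t :* u) :* (c :* s :+ d :* r) := p :* (t :* (s :* (u :* c) :+ r :* (u :* d))))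
           ≈-refl (p³ ^ 18) (t ^ 6) (U ^ 6) coefficient₀ (S 0F) coefficient₁ (S 1F) ⟩
    p³ ^ 18 ⊛ (t ^ 6 ⊛ (S 0F ⊛ (U ^ 6 ⊛ coefficient₀) ⊕ S 1F ⊛ (U ^ 6 ⊛ coefficient₁)))
      ≈⟨ ⊛-congˡ (p³ ^ 18) (⊛-congˡ (t ^ 6) (+-cong
           (⊛-congˡ (S 0F) ((U⁶⊨ ⊨* coefficient₀⊨) .proof)) (⊛-congˡ (S 1F) ((U⁶⊨ ⊨* coefficient₁⊨) .proof)))) ⟩
    p³ ^ 18 ⊛ (t ^ 6 ⊛ (S 0F ⊛ ⟦ form₀ ⟧ ⊕ S 1F ⊛ ⟦ form₁ ⟧)) ∎
    where
    open ≈-Reasoning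
    p³ : Laurent
    p³ = P₁₈.partitions ^ 3
    series : (G (+ 1) ⊛ G -[1+ 0 ]) ^ 18 ≈ P₆.partitions ^ 18 ⊛ ϑ ^ 18
    series = ≈-trans (^-congˡ 18 (≈-trans (≈-sym (*-cong (factors≈G (+ 1)) (factors≈G -[1+ 0 ])))
      (≈-trans ϑ-product (⊛-comm ϑ P₆.partitions)))) (^-distrib-* P₆.partitions ϑ 18)
    zfree-^ : ∀ {u} → ZFree u → ∀ k → ZFree (u ^ k)
    zfree-^ f zero    = 𝟙-zfree
    zfree-^ f (suc k) = zfree-⊛ f (zfree-^ f k)
    P₆¹⁸-zfree : ZFree (P₆.partitions ^ 18)
    P₆¹⁸-zfree = zfree-^ P₆-zfree 18
    M¹⁸ : M ^ 18 ≈ t ^ 6 ⊛ U ^ 6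
    M¹⁸ = ≈-trans (≈-sym (^-assocʳ M 3 6)) (≈-trans (^-congˡ 6 (≈-trans
      (solve 1 (λ M → M :^ 3 := M :* (M :* M)) ≈-refl M) M³≈D)) (^-distrib-* t U 6))

  previous : Fin 3 → Fin 3
  previous 0F = 2F
  previous 1F = 0F
  previous 2F = 1F

  -- The factor `t ^ 6` adds 36, which is 0 modulo 9, and the partition series adds 0. `S 0F` keeps
  -- the class, while `S 1F` adds 6 and so advances the index by one.
  div-series : ∀ m r → DivisibleAt m r form₀ → DivisibleAt m (previous r) form₁ →
               Div m (class r) (Q^ 36 ⊛ ct ((G (+ 1) ⊛ G -[1+ 0 ]) ^ 18))
  div-series m r p₀ p₁ = div-≈ shiftedSeries
    (div-shift (shift₀ r) (div-⊛ (^-graded (^-graded P₁₈-graded 3) 18) (div-⊛ (^-graded t-graded 6)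
      (div-⊕ (div-shift (shift₁ r) (div-⊛ S₀-graded (div-⟦⟧ m r form₀ p₀)))
             (div-shift (shift₂ r) (div-⊛ S₁-graded (div-⟦⟧ m (previous r) form₁ p₁)))))))
    where
    shift₀ : ∀ r → Congruent (+ 9) (class r) (+ 0 ℤ.+ (+ 36 ℤ.+ class r))
    shift₀ 0F = (+ 4) by refl
    shift₀ 1F = (+ 4) by refl
    shift₀ 2F = (+ 4) by refl
    shift₁ : ∀ r → Congruent (+ 9) (class r) (+ 0 ℤ.+ class r)
    shift₁ 0F = (+ 0) by refl
    shift₁ 1F = (+ 0) by refl
    shift₁ 2F = (+ 0) by refl
    shift₂ : ∀ r → Congruent (+ 9) (class r) (+ 6 ℤ.+ class (previous r))
    shift₂ 0F = (+ 1) by refl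
    shift₂ 1F = (+ 0) by refl
    shift₂ 2F = (+ 1) by refl

open import Data.Nat.Base using (_+_; _*_)

module Coefficient (n : ℕ) where
  open Constant (36 + 6 * n)

  -- Only the equality of the truncated semiring depends on the truncation degree, not its
  -- operations.
  prod-independent : ∀ {K K′} ζ m →
    Products.prod (Truncated.laurent K) (factor ζ) m ≡ Products.prod (Truncated.laurent K′) (factor ζ) m
  prod-independent ζ zero    = refl
  prod-independent ζ (suc m) = cong (factor ζ m ⊛_) (prod-independent ζ m)

  coefficientAt-good : ∀ K s → deg s ≤ K → Truncated.Good K (coefficientAt s)
  coefficientAt-good K s s≤K u K<u = cong (λ b → if b then 1 else 0)
    (dec-false (u ≟ᵐ s) (λ { refl → ℕ.<⇒≱ K<u s≤K }))

  private
    module Low = RowProduct (6 * n)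
    module Low≈ = Truncated (6 * n)
    open Exp Low≈.laurent using () renaming (_^_ to _^′_)

    G′ : ℤ → Laurent
    G′ ζ = Products.prod Low≈.laurent (factor ζ) N

    n≤N : n ≤ N
    n≤N = ℕ.≤-trans (ℕ.m≤n*m n 6) (ℕ.≤-trans (ℕ.m≤n+m (6 * n) 37) (ℕ.m≤n*m (suc (36 + 6 * n)) 20))

    rows≈ : ∀ ζ → map (rowWeight ζ) (rows 18 n) Low≈.≈ G′ ζ ^′ 18
    rows≈ ζ = subst (λ m → map (rowWeight ζ) (rows 18 n) Low≈.≈ Products.prod Low≈.laurent (factor ζ) m ^′ 18)
      (ℕ.m∸n+n≡m n≤N) (Low.rows≈prod 18 n (N ∸ n) ζ
        (s≤s (ℕ.≤-trans (ℕ.≤-reflexive (ℕ.*-comm 6 n)) (ℕ.m≤n+m (n * 6) 2))))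

    φ : Mon → ℕ
    φ = coefficientAt (+ 0 , 6 * n)

  -- Two truncation degrees meet here. Rows with entries below `n` agree with `G` only up to degree
  -- `6 * n`, which suffices for the coefficient of `cφ`; the factor Q³⁶ of the shifted series
  -- requires degree `36 + 6 * n`.
  cφ≡ : cφ 18 n ≡ ∑ φ ((G (+ 1) ⊛ G -[1+ 0 ]) ^ 18)
  cφ≡ = begin
    cφ 18 n
      ≡⟨ cφ≡coefficient 18 n ⟩
    ∑ φ (map (rowWeight (+ 1)) (rows 18 n) ⊛ map (rowWeight -[1+ 0 ]) (rows 18 n))
      ≡⟨ Low≈.at (CommutativeSemiring.*-cong Low≈.laurent (rows≈ (+ 1)) (rows≈ -[1+ 0 ])) φ (coefficientAt-good _ _ ℕ.≤-refl) ⟩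
    ∑ φ (G′ (+ 1) ^′ 18 ⊛ G′ -[1+ 0 ] ^′ 18)
      ≡⟨ cong₂ (λ u v → ∑ φ (u ^′ 18 ⊛ v ^′ 18)) (prod-independent (+ 1) N) (prod-independent -[1+ 0 ] N) ⟩
    ∑ φ (G (+ 1) ^ 18 ⊛ G -[1+ 0 ] ^ 18)
      ≡⟨ ^-distrib-* (G (+ 1)) (G -[1+ 0 ]) 18 .at φ (coefficientAt-good _ _ (ℕ.m≤n+m (6 * n) 36)) ⟨
    ∑ φ ((G (+ 1) ⊛ G -[1+ 0 ]) ^ 18) ∎
    where open ≡-Reasoning

  -- The functional reads a monomial of z-degree 0, so it does not notice the passage to the
  -- constant term, and the factor Q³⁶ only moves the degree that it reads.
  ∑-shift-ct : ∀ u → ∑ (coefficientAt (+ 0 , 36 + 6 * n)) (Q^ 36 ⊛ ct u) ≡ ∑ φ u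
  ∑-shift-ct u = trans (∑-mon⊛ _ (+ 0 , 36) (ct u)) (trans (∑-keep z⁰ _ u) (∑-cong pointwise u))
    where
    shifted : ∀ m k → (+ 0 , 36) ∙ (m , k) ≡ (+ 0 , 36 + 6 * n) ⇔ (m , k) ≡ (+ 0 , 6 * n)
    shifted m k = mk⇔
      (λ e → cong₂ _,_ (trans (sym (ℤ.+-identityˡ m)) (cong proj₁ e)) (ℕ.+-cancelˡ-≡ 36 k (6 * n) (cong proj₂ e)))
      (λ e → cong ((+ 0 , 36) ∙_) e)
    pointwise : ∀ s → restrict z⁰ (λ t → coefficientAt (+ 0 , 36 + 6 * n) ((+ 0 , 36) ∙ t)) s ≡ φ s
    pointwise (m , k) with m ℤ.≟ + 0
    ... | yes refl = cong (λ b → if b then 1 else 0)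
          (does-⇔ (shifted (+ 0) k) (((+ 0 , 36) ∙ (+ 0 , k)) ≟ᵐ (+ 0 , 36 + 6 * n)) ((+ 0 , k) ≟ᵐ (+ 0 , 6 * n)))
    ... | no _     = refl

  cφ-divisible : ∀ m r → Congruent (+ 9) (class r) (+ (36 + 6 * n)) →
    DivisibleAt m r form₀ → DivisibleAt m (previous r) form₁ → m ∣ cφ 18 n
  cφ-divisible m r p q₀ q₁ = subst (m ∣_) (trans (∑-shift-ct _) (sym cφ≡))
    (div-series m r q₀ q₁ .at-degree (coefficientAt (+ 0 , 36 + 6 * n)) (coefficientAt-good _ _ ℕ.≤-refl)
      (λ s ¬q → cong (λ b → if b then 1 else 0) (dec-false (s ≟ᵐ (+ 0 , 36 + 6 * n)) (λ { refl → ¬q p }))))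

theorem1p3 : (n : ℕ) → (81 ∣ cφ 18 (3 * n + 1)) × (2187 ∣ cφ 18 (3 * n + 2))
theorem1p3 n =
  Coefficient.cφ-divisible (3 * n + 1) 81 1F
    ((+ (4 + 2 * n)) by congruence₁) form₀-1 form₁-0 ,
  Coefficient.cφ-divisible (3 * n + 2) 2187 2F
    ((+ (5 + 2 * n)) by congruence₂) form₀-2 form₁-1
  where
  degree₁ : ∀ n → 36 + 6 * (3 * n + 1) ≡ 9 * (4 + 2 * n) + 6
  degree₁ = solve-∀
  degree₂ : ∀ n → 36 + 6 * (3 * n + 2) ≡ 9 * (5 + 2 * n) + 3
  degree₂ = solve-∀
  congruence₁ : + (36 + 6 * (3 * n + 1)) ≡ + 9 ℤ.* + (4 + 2 * n) ℤ.+ + 6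
  congruence₁ = trans (cong +_ (degree₁ n)) (cong (ℤ._+ + 6) (ℤ.pos-* 9 (4 + 2 * n)))
  congruence₂ : + (36 + 6 * (3 * n + 2)) ≡ + 9 ℤ.* + (5 + 2 * n) ℤ.+ + 3
  congruence₂ = trans (cong +_ (degree₂ n)) (cong (ℤ._+ + 3) (ℤ.pos-* 9 (5 + 2 * n)))
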